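{- Let $\mathcal{P}$ be a $\mathsf{CMSO}_2$-definable edge selection problem. There exists a computable function $f$ such that for every $k\in\mathbb{N}$, $\mathcal{P}$ admits an isolation scheme on graphs of treewidth at most $k$ that uses $R\coloneqq f(k)\cdot\log n+\mathcal{O}(\log^2 n)$ random bits and assigns weights upper bounded by $2^R$, where $n$ is the number of vertices.
   Context: $\mathsf{CMSO}_2$ is monadic second-order logic on graphs with variables for vertices, edges, vertex sets and edge sets, atomic formulas $x=y$, $x\in X$, $\mathsf{inc}(u,e)$ (vertex $u$ incident to edge $e$) and modular counting predicates $|X|\equiv a \bmod p$ for constants $a,p$, closed under boolean connectives, negation and existential/universal quantification over all four kinds of variables. An edge selection problem maps every graph $G$ to a family $\mathcal{P}(G)\subseteq 2^{E(G)}$; it is $\mathsf{CMSO}_2$-definable if there is a $\mathsf{CMSO}_2$ formula $\varphi(X)$ with one free edge-set variable $X$ such that $\mathcal{P}(G)=\{S\subseteq E(G): G\models\varphi(S)\}$ for every $G$. For $\omega\colon U\to\mathbb{N}$, $\omega(X)=\sum_{e\in X}\omega(e)$, and $\omega$ isolates $\mathcal{F}$ if exactly one member of $\mathcal{F}$ attains the minimum weight. An isolation scheme for $\mathcal{P}$ on a graph class $\mathcal{C}$ is, for every $n,m$, a list of weight functions $\omega_1,\ldots,\omega_\ell\colon[m]\to\mathbb{N}$ such that for every $n$-vertex $G\in\mathcal{C}$ with edges enumerated by $[m]$, at least half of the $\omega_i$ isolate $\mathcal{P}(G)$; it uses $\log\ell$ random bits and its maximum weight is the largest value of the $\omega_i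$.
   Formalization: "Isolates" is taken as "at most one member attains the minimum weight": it holds vacuously when P(G) is empty, where the literal "exactly one" would make the claim false; for nonempty P(G) the two agree. -}

module Defs where

open import Data.Nat using (ℕ; zero; suc; _+_; _*_; _^_; _≤_; _%_; NonZero)
open import Data.Nat.Logarithm using (⌈log₂_⌉)
open import Data.Bool using (Bool; true; false; if_then_else_)
open import Data.Fin using (Fin; zero; suc; toℕ)
open import Data.Fin.Subset using (Subset; ∣_∣) renaming (_∈_ to _∈ₛ_)
open import Data.Vec using ([]; _∷_)
open import Data.List using (List; []; _∷_)
open import Data.List.Membership.Propositional using (_∈_)
open import Data.List.Relation.Unary.All using (All; []; _∷_; lookup)
open import Data.Product using (Σ; ∃; _×_; _,_; proj₁; proj₂)
open import Data.Sum using (_⊎_)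
open import Data.Unit using (⊤)
open import Relation.Nullary using (¬_)
open import Relation.Binary.PropositionalEquality using (_≡_; _≢_)

SameEnds : ∀ {n} → Fin n × Fin n → Fin n × Fin n → Set
SameEnds (u , v) (u' , v') = (u ≡ u' × v ≡ v') ⊎ (u ≡ v' × v ≡ u')

record Graph (n m : ℕ) : Set where
  field
    ends     : Fin m → Fin n × Fin n
    loopless : ∀ e → proj₁ (ends e) ≢ proj₂ (ends e)
    noParallel : ∀ e e' → SameEnds (ends e) (ends e') → e ≡ e'

open Graph public

Inc : ∀ {n m} → Graph n m → Fin n → Fin m → Set
Inc G u e = (u ≡ proj₁ (ends G e)) ⊎ (u ≡ proj₂ (ends G e))

-- Treewidth.  A tree on nodes Fin (suc t) is given by parent pointers:
-- node 0 is the root, node (suc i) has parent (parent i) with index ≤ i.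

TopFor : ∀ {n t} → (Fin t → Fin (suc t)) → (Fin (suc t) → Subset n) →
         Fin n → Fin (suc t) → Set
TopFor parent bag v zero    = ⊤
TopFor parent bag v (suc i) = ¬ (v ∈ₛ bag (parent i))

record TreeDecomposition {n m} (G : Graph n m) (k : ℕ) : Set where
  field
    t        : ℕ
    parent   : Fin t → Fin (suc t)
    parent≤  : ∀ i → toℕ (parent i) ≤ toℕ i
    bag      : Fin (suc t) → Subset n
    width    : ∀ x → ∣ bag x ∣ ≤ suc k
    vertexCovered : ∀ v → ∃ λ x → v ∈ₛ bag x
    edgeCovered   : ∀ e → ∃ λ x → (proj₁ (ends G e) ∈ₛ bag x) × (proj₂ (ends G e) ∈ₛ bag x)
    -- the nodes whose bags contain v induce a connected subtree
    connected : ∀ v x y → v ∈ₛ bag x → v ∈ₛ bag y →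
                TopFor parent bag v x → TopFor parent bag v y → x ≡ y

TreewidthAtMost : ∀ {n m} → ℕ → Graph n m → Set
TreewidthAtMost k G = TreeDecomposition G k

data Sort : Set where
  vtx edg vset eset : Sort

data Formula (Γ : List Sort) : Set where
  eqV  : vtx ∈ Γ → vtx ∈ Γ → Formula Γ
  eqE  : edg ∈ Γ → edg ∈ Γ → Formula Γ
  memV : vtx ∈ Γ → vset ∈ Γ → Formula Γ
  memE : edg ∈ Γ → eset ∈ Γ → Formula Γ
  inc  : vtx ∈ Γ → edg ∈ Γ → Formula Γ
  modV : vset ∈ Γ → (a p : ℕ) → {{NonZero p}} → Formula Γ
  modE : eset ∈ Γ → (a p : ℕ) → {{NonZero p}} → Formula Γ
  neg  : Formula Γ → Formula Γ
  and  : Formula Γ → Formula Γ → Formula Γ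
  or   : Formula Γ → Formula Γ → Formula Γ
  ex   : (s : Sort) → Formula (s ∷ Γ) → Formula Γ
  all  : (s : Sort) → Formula (s ∷ Γ) → Formula Γ

Dom : ∀ {n m} → Graph n m → Sort → Set
Dom {n} {m} G vtx  = Fin n
Dom {n} {m} G edg  = Fin m
Dom {n} {m} G vset = Subset n
Dom {n} {m} G eset = Subset m

Env : ∀ {n m} → Graph n m → List Sort → Set
Env G Γ = All (Dom G) Γ

Sat : ∀ {n m Γ} (G : Graph n m) → Env G Γ → Formula Γ → Set
Sat G ρ (eqV x y)  = lookup ρ x ≡ lookup ρ y
Sat G ρ (eqE x y)  = lookup ρ x ≡ lookup ρ y
Sat G ρ (memV x X) = lookup ρ x ∈ₛ lookup ρ X
Sat G ρ (memE x X) = lookup ρ x ∈ₛ lookup ρ X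
Sat G ρ (inc u e)  = Inc G (lookup ρ u) (lookup ρ e)
Sat G ρ (modV X a p) = ∣ lookup ρ X ∣ % p ≡ a % p
Sat G ρ (modE X a p) = ∣ lookup ρ X ∣ % p ≡ a % p
Sat G ρ (neg φ)    = ¬ Sat G ρ φ
Sat G ρ (and φ ψ)  = Sat G ρ φ × Sat G ρ ψ
Sat G ρ (or φ ψ)   = Sat G ρ φ ⊎ Sat G ρ ψ
Sat G ρ (ex s φ)   = Σ (Dom G s) λ d → Sat G (d ∷ ρ) φ
Sat G ρ (all s φ)  = (d : Dom G s) → Sat G (d ∷ ρ) φ

EdgeSelectionProblem : Set₁
EdgeSelectionProblem = ∀ {n m} → Graph n m → Subset m → Set

CMSO₂Definable : EdgeSelectionProblem → Set
CMSO₂Definable P =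
  Σ (Formula (eset ∷ [])) λ φ →
    ∀ {n m} (G : Graph n m) (S : Subset m) →
      (P G S → Sat G (S ∷ []) φ) × (Sat G (S ∷ []) φ → P G S)

weight : ∀ {m} → (Fin m → ℕ) → Subset m → ℕ
weight {zero}  ω []      = 0
weight {suc m} ω (b ∷ X) = (if b then ω zero else 0) + weight (λ e → ω (suc e)) X

-- ω isolates F: at most one member of F attains the minimum weight
-- (for the nonempty finite families this is "exactly one").
Isolates : ∀ {m} → (Fin m → ℕ) → (Subset m → Set) → Set
Isolates {m} ω F =
  ∀ (S T : Subset m) → F S → F T →
    (∀ U → F U → weight ω S ≤ weight ω U) →
    (∀ U → F U → weight ω T ≤ weight ω U) → S ≡ T

IsolationScheme : EdgeSelectionProblem → (k n m R : ℕ) → Set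
IsolationScheme P k n m R =
  Σ ℕ λ ℓ → Σ (Fin ℓ → Fin m → ℕ) λ ω →
    (1 ≤ ℓ) × (⌈log₂ ℓ ⌉ ≤ R) × (∀ i e → ω i e ≤ 2 ^ R) ×
    (∀ (G : Graph n m) → TreewidthAtMost k G →
      Σ (Subset ℓ) λ I → (ℓ ≤ 2 * ∣ I ∣) × (∀ i → i ∈ₛ I → Isolates (ω i) (P G)))

module Submission where

open import Defs
open import Data.Nat using (ℕ; zero; suc; _+_; _*_; _∸_; _^_; _≤_; _<_; z≤n; s≤s; NonZero; _%_; _⊔_; ∣_-_∣; ≢-nonZero; >-nonZero; _≤?_)
import Data.Nat as ℕ
open import Data.Nat.Properties hiding (_≟_)
open import Data.Nat.DivMod
open import Data.Nat.Divisibility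
open import Data.Nat.Logarithm
open import Data.Nat.Primality
open import Data.Nat.Primality.Factorisation using (factorise; module PrimeFactorisation)
open import Data.Nat.ListAction using (product)
open import Data.Nat.Tactic.RingSolver using (solve-∀)
open import Data.Bool using (Bool; true; false; if_then_else_; _∧_; _∨_; not)
import Data.Bool as Bool
open import Data.Bool.Properties using (∨-identityʳ)
open import Data.Fin using (Fin; zero; suc; toℕ; inject≤; remQuot; splitAt; combine; funToFin; finToFun)
open import Data.Fin.Properties as Fin using (inject≤-injective; finToFun-funToFin; _≟_)
open import Data.Fin.Subset using (Subset; ∣_∣; ⁅_⁆; ∁; _∪_; _∩_; ⊥) renaming (_∈_ to _∈ₛ_; _∉_ to _∉ₛ_)
open import Data.Vec as Vec using (Vec; []; _∷_; here; there; tabulate)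
open import Data.Vec.Properties using ([]=⇒lookup; lookup⇒[]=; lookup∘tabulate; lookup-replicate; lookup-zipWith; lookup-splitAt; lookup-map)
open import Data.Fin.Subset.Properties using (x∈⁅y⁆⇒x≡y; x∈⁅x⁆; x∈p∪q⁺; ∣⊥∣≡0; ∣∁p∣≡n∸∣p∣; x∈∁p⇒x∉p; ∉⊥; _∈?_; x∈p∩q⁺; x∈p∩q⁻; ∩-idem; ∣⁅x⁆∣≡1; anySubset?)
open import Data.List using (List; []; _∷_; _++_; length; filter; map; upTo; lookup; cartesianProduct; allFin)
open import Data.List.Properties using (length-++; length-map; length-tabulate)
open import Data.List.Membership.Propositional using (_∈_; find; lose)
open import Data.List.Membership.Propositional.Properties using (∈-filter⁺; ∈-filter⁻; ∈-upTo⁺; ∈-upTo⁻; ∈-lookup; ∈-cartesianProduct⁺; ∈-allFin)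
open import Data.List.Relation.Unary.All as All using (All; []; _∷_)
open import Data.List.Relation.Unary.Any as Any using (here; there)
import Data.List.Relation.Unary.Unique.Propositional.Properties as Unique
open import Data.List.Relation.Unary.Unique.Propositional using (Unique)
open import Data.List.Relation.Unary.AllPairs using ([]; _∷_)
open import Data.Product using (Σ; ∃; _×_; _,_; proj₁; proj₂)
open import Data.Product.Properties using (≡-dec)
open import Data.Sum using (_⊎_; inj₁; inj₂; [_,_]′)
import Data.Empty as Empty
open import Data.Unit using (⊤; tt)
open import Function using (_∘_; id; case_of_)
open import Relation.Nullary.Decidable as Dec using (toWitness; dec-true; _×-dec_; _⊎-dec_; ¬?)
open import Relation.Nullary using (¬_; Dec; yes; no; does; contradiction)
open import Relation.Binary.PropositionalEquality using (_≡_; _≢_; _≗_; refl; sym; trans; cong; cong₂; subst; module ≡-Reasoning)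

-- A tree decomposition turns the graph into a term built with boundedly many pending slots, and by a
-- Feferman-Vaught argument the type of a selection S with respect to the formula is computed bottom-up
-- along this term, with a number N of states that depends only on k and the formula.  So membership of S
-- is decided by a tree over the edges with N states.  Cutting the tree into contexts and using functions
-- from states to states as new states makes it have depth O(log m).
--
-- On a tree of depth L the weights are refined level by level: ω ↦ M ω + (e ↦ 2^e mod p) for a random
-- prime p.  If for every child and every state the lightest selection is unique, only N⁴ pairs of
-- candidates compete at a node, and two different edge sets collide modulo at most m primes.  A random
-- prime with O(log n + N) bits therefore breaks all ties of a level with high probability, and the
-- L = O(log n) levels together use O(log² n + N log n) bits.  Enough small primes exist by Nair's bound
-- on the least common multiple of 1, ..., n.

-- The weights have to be fixed before the graph is known: they depend on `n`, `m` and `N` only, and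
-- a term and its tree appear just in the count of the seeds that fail. So the shape of the tree is
-- irrelevant and its depth decides, as each level costs one prime. A path-like decomposition has
-- linear depth, which forces the balancing. Balancing composes contexts, so the states must be
-- functions; this turns the number n₀ of types into n₀ ^ n₀. Uniqueness is asked for every state of
-- every node, accepting or not: a lightest solution restricts to a selection that is lightest for
-- some state of the child, and that state cannot be predicted. The error is shared out evenly. With
-- at most 2 ^ L nodes and N⁴ m bad primes per node, primes are drawn from so many that a level
-- spoils at most 1/(2L) of the seeds, and half of them survive L levels. The bound is f(k) = 72 N,
-- where N is computed by recursion on the translated formula.

-- Primes

-- pascal i j is the binomial coefficient of i + j over i.
pascal : ℕ → ℕ → ℕ
pascal zero    j       = 1
pascal (suc i) zero    = 1
pascal (suc i) (suc j) = pascal i (suc j) + pascal (suc i) j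

pascal-monoʳ : ∀ i j → pascal i j ≤ pascal i (suc j)
pascal-monoʳ zero    j = ≤-refl
pascal-monoʳ (suc i) j = m≤n+m (pascal (suc i) j) (pascal i (suc j))

pascal-monoˡ : ∀ i j → pascal i j ≤ pascal (suc i) j
pascal-monoˡ zero    zero    = ≤-refl
pascal-monoˡ (suc i) zero    = ≤-refl
pascal-monoˡ i       (suc j) = m≤m+n (pascal i (suc j)) (pascal (suc i) j)

-- Both summands of Pascal's rule dominate the previous central coefficient, so it at least doubles.
-- Having 2 ^ k in place of the true order 4 ^ k costs a constant factor in the prime count.
2^k≤pascal : ∀ k → 2 ^ k ≤ pascal k k
2^k≤pascal zero    = ≤-refl
2^k≤pascal (suc k) = begin
  2 ^ k + (2 ^ k + 0)                     ≡⟨ cong (2 ^ k +_) (+-identityʳ (2 ^ k)) ⟩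
  2 ^ k + 2 ^ k                           ≤⟨ +-mono-≤ (2^k≤pascal k) (2^k≤pascal k) ⟩
  pascal k k + pascal k k                 ≤⟨ +-mono-≤ (pascal-monoʳ k k) (pascal-monoˡ k k) ⟩
  pascal k (suc k) + pascal (suc k) k     ∎
  where open ≤-Reasoning

-- The two absorption identities need each other: Pascal's rule leaves one summand with the wrong
-- factor, and the two smaller instances together exchange `suc i` for `suc j` there.
pascal-absorbˡ : ∀ i j → suc i * pascal (suc i) j ≡ suc (i + j) * pascal i j
pascal-absorbʳ : ∀ i j → suc j * pascal i (suc j) ≡ suc (i + j) * pascal i j

pascal-absorbˡ zero    zero    = refl
pascal-absorbˡ (suc i) zero    = cong (λ z → suc z * 1) (sym (+-identityʳ (suc i)))
pascal-absorbˡ i       (suc j) = begin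
  suc i * (pascal i (suc j) + pascal (suc i) j)
    ≡⟨ *-distribˡ-+ (suc i) (pascal i (suc j)) (pascal (suc i) j) ⟩
  suc i * pascal i (suc j) + suc i * pascal (suc i) j
    ≡⟨ cong (suc i * pascal i (suc j) +_) (trans (pascal-absorbˡ i j) (sym (pascal-absorbʳ i j))) ⟩
  suc i * pascal i (suc j) + suc j * pascal i (suc j)
    ≡⟨ *-distribʳ-+ (pascal i (suc j)) (suc i) (suc j) ⟨
  suc (i + suc j) * pascal i (suc j) ∎
  where open ≡-Reasoning

pascal-absorbʳ zero    j = refl
pascal-absorbʳ (suc i) j = begin
  suc j * (pascal i (suc j) + pascal (suc i) j)
    ≡⟨ *-distribˡ-+ (suc j) (pascal i (suc j)) (pascal (suc i) j) ⟩
  suc j * pascal i (suc j) + suc j * pascal (suc i) j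
    ≡⟨ cong (_+ suc j * pascal (suc i) j) (trans (pascal-absorbʳ i j) (sym (pascal-absorbˡ i j))) ⟩
  suc i * pascal (suc i) j + suc j * pascal (suc i) j
    ≡⟨ *-distribʳ-+ (pascal (suc i) j) (suc i) (suc j) ⟨
  (suc i + suc j) * pascal (suc i) j
    ≡⟨ cong (_* pascal (suc i) j) (+-suc (suc i) j) ⟩
  suc (suc i + j) * pascal (suc i) j ∎
  where open ≡-Reasoning

-- The reciprocal of (i + j + 1) (i + j choose i) is the integral of x^i (1 - x)^j over [0, 1];
-- the induction is the identity x^(i+1) (1-x)^j = x^i (1-x)^j - x^i (1-x)^(j+1).
leibniz∣ : ∀ D i j → (∀ k → k ≤ i + j → suc k ∣ D) → suc (i + j) * pascal i j ∣ D
leibniz∣ D zero    j h = subst (_∣ D) (sym (*-identityʳ (suc j))) (h j ≤-refl)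
leibniz∣ D (suc i) j h
  with leibniz∣ D i j (λ k k≤ → h k (m≤n⇒m≤1+n k≤))
     | leibniz∣ D i (suc j) (λ k k≤ → h k (subst (k ≤_) (+-suc i j) k≤))
-- The subtraction is never truncated in effect: multiplied out, the two products are D + s and s
-- for the same s, because q₁ β and q₂ γ are both D / (i + 1).
... | divides q₁ e₁ | divides q₂ e₂ = divides (q₁ ∸ q₂) (sym (begin
    (q₁ ∸ q₂) * (suc (suc i + j) * β)
      ≡⟨ *-distribʳ-∸ (suc (suc i + j) * β) q₁ q₂ ⟩
    q₁ * (suc (suc i + j) * β) ∸ q₂ * (suc (suc i + j) * β)
      ≡⟨ cong₂ _∸_ left right ⟩
    (D + suc j * (q₁ * β)) ∸ suc j * (q₁ * β)
      ≡⟨ m+n∸n≡m D (suc j * (q₁ * β)) ⟩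
    D ∎))
  where
  open ≡-Reasoning
  β = pascal (suc i) j
  γ = pascal (suc i) (suc j)
  swap : ∀ a b c → a * (b * c) ≡ b * (a * c)
  swap = solve-∀
  D≡β : D ≡ suc i * (q₁ * β)
  D≡β = trans e₁ (trans (cong (q₁ *_) (sym (pascal-absorbˡ i j))) (swap q₁ (suc i) β))
  D≡γ : D ≡ suc i * (q₂ * γ)
  D≡γ = trans e₂ (trans (cong (q₂ *_) (sym (pascal-absorbˡ i (suc j)))) (swap q₂ (suc i) γ))
  qβ≡qγ : q₁ * β ≡ q₂ * γ
  qβ≡qγ = *-cancelˡ-≡ (q₁ * β) (q₂ * γ) (suc i) (trans (sym D≡β) D≡γ)
  left : q₁ * (suc (suc i + j) * β) ≡ D + suc j * (q₁ * β)
  left = trans (expand q₁ i j β) (cong (_+ suc j * (q₁ * β)) (sym D≡β))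
    where
    expand : ∀ q i j b → q * (suc (suc i + j) * b) ≡ suc i * (q * b) + suc j * (q * b)
    expand = solve-∀
  right : q₂ * (suc (suc i + j) * β) ≡ suc j * (q₁ * β)
  right = trans (cong (q₂ *_) (sym (pascal-absorbʳ (suc i) j)))
         (trans (swap q₂ (suc j) γ) (cong (suc j *_) (sym qβ≡qγ)))

primesUpTo : ℕ → List ℕ
primesUpTo n = filter prime? (upTo (suc n))

∈-product-∣ : ∀ {p} ps → p ∈ ps → p ∣ product ps
∈-product-∣ (p ∷ ps) (here refl) = m∣m*n (product ps)
∈-product-∣ (q ∷ ps) (there p∈)  = ∣n⇒∣m*n q (∈-product-∣ ps p∈)

product-∣-^ : ∀ D fs → (∀ {f} → f ∈ fs → f ∣ D) → product fs ∣ D ^ length fs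
product-∣-^ D []       h = ∣-refl
product-∣-^ D (f ∷ fs) h = *-pres-∣ (h (here refl)) (product-∣-^ D fs (h ∘ there))

2^length≤product : ∀ fs → All Prime fs → 2 ^ length fs ≤ product fs
2^length≤product []       []         = ≤-refl
2^length≤product (f ∷ fs) (pf ∷ pfs) =
  *-mono-≤ (Data.Nat.nonTrivial⇒n>1 f {{prime⇒nonTrivial pf}}) (2^length≤product fs pfs)

product≤^ : ∀ N fs → (∀ {f} → f ∈ fs → f ≤ N) → product fs ≤ N ^ length fs
product≤^ N []       h = ≤-refl
product≤^ N (f ∷ fs) h = *-mono-≤ (h (here refl)) (product≤^ N fs (h ∘ there))

^-monoʳ-∣ : ∀ D {a b} → a ≤ b → D ^ a ∣ D ^ b
^-monoʳ-∣ D {a} {b} a≤b = divides (D ^ (b ∸ a)) (trans (cong (D ^_) (sym (m∸n+n≡m a≤b))) (^-distribˡ-+-* D (b ∸ a) a))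

2^-cancel-≤ : ∀ {a b} → 2 ^ a ≤ 2 ^ b → a ≤ b
2^-cancel-≤ {a} {b} h = ≮⇒≥ (λ b<a → <⇒≱ (^-monoʳ-< 2 (s≤s (s≤s z≤n)) b<a) h)

-- Nair's argument: every number up to 2 ^ B divides the B-th power of the product of the primes up to 2 ^ B.
prime-count-bound : ∀ B → 2 ^ B ≤ (2 + B) * (2 + B) * length (primesUpTo (2 ^ (2 + B)))
prime-count-bound B = 2^-cancel-≤ (begin
    2 ^ k                              ≤⟨ 2^k≤pascal k ⟩
    pascal k k                         ≤⟨ ∣⇒≤ {{D≢0}} (∣-trans (n∣m*n (suc (k + k))) leib) ⟩
    product ps ^ B′                    ≤⟨ ^-monoˡ-≤ B′ (product≤^ N ps λ f∈ → m<1+n⇒m≤n (∈-upTo⁻ (proj₁ (∈-filter⁻ prime? {xs = upTo (suc N)} f∈)))) ⟩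
    ((2 ^ B′) ^ length ps) ^ B′        ≡⟨ ^-*-assoc (2 ^ B′) (length ps) B′ ⟩
    (2 ^ B′) ^ (length ps * B′)        ≡⟨ ^-*-assoc 2 B′ (length ps * B′) ⟩
    2 ^ (B′ * (length ps * B′))        ≡⟨ cong (2 ^_) (rearrange B′ (length ps)) ⟩
    2 ^ (B′ * B′ * length ps)          ∎)
  where
  open ≤-Reasoning
  B′ = 2 + B
  k  = 2 ^ B
  N  = 2 ^ B′
  ps = primesUpTo N
  D  = product ps ^ B′
  rearrange : ∀ a b → a * (b * a) ≡ a * a * b
  rearrange = solve-∀
  isPrime : ∀ {p} → p ∈ ps → Prime p
  isPrime p∈ = proj₂ (∈-filter⁻ prime? {xs = upTo (suc N)} p∈)
  product≢0 : ∀ fs → (∀ {f} → f ∈ fs → Prime f) → product fs ≢ 0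
  product≢0 (f ∷ fs) h eq with m*n≡0⇒m≡0∨n≡0 f eq
  ... | inj₁ e = ¬prime[0] (subst Prime e (h (here refl)))
  ... | inj₂ e = product≢0 fs (h ∘ there) e
  D≢0 : NonZero D
  D≢0 = m^n≢0 (product ps) B′ {{≢-nonZero (product≢0 ps isPrime)}}
  divides-D : ∀ j → .{{_ : NonZero j}} → j ≤ N → j ∣ D
  divides-D j j≤N with factorise j
  ... | pf = subst (_∣ D) (sym isFactorisation)
               (∣-trans (product-∣-^ (product ps) factors λ f∈ → ∈-product-∣ ps (inList f∈)) (^-monoʳ-∣ (product ps) few))
    where
    open PrimeFactorisation pf
    -- Prime factors are at least 2, so a number up to 2 ^ B′ has at most B′ of them with
    -- multiplicity; this is the exponent in `D`.
    few : length factors ≤ B′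
    few = 2^-cancel-≤ (≤-trans (2^length≤product factors factorsPrime) (subst (_≤ N) isFactorisation j≤N))
    inList : ∀ {f} → f ∈ factors → f ∈ ps
    inList f∈ = ∈-filter⁺ prime? (∈-upTo⁺ (s≤s (≤-trans (∣⇒≤ f∣j) j≤N))) (All.lookup factorsPrime f∈)
      where f∣j = subst (_ ∣_) (sym isFactorisation) (∈-product-∣ factors f∈)
  -- The central coefficient needs all divisors up to 2k + 1, and N is 4k: hence the 2 in B′ = 2 +
  -- B.
  2k<N : suc (k + k) ≤ N
  2k<N = begin
    suc (k + k)             ≤⟨ +-monoˡ-≤ (k + k) (≤-trans (m^n>0 2 B) (m≤m+n k k)) ⟩
    (k + k) + (k + k)       ≡⟨ double k ⟩
    2 * (2 * k)             ∎
    where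
    double : ∀ k → (k + k) + (k + k) ≡ 2 * (2 * k)
    double = solve-∀
  leib : suc (k + k) * pascal k k ∣ D
  leib = leibniz∣ D k k λ i i≤ → divides-D (suc i) (≤-trans (s≤s i≤) 2k<N)

-- For B = 8 + 2a the left side is the factor (2 + B)² of `prime-count-bound`; paying 2 ^ (8 + a)
-- for it leaves 2 ^ a primes out of 2 ^ B. With the offset 8 the induction starts from 100 ≤ 256.
[2a+10]²≤2^[a+8] : ∀ a → (10 + 2 * a) * (10 + 2 * a) ≤ 2 ^ (8 + a)
[2a+10]²≤2^[a+8] zero    = toWitness {a? = 100 ≤? 256} tt
[2a+10]²≤2^[a+8] (suc a) = begin
  (10 + 2 * suc a) * (10 + 2 * suc a)                       ≤⟨ m≤m+n _ (4 * (a * a) + 32 * a + 56) ⟩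
  (10 + 2 * suc a) * (10 + 2 * suc a) + (4 * (a * a) + 32 * a + 56) ≡⟨ expand a ⟩
  2 * ((10 + 2 * a) * (10 + 2 * a))                         ≤⟨ *-monoʳ-≤ 2 ([2a+10]²≤2^[a+8] a) ⟩
  2 * 2 ^ (8 + a)                                           ≡⟨ cong (2 ^_) (sym (+-suc 8 a)) ⟩
  2 ^ (8 + suc a)                                           ∎
  where
  open ≤-Reasoning
  expand : ∀ a → (10 + 2 * suc a) * (10 + 2 * suc a) + (4 * (a * a) + 32 * a + 56) ≡ 2 * ((10 + 2 * a) * (10 + 2 * a))
  expand = solve-∀

lookup-injective : ∀ {xs : List ℕ} → Unique xs → ∀ i j → lookup xs i ≡ lookup xs j → i ≡ j
lookup-injective (_  ∷ _)  zero    zero    eq = refl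
lookup-injective (x∉ ∷ _)  zero    (suc j) eq = contradiction eq (All.lookup x∉ (∈-lookup j))
lookup-injective (x∉ ∷ _)  (suc i) zero    eq = contradiction (sym eq) (All.lookup x∉ (∈-lookup i))
lookup-injective (_  ∷ xs) (suc i) (suc j) eq = cong suc (lookup-injective xs i j eq)

-- Exactly 2 ^ a indices, so that drawing a prime costs a bits and the seeds of several levels
-- multiply to a power of two.
record Primes (a b : ℕ) : Set where
  field
    modulus   : Fin (2 ^ a) → ℕ
    isPrime   : ∀ i → Prime (modulus i)
    modulus≤  : ∀ i → modulus i ≤ 2 ^ b
    injective : ∀ {i j} → modulus i ≡ modulus j → i ≡ j

manyPrimes : ∀ a → Primes a (10 + 2 * a)
manyPrimes a = record
  { modulus   = λ i → lookup ps (inject≤ i enough)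
  ; isPrime   = λ i → proj₂ (∈-filter⁻ prime? {xs = upTo (suc N)} (∈-lookup (inject≤ i enough)))
  ; modulus≤  = λ i → m<1+n⇒m≤n (∈-upTo⁻ (proj₁ (∈-filter⁻ prime? {xs = upTo (suc N)} (∈-lookup (inject≤ i enough)))))
  ; injective = λ {i} {j} eq → inject≤-injective enough enough i j (lookup-injective (Unique.filter⁺ prime? (Unique.upTo⁺ (suc N))) _ _ eq)
  }
  where
  N  = 2 ^ (10 + 2 * a)
  ps = primesUpTo N
  enough : 2 ^ a ≤ length ps
  enough = *-cancelˡ-≤ (2 ^ (8 + a)) {{m^n≢0 2 (8 + a)}} (begin
    2 ^ (8 + a) * 2 ^ a                           ≡⟨ ^-distribˡ-+-* 2 (8 + a) a ⟨
    2 ^ (8 + a + a)                               ≡⟨ cong (2 ^_) (double a) ⟩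
    2 ^ (8 + 2 * a)                               ≤⟨ prime-count-bound (8 + 2 * a) ⟩
    (10 + 2 * a) * (10 + 2 * a) * length ps       ≤⟨ *-monoˡ-≤ (length ps) ([2a+10]²≤2^[a+8] a) ⟩
    2 ^ (8 + a) * length ps                       ∎)
    where
    open ≤-Reasoning
    double : ∀ a → 8 + a + a ≡ 8 + 2 * a
    double = solve-∀

-- Hashing edge sets modulo primes

%≡%⇒∣∣-∣ : ∀ a b d .{{_ : NonZero d}} → a % d ≡ b % d → d ∣ ∣ a - b ∣
%≡%⇒∣∣-∣ a b d eq = divides ∣ a / d - b / d ∣ (begin
  ∣ a - b ∣                                          ≡⟨ cong₂ ∣_-_∣ (m≡m%n+[m/n]*n a d) (m≡m%n+[m/n]*n b d) ⟩
  ∣ a % d + a / d * d - b % d + b / d * d ∣          ≡⟨ cong (λ r → ∣ a % d + a / d * d - r + b / d * d ∣) eq ⟨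
  ∣ a % d + a / d * d - a % d + b / d * d ∣          ≡⟨ ∣m+n-m+o∣≡∣n-o∣ (a % d) (a / d * d) (b / d * d) ⟩
  ∣ a / d * d - b / d * d ∣                          ≡⟨ *-distribʳ-∣-∣ d (a / d) (b / d) ⟨
  ∣ a / d - b / d ∣ * d                              ∎)
  where open ≡-Reasoning

weight-% : ∀ {m} (ω : Fin m → ℕ) p .{{_ : NonZero p}} (S : Subset m) →
           weight (λ e → ω e % p) S % p ≡ weight ω S % p
weight-% ω p []          = refl
weight-% ω p (false ∷ S) = weight-% (ω ∘ suc) p S
weight-% ω p (true ∷ S)  = begin
  (ω zero % p + weight (λ e → ω (suc e) % p) S) % p
    ≡⟨ %-distribˡ-+ (ω zero % p) _ p ⟩
  (ω zero % p % p + weight (λ e → ω (suc e) % p) S % p) % p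
    ≡⟨ cong₂ (λ x y → (x + y) % p) (m%n%n≡m%n (ω zero) p) (weight-% (ω ∘ suc) p S) ⟩
  (ω zero % p + weight (ω ∘ suc) S % p) % p
    ≡⟨ %-distribˡ-+ (ω zero) _ p ⟨
  (ω zero + weight (ω ∘ suc) S) % p ∎
  where open ≡-Reasoning

weight-* : ∀ {m} c (ω : Fin m → ℕ) (S : Subset m) → weight (λ e → c * ω e) S ≡ c * weight ω S
weight-* c ω []          = sym (*-zeroʳ c)
weight-* c ω (false ∷ S) = weight-* c (ω ∘ suc) S
weight-* c ω (true ∷ S)  =
  trans (cong (c * ω zero +_) (weight-* c (ω ∘ suc) S)) (sym (*-distribˡ-+ c (ω zero) (weight (ω ∘ suc) S)))

bit : Bool → ℕ
bit b = if b then 1 else 0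

-- The weight of `S` is then the number with binary digits `S`, which identifies it. Being
-- exponential in m, these weights enter the scheme only modulo a prime.
powers : ∀ {m} → Fin m → ℕ
powers e = 2 ^ toℕ e

weight-powers-∷ : ∀ {m} b (S : Subset m) → weight powers (b ∷ S) ≡ bit b + 2 * weight powers S
weight-powers-∷ b S = cong (bit b +_) (weight-* 2 powers S)

weight-powers-< : ∀ {m} (S : Subset m) → weight powers S < 2 ^ m
weight-powers-< []              = s≤s z≤n
weight-powers-< {suc m} (b ∷ S) = begin-strict
  weight powers (b ∷ S)       ≡⟨ weight-powers-∷ b S ⟩
  bit b + 2 * weight powers S <⟨ +-monoˡ-< (2 * weight powers S) (bit<2 b) ⟩
  2 + 2 * weight powers S     ≡⟨ *-suc 2 (weight powers S) ⟨
  2 * suc (weight powers S)   ≤⟨ *-monoʳ-≤ 2 (weight-powers-< S) ⟩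
  2 * 2 ^ m                   ∎
  where
  open ≤-Reasoning
  bit<2 : ∀ b → bit b < 2
  bit<2 false = s≤s z≤n
  bit<2 true  = s≤s (s≤s z≤n)

weight-powers-injective : ∀ {m} (S T : Subset m) → weight powers S ≡ weight powers T → S ≡ T
weight-powers-injective []      []      eq = refl
weight-powers-injective (b ∷ S) (c ∷ T) eq = cong₂ _∷_ (heads b c parity) (weight-powers-injective S T tails)
  where
  split : bit b + 2 * weight powers S ≡ bit c + 2 * weight powers T
  split = trans (sym (weight-powers-∷ b S)) (trans eq (weight-powers-∷ c T))
  parity : bit b % 2 ≡ bit c % 2
  parity = trans (sym (%-remove-+ʳ (bit b) (m∣m*n (weight powers S))))
          (trans (cong (_% 2) split) (%-remove-+ʳ (bit c) (m∣m*n (weight powers T))))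
  heads : ∀ b c → bit b % 2 ≡ bit c % 2 → b ≡ c
  heads false false _ = refl
  heads true  true  _ = refl
  tails : weight powers S ≡ weight powers T
  tails = *-cancelˡ-≡ _ _ 2 (+-cancelˡ-≡ (bit c) _ _
    (subst (λ x → bit x + 2 * weight powers S ≡ bit c + 2 * weight powers T) (heads b c parity) split))

-- Distinct primes can be divided out of D one at a time: by Euclid's lemma the others still divide
-- the quotient, and each division at least halves it.
2^∣divisors∣≤ : ∀ {Q} (P : Fin Q → ℕ) → (∀ i → Prime (P i)) → (∀ {i j} → P i ≡ P j → i ≡ j) →
  ∀ (B : Subset Q) D → D ≢ 0 → (∀ i → i ∈ₛ B → P i ∣ D) → 2 ^ ∣ B ∣ ≤ D
2^∣divisors∣≤ P prm inj []          D D≢0 h = n≢0⇒n>0 D≢0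
2^∣divisors∣≤ P prm inj (false ∷ B) D D≢0 h =
  2^∣divisors∣≤ (P ∘ suc) (prm ∘ suc) (Fin.suc-injective ∘ inj) B D D≢0 (λ i i∈ → h (suc i) (there i∈))
2^∣divisors∣≤ P prm inj (true ∷ B)  D D≢0 h with h zero here
... | divides q refl = begin
    2 * 2 ^ ∣ B ∣   ≤⟨ *-mono-≤ (Data.Nat.nonTrivial⇒n>1 p {{prime⇒nonTrivial (prm zero)}})
                               (2^∣divisors∣≤ (P ∘ suc) (prm ∘ suc) (Fin.suc-injective ∘ inj) B q q≢0 rest) ⟩
    p * q           ≡⟨ *-comm p q ⟩
    q * p           ∎
  where
  open ≤-Reasoning
  p = P zero
  q≢0 : q ≢ 0
  q≢0 refl = D≢0 refl
  rest : ∀ i → i ∈ₛ B → P (suc i) ∣ q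
  rest i i∈ with euclidsLemma q p (prm (suc i)) (h (suc i) (there i∈))
  ... | inj₁ d = d
  ... | inj₂ d with prime⇒irreducible (prm zero) d
  ...   | inj₁ e = contradiction (subst Prime e (prm (suc i))) ¬prime[1]
  ...   | inj₂ e = contradiction (inj e) (λ ())

module Hash {a b : ℕ} (P : Primes a b) where
  open Primes P public

  hash : ∀ {m} → Fin (2 ^ a) → Fin m → ℕ
  hash i e = _%_ (powers e) (modulus i) {{prime⇒nonZero (isPrime i)}}

  hash<2^ : ∀ {m} i (e : Fin m) → hash i e < 2 ^ b
  hash<2^ i e = <-≤-trans (m%n<n (powers e) (modulus i) {{prime⇒nonZero (isPrime i)}}) (modulus≤ i)

  -- Hash weights are congruent to the binary numbers of the sets, so a collision makes the prime
  -- divide their difference, which is nonzero and below 2 ^ m. Hash weights are sums of residues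
  -- that are not reduced again, so `B` may contain primes without a collision.
  collisions : ∀ {m} (S T : Subset m) → S ≢ T →
    Σ (Subset (2 ^ a)) λ B → (∣ B ∣ ≤ m) × (∀ i → i ∉ₛ B → weight (hash i) S ≢ weight (hash i) T)
  collisions {m} S T S≢T = B , bound , separates
    where
    D = ∣ weight powers S - weight powers T ∣
    B = tabulate (λ i → does (modulus i ∣? D))
    B⁻ : ∀ i → i ∈ₛ B → modulus i ∣ D
    B⁻ i i∈ with modulus i ∣? D in eq
    ... | yes d = d
    ... | no  _ = contradiction (trans (sym ([]=⇒lookup i∈)) (trans (lookup∘tabulate _ i) (cong does eq))) (λ ())
    B⁺ : ∀ i → modulus i ∣ D → i ∈ₛ B
    B⁺ i d = lookup⇒[]= i B (trans (lookup∘tabulate _ i) (dec-true (modulus i ∣? D) d))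
    D≢0 : D ≢ 0
    D≢0 eq = S≢T (weight-powers-injective S T (∣m-n∣≡0⇒m≡n eq))
    D<2^m : D < 2 ^ m
    D<2^m = ≤-<-trans (∣m-n∣≤m⊔n (weight powers S) (weight powers T)) (⊔-pres-<m (weight-powers-< S) (weight-powers-< T))
    bound : ∣ B ∣ ≤ m
    bound = 2^-cancel-≤ (≤-trans (2^∣divisors∣≤ modulus isPrime injective B D D≢0 B⁻) (<⇒≤ D<2^m))
    separates : ∀ i → i ∉ₛ B → weight (hash i) S ≢ weight (hash i) T
    separates i i∉ eq = i∉ (B⁺ i (%≡%⇒∣∣-∣ _ _ p {{nz}} (begin
      weight powers S % p       ≡⟨ weight-% powers p S ⟨
      weight (hash i) S % p     ≡⟨ cong (_% p) eq ⟩
      weight (hash i) T % p     ≡⟨ weight-% powers p T ⟩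
      weight powers T % p       ∎)))
      where
      open ≡-Reasoning
      p = modulus i
      instance nz = prime⇒nonZero (isPrime i)

-- Selections from a tree of keys

-- The shape of a local selection. With `Sel` the selection of a node is a pair of selections of its
-- children, and replacing one component is immediate; subsets of all the edges return only through
-- `res` and `glob`.
data Keys (m : ℕ) : Set where
  none : Keys m
  one  : Fin m → Keys m
  two  : Keys m → Keys m → Keys m

Sel : ∀ {m} → Keys m → Set
Sel none      = ⊤
Sel (one e)   = Bool
Sel (two k l) = Sel k × Sel l

occ : ∀ {m} → Keys m → Fin m → ℕ
occ none      e = 0
occ (one f)   e = bit (does (f ≟ e))
occ (two k l) e = occ k e + occ l e

res : ∀ {m} (k : Keys m) → Subset m → Sel k
res none      S = tt
res (one e)   S = Vec.lookup S e
res (two k l) S = res k S , res l S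

glob : ∀ {m} (k : Keys m) → Sel k → Subset m
glob none      d       = ⊥
glob (one e)   b       = if b then ⁅ e ⁆ else ⊥
glob (two k l) (d , c) = glob k d ∪ glob l c

cost : ∀ {m} (k : Keys m) → (Fin m → ℕ) → Sel k → ℕ
cost none      ω d       = 0
cost (one e)   ω b       = if b then ω e else 0
cost (two k l) ω (d , c) = cost k ω d + cost l ω c

occ-one : ∀ {m} (e : Fin m) → occ (one e) e ≡ 1
occ-one e = cong bit (dec-true (e ≟ e) refl)

lookup-⊥ : ∀ {m} (e : Fin m) → Vec.lookup ⊥ e ≡ false
lookup-⊥ e = lookup-replicate e false

lookup-⁅⁆ : ∀ {m} (e f : Fin m) → e ≢ f → Vec.lookup ⁅ e ⁆ f ≡ false
lookup-⁅⁆ e f e≢f with Vec.lookup ⁅ e ⁆ f in eq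
... | false = refl
... | true  = contradiction (sym (x∈⁅y⁆⇒x≡y e (lookup⇒[]= f ⁅ e ⁆ eq))) e≢f

lookup-⁅⁆-same : ∀ {m} (e : Fin m) → Vec.lookup ⁅ e ⁆ e ≡ true
lookup-⁅⁆-same e = []=⇒lookup (x∈⁅x⁆ e)

lookup-glob : ∀ {m} (k : Keys m) d e → occ k e ≡ 0 → Vec.lookup (glob k d) e ≡ false
lookup-glob none      d       e _ = lookup-⊥ e
lookup-glob (one f)   false   e _ = lookup-⊥ e
lookup-glob (one f)   true    e h with f ≟ e
... | no f≢e = lookup-⁅⁆ f e f≢e
lookup-glob (two k l) (d , c) e h =
  trans (lookup-zipWith _∨_ e (glob k d) (glob l c))
        (cong₂ _∨_ (lookup-glob k d e (m+n≡0⇒m≡0 (occ k e) h)) (lookup-glob l c e (m+n≡0⇒n≡0 (occ k e) h)))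

res-cong : ∀ {m} (k : Keys m) S T → (∀ e → occ k e ≢ 0 → Vec.lookup S e ≡ Vec.lookup T e) → res k S ≡ res k T
res-cong none      S T h = refl
res-cong (one e)   S T h = h e (λ eq → 1+n≢0 (trans (sym (occ-one e)) eq))
res-cong (two k l) S T h = cong₂ _,_
  (res-cong k S T λ e e∈ → h e (e∈ ∘ m+n≡0⇒m≡0 (occ k e)))
  (res-cong l S T λ e e∈ → h e (e∈ ∘ m+n≡0⇒n≡0 (occ k e)))

Linear : ∀ {m} → Keys m → Set
Linear k = ∀ e → occ k e ≤ 1

linearˡ : ∀ {m} (k l : Keys m) → Linear (two k l) → Linear k
linearˡ k l lin e = ≤-trans (m≤m+n (occ k e) (occ l e)) (lin e)

linearʳ : ∀ {m} (k l : Keys m) → Linear (two k l) → Linear l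
linearʳ k l lin e = ≤-trans (m≤n+m (occ l e) (occ k e)) (lin e)

linear-disjoint : ∀ {m} (k l : Keys m) → Linear (two k l) → ∀ e → occ k e ≡ 0 ⊎ occ l e ≡ 0
linear-disjoint k l lin e with occ k e | occ l e | lin e
... | zero  | _     | _       = inj₁ refl
... | suc _ | zero  | _       = inj₂ refl
... | suc a | suc b | s≤s a+b = contradiction (m+n≤o⇒n≤o a a+b) λ ()

-- Linearity enters at `two`: the union must not let one branch select a key of the other.
res-glob : ∀ {m} (k : Keys m) → Linear k → ∀ d → res k (glob k d) ≡ d
res-glob none      lin tt      = refl
res-glob (one e)   lin false   = lookup-⊥ e
res-glob (one e)   lin true    = lookup-⁅⁆-same e
res-glob (two k l) lin (d , c) = cong₂ _,_
    (trans (res-cong k (glob k d ∪ glob l c) (glob k d) left)  (res-glob k (linearˡ k l lin) d))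
    (trans (res-cong l (glob k d ∪ glob l c) (glob l c) right) (res-glob l (linearʳ k l lin) c))
  where
  ∪-lookup : ∀ e → Vec.lookup (glob k d ∪ glob l c) e ≡ Vec.lookup (glob k d) e ∨ Vec.lookup (glob l c) e
  ∪-lookup e = lookup-zipWith _∨_ e (glob k d) (glob l c)
  left : ∀ e → occ k e ≢ 0 → Vec.lookup (glob k d ∪ glob l c) e ≡ Vec.lookup (glob k d) e
  left e e∈ with linear-disjoint k l lin e
  ... | inj₁ e∉ = contradiction e∉ e∈
  ... | inj₂ e∉ = trans (∪-lookup e) (trans (cong (_ ∨_) (lookup-glob l c e e∉)) (∨-identityʳ _))
  right : ∀ e → occ l e ≢ 0 → Vec.lookup (glob k d ∪ glob l c) e ≡ Vec.lookup (glob l c) e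
  right e e∈ with linear-disjoint k l lin e
  ... | inj₁ e∉ = trans (∪-lookup e) (cong (_∨ _) (lookup-glob k d e e∉))
  ... | inj₂ e∉ = contradiction e∉ e∈

res-injective : ∀ {m} (k : Keys m) S T → res k S ≡ res k T → ∀ e → occ k e ≢ 0 → Vec.lookup S e ≡ Vec.lookup T e
res-injective none      S T eq e e∈ = contradiction refl e∈
res-injective (one f)   S T eq e e∈ with f ≟ e
... | yes refl = eq
... | no  _    = contradiction refl e∈
res-injective (two k l) S T eq e e∈ with occ k e in eqk
... | suc _ = res-injective k S T (cong proj₁ eq) e (λ z → 1+n≢0 (trans (sym eqk) z))
... | zero  = res-injective l S T (cong proj₂ eq) e e∈

lookup-ext : ∀ {m} {A : Set} (S T : Vec A m) → (∀ e → Vec.lookup S e ≡ Vec.lookup T e) → S ≡ T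
lookup-ext []      []      h = refl
lookup-ext (x ∷ S) (y ∷ T) h = cong₂ _∷_ (h zero) (lookup-ext S T (h ∘ suc))

weight-⊥ : ∀ {m} (ω : Fin m → ℕ) → weight ω ⊥ ≡ 0
weight-⊥ {zero}  ω = refl
weight-⊥ {suc m} ω = weight-⊥ (ω ∘ suc)

weight-⁅⁆ : ∀ {m} (ω : Fin m → ℕ) e → weight ω ⁅ e ⁆ ≡ ω e
weight-⁅⁆ ω zero    = trans (cong (ω zero +_) (weight-⊥ (ω ∘ suc))) (+-identityʳ (ω zero))
weight-⁅⁆ ω (suc e) = weight-⁅⁆ (ω ∘ suc) e

weight-∪ : ∀ {m} (ω : Fin m → ℕ) S T → (∀ e → Vec.lookup S e ≡ false ⊎ Vec.lookup T e ≡ false) →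
           weight ω (S ∪ T) ≡ weight ω S + weight ω T
weight-∪ ω []          []          h = refl
weight-∪ ω (false ∷ S) (false ∷ T) h = weight-∪ (ω ∘ suc) S T (h ∘ suc)
weight-∪ ω (true ∷ S)  (false ∷ T) h =
  trans (cong (ω zero +_) (weight-∪ (ω ∘ suc) S T (h ∘ suc))) (sym (+-assoc (ω zero) _ _))
weight-∪ ω (false ∷ S) (true ∷ T)  h = trans (cong (ω zero +_) (weight-∪ (ω ∘ suc) S T (h ∘ suc))) (swap (ω zero) (weight (ω ∘ suc) S) (weight (ω ∘ suc) T))
  where
  swap : ∀ a b c → a + (b + c) ≡ b + (a + c)
  swap = solve-∀
weight-∪ ω (true ∷ S)  (true ∷ T)  h with h zero
... | inj₁ ()
... | inj₂ ()

weight-glob : ∀ {m} (ω : Fin m → ℕ) (k : Keys m) → Linear k → ∀ d → weight ω (glob k d) ≡ cost k ω d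
weight-glob ω none      lin d       = weight-⊥ ω
weight-glob ω (one e)   lin false   = weight-⊥ ω
weight-glob ω (one e)   lin true    = weight-⁅⁆ ω e
weight-glob ω (two k l) lin (d , c) =
  trans (weight-∪ ω (glob k d) (glob l c) disjoint)
        (cong₂ _+_ (weight-glob ω k (linearˡ k l lin) d) (weight-glob ω l (linearʳ k l lin) c))
  where
  disjoint : ∀ e → Vec.lookup (glob k d) e ≡ false ⊎ Vec.lookup (glob l c) e ≡ false
  disjoint e with linear-disjoint k l lin e
  ... | inj₁ e∉ = inj₁ (lookup-glob k d e e∉)
  ... | inj₂ e∉ = inj₂ (lookup-glob l c e e∉)

Exact : ∀ {m} → Keys m → Set
Exact k = ∀ e → occ k e ≡ 1

exact⇒linear : ∀ {m} (k : Keys m) → Exact k → Linear k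
exact⇒linear k exact e = ≤-reflexive (exact e)

exact-injective : ∀ {m} (k : Keys m) → Exact k → ∀ S T → res k S ≡ res k T → S ≡ T
exact-injective k exact S T eq =
  lookup-ext S T λ e → res-injective k S T eq e (λ z → 1+n≢0 (trans (sym (exact e)) z))

glob-res : ∀ {m} (k : Keys m) → Exact k → ∀ S → glob k (res k S) ≡ S
glob-res k exact S = exact-injective k exact _ S (res-glob k (exact⇒linear k exact) (res k S))

cost-res : ∀ {m} (ω : Fin m → ℕ) (k : Keys m) → Exact k → ∀ S → cost k ω (res k S) ≡ weight ω S
cost-res ω k exact S =
  trans (sym (weight-glob ω k (exact⇒linear k exact) (res k S))) (cong (weight ω) (glob-res k exact S))

allSel : ∀ {m} (k : Keys m) → List (Sel k)
allSel none      = tt ∷ []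
allSel (one e)   = false ∷ true ∷ []
allSel (two k l) = cartesianProduct (allSel k) (allSel l)

∈-allSel : ∀ {m} (k : Keys m) d → d ∈ allSel k
∈-allSel none      tt      = here refl
∈-allSel (one e)   false   = here refl
∈-allSel (one e)   true    = there (here refl)
∈-allSel (two k l) (d , c) = ∈-cartesianProduct⁺ (∈-allSel k d) (∈-allSel l c)

sel-≟ : ∀ {m} (k : Keys m) (d c : Sel k) → Dec (d ≡ c)
sel-≟ none      tt      tt        = yes refl
sel-≟ (one e)   b       c         = b Bool.≟ c
sel-≟ (two k l) (d , c) (d′ , c′) = ≡-dec (sel-≟ k) (sel-≟ l) (d , c) (d′ , c′)

-- Isolation on trees of small depth

data Exp (N m : ℕ) : Set where
  const : Fin N → Exp N m
  leaf  : Fin m → (Bool → Fin N) → Exp N m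
  node  : (Fin N → Fin N → Fin N) → Exp N m → Exp N m → Exp N m

module _ {N m : ℕ} where

  keys : Exp N m → Keys m
  keys (const s)    = none
  keys (leaf e g)   = one e
  keys (node f x y) = two (keys x) (keys y)

  eval : (x : Exp N m) → Sel (keys x) → Fin N
  eval (const s)    d       = s
  eval (leaf e g)   b       = g b
  eval (node f x y) (d , c) = f (eval x d) (eval y c)

  depth : Exp N m → ℕ
  depth (const s)    = 0
  depth (leaf e g)   = 0
  depth (node f x y) = suc (depth x ⊔ depth y)

  nodes : Exp N m → ℕ
  nodes (const s)    = 0
  nodes (leaf e g)   = 0
  nodes (node f x y) = suc (nodes x + nodes y)

  nodes<2^depth : ∀ x → nodes x < 2 ^ depth x
  nodes<2^depth (const s)    = s≤s z≤n
  nodes<2^depth (leaf e g)   = s≤s z≤n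
  nodes<2^depth (node f x y) = begin
    suc (suc (nodes x + nodes y))                       ≡⟨ cong suc (+-suc (nodes x) (nodes y)) ⟨
    suc (nodes x) + suc (nodes y)                       ≤⟨ +-mono-≤ (nodes<2^depth x) (nodes<2^depth y) ⟩
    2 ^ depth x + 2 ^ depth y                           ≤⟨ +-mono-≤ (^-monoʳ-≤ 2 (m≤m⊔n (depth x) (depth y))) (^-monoʳ-≤ 2 (m≤n⊔m (depth x) (depth y))) ⟩
    2 ^ (depth x ⊔ depth y) + 2 ^ (depth x ⊔ depth y)   ≡⟨ cong (2 ^ (depth x ⊔ depth y) +_) (+-identityʳ _) ⟨
    2 ^ suc (depth x ⊔ depth y)                         ∎
    where open ≤-Reasoning

  -- Competitors are the selections of the same state, since nothing but the state is visible
  -- further up.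
  Min : (Fin m → ℕ) → (x : Exp N m) → Sel (keys x) → Set
  Min ω x d = ∀ d′ → eval x d′ ≡ eval x d → cost (keys x) ω d ≤ cost (keys x) ω d′

  Iso : (Fin m → ℕ) → Exp N m → Set
  Iso ω x = ∀ d d′ → eval x d ≡ eval x d′ → Min ω x d → Min ω x d′ → d ≡ d′

  -- Exchange argument: swapping one component for another of equal state preserves the state of the
  -- node, and the cost of the other component cancels.
  Min-children : ∀ {ω f} x y {d c} → Min ω (node f x y) (d , c) → Min ω x d × Min ω y c
  Min-children {ω} {f} x y {d} {c} h =
    (λ d′ eq → +-cancelʳ-≤ (cost (keys y) ω c) _ _ (h (d′ , c) (cong (λ s → f s (eval y c)) eq))) ,
    (λ c′ eq → +-cancelˡ-≤ (cost (keys x) ω d) _ _ (h (d , c′) (cong (f (eval x d)) eq)))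

  -- The invariant after j refinements. It speaks of all nodes, vacuously where the depth exceeds j,
  -- so that one prime can serve a whole level.
  AllIso : (Fin m → ℕ) → ℕ → Exp N m → Set
  AllIso ω j (const s)        = ⊤
  AllIso ω j x@(leaf e g)     = Iso ω x
  AllIso ω j x@(node f y z)   = (depth x ≤ j → Iso ω x) × AllIso ω j y × AllIso ω j z

  AllIso⇒Iso : ∀ {ω j} x → AllIso ω j x → depth x ≤ j → Iso ω x
  AllIso⇒Iso (const s)    _       _ tt tt _ _ _ = refl
  AllIso⇒Iso (leaf e g)   iso     _             = iso
  AllIso⇒Iso (node f x y) (h , _) d≤            = h d≤

  -- The initial weight is positive because both choices at a leaf may lead to the same state; the
  -- tie is then broken in favour of `false`.
  AllIso-1 : ∀ x → AllIso (λ _ → 1) 0 x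
  AllIso-1 (const s)    = tt
  AllIso-1 (leaf e g)   = iso
    where
    iso : Iso (λ _ → 1) (leaf e g)
    iso false false _  _ _ = refl
    iso true  true  _  _ _ = refl
    iso false true  eq _ h = contradiction (h false eq) λ ()
    iso true  false eq h _ = contradiction (h false (sym eq)) λ ()
  AllIso-1 (node f x y) = (λ ()) , AllIso-1 x , AllIso-1 y

  -- Lexicographic by ω and then h, as long as h costs less than M in total.
  refine : ℕ → (ω h : Fin m → ℕ) → Fin m → ℕ
  refine M ω h e = ω e * M + h e

  cost-refine : ∀ M ω h k d → cost k (refine M ω h) d ≡ cost k ω d * M + cost k h d
  cost-refine M ω h none      d       = refl
  cost-refine M ω h (one e)   false   = refl
  cost-refine M ω h (one e)   true    = refl
  cost-refine M ω h (two k l) (d , c) =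
    trans (cong₂ _+_ (cost-refine M ω h k d) (cost-refine M ω h l c))
          (regroup (cost k ω d) (cost l ω c) M (cost k h d) (cost l h c))
    where
    regroup : ∀ a b M c d → (a * M + c) + (b * M + d) ≡ (a + b) * M + (c + d)
    regroup = solve-∀

  module Refine (M : ℕ) (ω h : Fin m → ℕ) where

    Min-refine : ∀ x → (∀ d → cost (keys x) h d < M) → ∀ {d} → Min (refine M ω h) x d → Min ω x d
    Min-refine x h<M {d} min d′ eq = ≮⇒≥ λ d′<d → <⇒≱ (begin-strict
        C′ d′                             ≡⟨ cost-refine M ω h (keys x) d′ ⟩
        C d′ * M + H d′                   <⟨ +-monoʳ-< (C d′ * M) (h<M d′) ⟩
        C d′ * M + M                      ≡⟨ +-comm (C d′ * M) M ⟩
        suc (C d′) * M                    ≤⟨ *-monoˡ-≤ M d′<d ⟩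
        C d * M                           ≤⟨ m≤m+n (C d * M) (H d) ⟩
        C d * M + H d                     ≡⟨ cost-refine M ω h (keys x) d ⟨
        C′ d                              ∎) (min d′ eq)
      where
      open ≤-Reasoning
      C = cost (keys x) ω
      H = cost (keys x) h
      C′ = cost (keys x) (refine M ω h)

    Iso-refine : ∀ x → (∀ d → cost (keys x) h d < M) → Iso ω x → Iso (refine M ω h) x
    Iso-refine x h<M iso d d′ eq min min′ = iso d d′ eq (Min-refine x h<M min) (Min-refine x h<M min′)

    -- By `Min-refine` both selections are also minimal for ω, so their ω-costs agree and what
    -- remains of the refined cost is h. A hash that separates the candidates thus leaves one
    -- minimum.
    Min-tie : ∀ x → (∀ d → cost (keys x) h d < M) → ∀ {d d′} → eval x d ≡ eval x d′ →
              Min (refine M ω h) x d → Min (refine M ω h) x d′ → cost (keys x) h d ≡ cost (keys x) h d′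
    Min-tie x h<M {d} {d′} eq min min′ = +-cancelˡ-≡ (C d * M) _ _ (begin
        C d * M + H d         ≡⟨ cost-refine M ω h (keys x) d ⟨
        C′ d                  ≡⟨ ≤-antisym (min d′ (sym eq)) (min′ d eq) ⟩
        C′ d′                 ≡⟨ cost-refine M ω h (keys x) d′ ⟩
        C d′ * M + H d′       ≡⟨ cong (λ c → c * M + H d′) (≤-antisym (Min-refine x h<M min d′ (sym eq)) (Min-refine x h<M min′ d eq)) ⟨
        C d * M + H d′        ∎)
      where
      open ≡-Reasoning
      C = cost (keys x) ω
      H = cost (keys x) h
      C′ = cost (keys x) (refine M ω h)

  minimum : ∀ ω (x : Exp N m) s (ds : List (Sel (keys x))) →
    (∃ λ d → eval x d ≡ s × (∀ d′ → d′ ∈ ds → eval x d′ ≡ s → cost (keys x) ω d ≤ cost (keys x) ω d′)) ⊎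
    (∀ d → d ∈ ds → eval x d ≢ s)
  minimum ω x s []       = inj₂ λ _ ()
  minimum ω x s (d ∷ ds) with eval x d ≟ s | minimum ω x s ds
  ... | no d≢  | inj₁ (b , eq , h) = inj₁ (b , eq , λ { _ (here refl) e → contradiction e d≢ ; d′ (there d′∈) → h d′ d′∈ })
  ... | no d≢  | inj₂ h            = inj₂ λ { _ (here refl) → d≢ ; d′ (there d′∈) → h d′ d′∈ }
  ... | yes d≡ | inj₂ h            = inj₁ (d , d≡ , λ { _ (here refl) e → ≤-refl ; d′ (there d′∈) e → contradiction e (h d′ d′∈) })
  ... | yes d≡ | inj₁ (b , eq , h) with ≤-total (cost (keys x) ω d) (cost (keys x) ω b)
  ...   | inj₁ d≤b = inj₁ (d , d≡ , λ { _ (here refl) e → ≤-refl ; d′ (there d′∈) e → ≤-trans d≤b (h d′ d′∈ e) })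
  ...   | inj₂ b≤d = inj₁ (b , eq , λ { _ (here refl) e → b≤d ; d′ (there d′∈) → h d′ d′∈ })

  -- Under `Iso` a state has at most one minimum, so one lightest selection for each attained state
  -- exhausts them.
  minima : ∀ {ω} (x : Exp N m) → Iso ω x →
    Σ (List (Sel (keys x))) λ ds → (length ds ≤ N) × (∀ d → Min ω x d → d ∈ ds)
  minima {ω} x iso with go (allFin N)
    where
    go : (ss : List (Fin N)) → Σ (List (Sel (keys x))) λ ds →
         (length ds ≤ length ss) × (∀ d → Min ω x d → eval x d ∈ ss → d ∈ ds)
    go []       = [] , z≤n , λ _ _ ()
    go (s ∷ ss) with go ss | minimum ω x s (allSel (keys x))
    ... | ds , len , h | inj₁ (b , eq , low) =
      b ∷ ds , s≤s len , λ { d min (here e)   → here (iso d b (trans e (sym eq)) min (λ d′ e′ → low d′ (∈-allSel (keys x) d′) (trans e′ eq)))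
                           ; d min (there s∈) → there (h d min s∈) }
    ... | ds , len , h | inj₂ empty =
      ds , m≤n⇒m≤1+n len , λ { d min (here e)   → contradiction e (empty d (∈-allSel (keys x) d))
                             ; d min (there s∈) → h d min s∈ }
  ... | ds , len , h = ds , ≤-trans len (≤-reflexive (length-tabulate id)) , λ d min → h d min (∈-allFin (eval x d))

-- Exceptional sets of seeds

∣p∪q∣≤∣p∣+∣q∣ : ∀ {n} (p q : Subset n) → ∣ p ∪ q ∣ ≤ ∣ p ∣ + ∣ q ∣
∣p∪q∣≤∣p∣+∣q∣ []          []          = z≤n
∣p∪q∣≤∣p∣+∣q∣ (false ∷ p) (false ∷ q) = ∣p∪q∣≤∣p∣+∣q∣ p q
∣p∪q∣≤∣p∣+∣q∣ (true ∷ p)  (false ∷ q) = s≤s (∣p∪q∣≤∣p∣+∣q∣ p q)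
∣p∪q∣≤∣p∣+∣q∣ (false ∷ p) (true ∷ q)  = ≤-trans (s≤s (∣p∪q∣≤∣p∣+∣q∣ p q)) (≤-reflexive (sym (+-suc ∣ p ∣ ∣ q ∣)))
∣p∪q∣≤∣p∣+∣q∣ (true ∷ p)  (true ∷ q)  = s≤s (≤-trans (m≤n⇒m≤1+n (∣p∪q∣≤∣p∣+∣q∣ p q)) (≤-reflexive (sym (+-suc ∣ p ∣ ∣ q ∣))))

-- Counting form of "with probability at least 1 - c/Q"; `AllBut-×` and `AllBut-list` are the union
-- bound.
AllBut : ∀ {Q} → ℕ → (Fin Q → Set) → Set
AllBut {Q} c P = Σ (Subset Q) λ B → (∣ B ∣ ≤ c) × (∀ i → i ∉ₛ B → P i)

module _ {Q : ℕ} where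

  AllBut-always : ∀ {c} {P : Fin Q → Set} → (∀ i → P i) → AllBut c P
  AllBut-always h = ⊥ , ≤-trans (≤-reflexive (∣⊥∣≡0 Q)) z≤n , λ i _ → h i

  AllBut-× : ∀ {c d} {P R : Fin Q → Set} → AllBut c P → AllBut d R → AllBut (c + d) (λ i → P i × R i)
  AllBut-× (B , B≤ , hB) (C , C≤ , hC) =
    B ∪ C , ≤-trans (∣p∪q∣≤∣p∣+∣q∣ B C) (+-mono-≤ B≤ C≤) ,
    λ i i∉ → hB i (i∉ ∘ x∈p∪q⁺ ∘ inj₁) , hC i (i∉ ∘ x∈p∪q⁺ ∘ inj₂)

  AllBut-mono : ∀ {c d} {P R : Fin Q → Set} → c ≤ d → (∀ i → P i → R i) → AllBut c P → AllBut d R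
  AllBut-mono c≤d h (B , B≤ , hB) = B , ≤-trans B≤ c≤d , λ i i∉ → h i (hB i i∉)

  AllBut-list : ∀ {A : Set} {c} {P : A → Fin Q → Set} (xs : List A) → (∀ x → AllBut c (P x)) →
                AllBut (length xs * c) (λ i → ∀ x → x ∈ xs → P x i)
  AllBut-list []       h = AllBut-always λ _ _ ()
  AllBut-list (x ∷ xs) h = AllBut-mono ≤-refl (λ { i (p , ps) _ (here refl) → p ; i (p , ps) y (there y∈) → ps y y∈ })
                             (AllBut-× (h x) (AllBut-list xs h))

length-cartesianProduct : ∀ {A B : Set} (xs : List A) (ys : List B) → length (cartesianProduct xs ys) ≡ length xs * length ys
length-cartesianProduct []       ys = refl
length-cartesianProduct (x ∷ xs) ys =
  trans (length-++ (map (x ,_) ys)) (cong₂ _+_ (length-map (x ,_) ys) (length-cartesianProduct xs ys))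

badPrimes : ℕ → ℕ → ℕ
badPrimes N m = N * N * (N * N) * m

weight≤ : ∀ {m} (ω : Fin m → ℕ) c → (∀ e → ω e ≤ c) → ∀ S → weight ω S ≤ m * c
weight≤ ω c h []          = z≤n
weight≤ ω c h (false ∷ S) = m≤n⇒m≤o+n c (weight≤ (ω ∘ suc) c (h ∘ suc) S)
weight≤ ω c h (true ∷ S)  = +-mono-≤ (h zero) (weight≤ (ω ∘ suc) c (h ∘ suc) S)

∣++∣ : ∀ {a b} (p : Subset a) (q : Subset b) → ∣ p Vec.++ q ∣ ≡ ∣ p ∣ + ∣ q ∣
∣++∣ []          q = refl
∣++∣ (false ∷ p) q = ∣++∣ p q
∣++∣ (true ∷ p)  q = cong suc (∣++∣ p q)

-- The dependent sum of the sets `g i`, with pairs coded as by `remQuot`: which next prime is good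
-- depends on the primes drawn before.
concatΣ : ∀ {n Q} → (Fin n → Subset Q) → Subset (n * Q)
concatΣ {zero}  g = []
concatΣ {suc n} g = g zero Vec.++ concatΣ (g ∘ suc)

lookup-concatΣ : ∀ {n Q} (g : Fin n → Subset Q) i →
  Vec.lookup (concatΣ g) i ≡ Vec.lookup (g (proj₁ (remQuot Q i))) (proj₂ (remQuot {n} Q i))
lookup-concatΣ {suc n} {Q} g i with splitAt Q i | lookup-splitAt Q (g zero) (concatΣ (g ∘ suc)) i
... | inj₁ j | eq = eq
... | inj₂ j | eq = trans eq (lookup-concatΣ (g ∘ suc) j)

∣concatΣ∣≥ : ∀ {n Q} c (I : Subset n) (g : Fin n → Subset Q) → (∀ i → i ∈ₛ I → c ≤ ∣ g i ∣) → ∣ I ∣ * c ≤ ∣ concatΣ g ∣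
∣concatΣ∣≥ c []          g h = z≤n
∣concatΣ∣≥ c (false ∷ I) g h = ≤-trans (m≤n⇒m≤o+n ∣ g zero ∣ (∣concatΣ∣≥ c I (g ∘ suc) (λ i i∈ → h (suc i) (there i∈))))
                                      (≤-reflexive (sym (∣++∣ (g zero) _)))
∣concatΣ∣≥ c (true ∷ I)  g h = ≤-trans (+-mono-≤ (h zero here) (∣concatΣ∣≥ c I (g ∘ suc) (λ i i∈ → h (suc i) (there i∈))))
                                      (≤-reflexive (sym (∣++∣ (g zero) _)))

-- The scheme and the share of its good seeds

module Scheme (N m : ℕ) {a b : ℕ} (P : Primes a b) where
  open Hash P

  Q : ℕ
  Q = 2 ^ a

  M : ℕ
  M = suc m * 2 ^ b

  seeds : ℕ → ℕ
  seeds zero    = 1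
  seeds (suc j) = seeds j * Q

  -- A seed is a sequence of j prime indices. Later hashes are less significant, so they only break
  -- the ties left by earlier ones.
  weights : ∀ j → Fin (seeds j) → Fin m → ℕ
  weights zero    _ = λ _ → 1
  weights (suc j) i = refine {N} M (weights j (proj₁ (remQuot Q i))) (hash (proj₂ (remQuot {seeds j} Q i)))

  cost-hash< : ∀ (k : Keys m) → Linear k → ∀ i d → cost k (hash i) d < M
  cost-hash< k lin i d = begin-strict
    cost k (hash i) d            ≡⟨ weight-glob (hash i) k lin d ⟨
    weight (hash i) (glob k d)   ≤⟨ weight≤ (hash i) _ (λ e → <⇒≤ (hash<2^ i e)) (glob k d) ⟩
    m * 2 ^ b         <⟨ m<n+m (m * 2 ^ b) (m^n>0 2 b) ⟩
    M                            ∎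
    where open ≤-Reasoning

  separate : ∀ (k : Keys m) → Linear k → ∀ (d d′ : Sel k) →
             AllBut m (λ i → cost k (hash i) d ≡ cost k (hash i) d′ → d ≡ d′)
  separate k lin d d′ with sel-≟ k d d′
  ... | yes d≡d′ = AllBut-always λ _ _ → d≡d′
  ... | no d≢d′ with collisions (glob k d) (glob k d′) (λ eq → d≢d′ (trans (sym (res-glob k lin d)) (trans (cong (res k) eq) (res-glob k lin d′))))
  ...   | B , B≤ , h = B , B≤ , λ i i∉ eq → contradiction
          (trans (weight-glob (hash i) k lin d) (trans eq (sym (weight-glob (hash i) k lin d′)))) (h i i∉)

  -- A minimum of a node is a pair of minima of its children, and these are at most N each,
  -- one for each state; so only N⁴ pairs of selections have to be told apart.
  isolate-node : ∀ {ω} f (x y : Exp N m) → Linear (keys (node f x y)) → Iso ω x → Iso ω y →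
                 AllBut (badPrimes N m) (λ i → Iso (refine {N} M ω (hash i)) (node f x y))
  isolate-node {ω} f x y lin isoˣ isoʸ with minima x isoˣ | minima y isoʸ
  ... | ds , ds≤ , ds∋ | cs , cs≤ , cs∋ =
    AllBut-mono few iso (AllBut-list (cartesianProduct cands cands) (λ (p , q) → separate (keys z) lin p q))
    where
    z = node f x y
    cands = cartesianProduct ds cs
    cands≤ : length cands ≤ N * N
    cands≤ = ≤-trans (≤-reflexive (length-cartesianProduct ds cs)) (*-mono-≤ ds≤ cs≤)
    few : length (cartesianProduct cands cands) * m ≤ badPrimes N m
    few = *-monoˡ-≤ m (≤-trans (≤-reflexive (length-cartesianProduct cands cands)) (*-mono-≤ cands≤ cands≤))
    module _ (i : Fin Q) (sep : ∀ p → p ∈ cartesianProduct cands cands →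
                           cost (keys z) (hash i) (proj₁ p) ≡ cost (keys z) (hash i) (proj₂ p) → proj₁ p ≡ proj₂ p) where
      open Refine {N} M ω (hash i)
      cand : ∀ {d} → Min (refine {N} M ω (hash i)) z d → d ∈ cands
      cand min with Min-children {f = f} x y (Min-refine z (cost-hash< (keys z) lin i) min)
      ... | minˣ , minʸ = ∈-cartesianProduct⁺ (ds∋ _ minˣ) (cs∋ _ minʸ)
      iso : Iso (refine {N} M ω (hash i)) z
      iso d d′ eq min min′ = sep (d , d′) (∈-cartesianProduct⁺ (cand min) (cand min′))
                                 (Min-tie z (cost-hash< (keys z) lin i) eq min min′)

  -- The same prime has to work at all nodes at once, so their exceptional sets add up. Leaves
  -- contribute nothing, because refining preserves isolation.
  isolate-level : ∀ {ω j} (x : Exp N m) → Linear (keys x) → AllIso ω j x →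
                  AllBut (nodes x * badPrimes N m) (λ i → AllIso (refine {N} M ω (hash i)) (suc j) x)
  isolate-level (const s) lin iso = AllBut-always λ _ → tt
  isolate-level {ω} x@(leaf e g) lin iso = AllBut-always λ i → Refine.Iso-refine M ω (hash i) x (cost-hash< (keys x) lin i) iso
  isolate-level {ω} {j} z@(node f x y) lin (iso , isoˣ , isoʸ) = AllBut-mono (≤-reflexive (distrib (nodes x) (nodes y) (badPrimes N m))) (λ i h → h)
      (AllBut-× top (AllBut-× (isolate-level x linˣ isoˣ) (isolate-level y linʸ isoʸ)))
    where
    linˣ = linearˡ (keys x) (keys y) lin
    linʸ = linearʳ (keys x) (keys y) lin
    distrib : ∀ a b c → c + (a * c + b * c) ≡ suc (a + b) * c
    distrib = solve-∀
    top : AllBut (badPrimes N m) (λ i → depth z ≤ suc j → Iso (refine {N} M ω (hash i)) z)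
    top with depth z ≤? suc j
    ... | no  d≰         = AllBut-always λ i d≤ → contradiction d≤ d≰
    ... | yes (s≤s d≤) = AllBut-mono ≤-refl (λ _ h _ → h)
      (isolate-node f x y lin (AllIso⇒Iso x isoˣ (≤-trans (m≤m⊔n (depth x) (depth y)) d≤))
                              (AllIso⇒Iso y isoʸ (≤-trans (m≤n⊔m (depth x) (depth y)) d≤)))

  -- δ bounds the bad primes of one level, and T δ ≤ Q says that they are at most a 1/T share of all
  -- primes.
  module Count (T : ℕ) (x : Exp N m) (lin : Linear (keys x)) (δ : ℕ)
               (x≤δ : nodes x * badPrimes N m ≤ δ) (Tδ≤Q : T * δ ≤ Q) where

    δ≤Q : ∀ {r} → suc r ≤ T → suc r * δ ≤ Q
    δ≤Q r≤ = ≤-trans (*-monoˡ-≤ δ r≤) Tδ≤Q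

    -- At least (T - j) / T of the seeds are good after j levels; r stands for T - j.
    good : ∀ j r → r + j ≡ T → Σ (Subset (seeds j)) λ I →
           (seeds j * r ≤ ∣ I ∣ * T) × (∀ i → i ∈ₛ I → AllIso (weights j i) j x)
    good zero    r eq = true ∷ [] , ≤-reflexive (cong (_+ 0) (trans (sym (+-identityʳ r)) eq)) , λ { zero _ → AllIso-1 x }
    good (suc j) r eq with good j (suc r) (trans (sym (+-suc r j)) eq)
    ... | I , I≥ , isoᴵ = concatΣ g , bound , λ i i∈ → iso i
            (lookup⇒[]= _ (g (proj₁ (remQuot Q i))) (trans (sym (lookup-concatΣ g i)) ([]=⇒lookup i∈)))
      where
      g : Fin (seeds j) → Subset Q
      g i with i ∈? I
      ... | yes i∈ = ∁ (proj₁ (isolate-level x lin (isoᴵ i i∈)))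
      ... | no  _  = ⊥
      g≥ : ∀ i → i ∈ₛ I → Q ∸ δ ≤ ∣ g i ∣
      g≥ i i∈ with i ∈? I
      ... | no i∉ = contradiction i∈ i∉
      ... | yes p with isolate-level x lin (isoᴵ i p)
      ...   | B , B≤ , _ = ≤-trans (∸-monoʳ-≤ Q (≤-trans B≤ x≤δ)) (≤-reflexive (sym (∣∁p∣≡n∸∣p∣ B)))
      iso′ : ∀ i q → q ∈ₛ g i → AllIso (refine {N} M (weights j i) (hash q)) (suc j) x
      iso′ i q q∈ with i ∈? I
      ... | no _  = contradiction q∈ ∉⊥
      ... | yes p = proj₂ (proj₂ (isolate-level x lin (isoᴵ i p))) q (x∈∁p⇒x∉p q∈)
      iso : ∀ i → proj₂ (remQuot {seeds j} Q i) ∈ₛ g (proj₁ (remQuot Q i)) → AllIso (weights (suc j) i) (suc j) x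
      iso i = iso′ (proj₁ (remQuot Q i)) (proj₂ (remQuot {seeds j} Q i))
      δ′ : suc r * δ ≤ Q
      δ′ = δ≤Q (subst (suc r ≤_) (trans (sym (+-suc r j)) eq) (m≤m+n (suc r) j))
      -- Each good seed keeps Q - δ continuations; going from r + 1 to r parts out of T pays for the
      -- lost ones since (r + 1) δ ≤ Q.
      loss : Q * r ≤ suc r * (Q ∸ δ)
      loss = begin
        Q * r                          ≡⟨ m+n∸n≡m (Q * r) Q ⟨
        Q * r + Q ∸ Q                  ≤⟨ ∸-monoʳ-≤ (Q * r + Q) δ′ ⟩
        Q * r + Q ∸ suc r * δ          ≡⟨ cong (_∸ suc r * δ) (trans (+-comm (Q * r) Q) (trans (sym (*-suc Q r)) (*-comm Q (suc r)))) ⟩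
        suc r * Q ∸ suc r * δ          ≡⟨ *-distribˡ-∸ (suc r) Q δ ⟨
        suc r * (Q ∸ δ)                ∎
        where open ≤-Reasoning
      bound : seeds j * Q * r ≤ ∣ concatΣ g ∣ * T
      bound = begin
        seeds j * Q * r                ≡⟨ *-assoc (seeds j) Q r ⟩
        seeds j * (Q * r)              ≤⟨ *-monoʳ-≤ (seeds j) loss ⟩
        seeds j * (suc r * (Q ∸ δ))    ≡⟨ *-assoc (seeds j) (suc r) (Q ∸ δ) ⟨
        seeds j * suc r * (Q ∸ δ)      ≤⟨ *-monoˡ-≤ (Q ∸ δ) I≥ ⟩
        ∣ I ∣ * T * (Q ∸ δ)            ≡⟨ swap ∣ I ∣ T (Q ∸ δ) ⟩
        ∣ I ∣ * (Q ∸ δ) * T            ≤⟨ *-monoˡ-≤ T (∣concatΣ∣≥ (Q ∸ δ) I g g≥) ⟩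
        ∣ concatΣ g ∣ * T              ∎
        where
        open ≤-Reasoning
        swap : ∀ a b c → a * b * c ≡ a * c * b
        swap = solve-∀

  weights< : ∀ j i e → weights j i e < 2 * M ^ j
  weights< zero    i e = s≤s (s≤s z≤n)
  weights< (suc j) i e = begin-strict
    w * M + h                  <⟨ +-monoʳ-< (w * M) h<M ⟩
    w * M + M                  ≡⟨ +-comm (w * M) M ⟩
    suc w * M                  ≤⟨ *-monoˡ-≤ M (weights< j _ e) ⟩
    2 * M ^ j * M              ≡⟨ rearrange (M ^ j) M ⟩
    2 * (M * M ^ j)            ∎
    where
    open ≤-Reasoning
    w = weights j (proj₁ (remQuot Q i)) e
    h = hash (proj₂ (remQuot {seeds j} Q i)) e
    h<M : h < M
    h<M = <-≤-trans (hash<2^ (proj₂ (remQuot {seeds j} Q i)) e) (m≤n*m _ (suc m))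
    rearrange : ∀ a b → 2 * a * b ≡ 2 * (b * a)
    rearrange = solve-∀

  seeds≡ : ∀ j → seeds j ≡ 2 ^ (j * a)
  seeds≡ zero    = refl
  seeds≡ (suc j) = trans (cong (_* Q) (seeds≡ j)) (trans (sym (^-distribˡ-+-* 2 (j * a) a)) (cong (2 ^_) (+-comm (j * a) a)))

-- The family has to be the class of a single root state. Exactness makes `res` and `glob` inverse
-- to each other and lets them preserve weights, so minimality transfers from subsets to local
-- selections.
Iso⇒Isolates : ∀ {N m} (ω : Fin m → ℕ) (x : Exp N m) → Exact (keys x) → Iso ω x →
  ∀ s (F : Subset m → Set) → (∀ S → F S → eval x (res (keys x) S) ≡ s) → (∀ S → eval x (res (keys x) S) ≡ s → F S) →
  Isolates ω F
Iso⇒Isolates {N} {m} ω x exact iso s F F⇒ ⇒F S T FS FT minS minT =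
  exact-injective k exact S T
    (iso (res k S) (res k T) (trans (F⇒ S FS) (sym (F⇒ T FT))) (local S FS minS) (local T FT minT))
  where
  k = keys x
  local : ∀ S → F S → (∀ U → F U → weight ω S ≤ weight ω U) → Min ω x (res k S)
  local S FS min d′ eq = begin
    cost k ω (res k S)         ≡⟨ cost-res ω k exact S ⟩
    weight ω S                 ≤⟨ min (glob k d′) (⇒F _ (trans (cong (eval x) resglob) (trans eq (F⇒ S FS)))) ⟩
    weight ω (glob k d′)       ≡⟨ weight-glob ω k (exact⇒linear k exact) d′ ⟩
    cost k ω d′                ∎
    where
    open ≤-Reasoning
    resglob = res-glob k (exact⇒linear k exact) d′

-- Balancing

-- Without constants every leaf is an edge, so `size` is bounded through m, however large the term
-- was.
data Tree (A : Set) (m : ℕ) : Set where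
  leaf : Fin m → (Bool → A) → Tree A m
  node : (A → A → A) → Tree A m → Tree A m → Tree A m

module _ {A : Set} {m : ℕ} where

  run : Tree A m → Subset m → A
  run (leaf e g)   S = g (Vec.lookup S e)
  run (node f l r) S = f (run l S) (run r S)

  occᵀ : Tree A m → Fin m → ℕ
  occᵀ (leaf f g)   e = occ (one f) e
  occᵀ (node f l r) e = occᵀ l e + occᵀ r e

  size : Tree A m → ℕ
  size (leaf e g)   = 1
  size (node f l r) = size l + size r

  1≤size : ∀ t → 1 ≤ size t
  1≤size (leaf e g)   = ≤-refl
  1≤size (node f l r) = ≤-trans (1≤size l) (m≤m+n (size l) (size r))

  -- A path from the root of a tree down to a hole, outermost frame first.
  Context : Set
  Context = List ((A → A → A) × Tree A m)

  plug : Context → Subset m → A → A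
  plug []             S a = a
  plug ((f , t) ∷ fs) S a = f (plug fs S a) (run t S)

  occᶜ : Context → Fin m → ℕ
  occᶜ []             e = 0
  occᶜ ((f , t) ∷ fs) e = occᵀ t e + occᶜ fs e

  sizeᶜ : Context → ℕ
  sizeᶜ []             = 0
  sizeᶜ ((f , t) ∷ fs) = size t + sizeᶜ fs

  plug-++ : ∀ as bs S a → plug (as ++ bs) S a ≡ plug as S (plug bs S a)
  plug-++ []             bs S a = refl
  plug-++ ((f , t) ∷ as) bs S a = cong (λ b → f b (run t S)) (plug-++ as bs S a)

  occᶜ-++ : ∀ as bs e → occᶜ (as ++ bs) e ≡ occᶜ as e + occᶜ bs e
  occᶜ-++ []             bs e = refl
  occᶜ-++ ((f , t) ∷ as) bs e = trans (cong (occᵀ t e +_) (occᶜ-++ as bs e)) (sym (+-assoc (occᵀ t e) _ _))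

  -- The lowest subtree on a heavy path with more than H leaves. If the tree has at most 2H leaves,
  -- cutting there leaves three pieces of at most H leaves: the context and both children.
  record Heavy (H : ℕ) (t : Tree A m) : Set where
    field
      context : Context
      op      : A → A → A
      l r     : Tree A m
      run≡    : ∀ S → run t S ≡ plug context S (op (run l S) (run r S))
      occ≡    : ∀ e → occᵀ t e ≡ occᶜ context e + (occᵀ l e + occᵀ r e)
      size≡   : size t ≡ sizeᶜ context + (size l + size r)
      H<      : H < size l + size r
      l≤      : size l ≤ H
      r≤      : size r ≤ H

  heavy : ∀ H t → 1 ≤ H → H < size t → Heavy H t
  heavy H (leaf e g)   1≤H H< = contradiction 1≤H (<⇒≱ H<)
  heavy H (node f l r) 1≤H H< with size l ≤? H | size r ≤? H
  ... | yes l≤ | yes r≤ = record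
    { context = [] ; op = f ; l = l ; r = r ; run≡ = λ _ → refl ; occ≡ = λ _ → refl ; size≡ = refl
    ; H< = H< ; l≤ = l≤ ; r≤ = r≤ }
  ... | no l≰ | _ = record
    { context = (f , r) ∷ context ; op = op ; l = l′ ; r = r′
    ; run≡  = λ S → cong (λ a → f a (run r S)) (run≡ S)
    ; occ≡  = λ e → trans (cong (_+ occᵀ r e) (occ≡ e)) (rotate (occᶜ context e) _ (occᵀ r e))
    ; size≡ = trans (cong (_+ size r) size≡) (rotate (sizeᶜ context) _ (size r))
    ; H< = H<′ ; l≤ = l′≤ ; r≤ = r′≤ }
    where
    open Heavy (heavy H l 1≤H (≰⇒> l≰)) renaming (l to l′; r to r′; H< to H<′; l≤ to l′≤; r≤ to r′≤)
    rotate : ∀ a b c → a + b + c ≡ c + a + b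
    rotate = solve-∀
  ... | yes _ | no r≰ = record
    -- Frames have their hole in the first argument, so a descent to the right flips the operation.
    { context = ((λ a b → f b a) , l) ∷ context ; op = op ; l = l′ ; r = r′
    ; run≡  = λ S → cong (f (run l S)) (run≡ S)
    ; occ≡  = λ e → trans (cong (occᵀ l e +_) (occ≡ e)) (sym (+-assoc (occᵀ l e) _ _))
    ; size≡ = trans (cong (size l +_) size≡) (sym (+-assoc (size l) _ _))
    ; H< = H<′ ; l≤ = l′≤ ; r≤ = r′≤ }
    where
    open Heavy (heavy H r 1≤H (≰⇒> r≰)) renaming (l to l′; r to r′; H< to H<′; l≤ to l′≤; r≤ to r′≤)

  -- Halving a context: the parts on both sides of `frame` are small, but the tree hanging from
  -- `frame` can be almost as large as the whole context. `c` counts the leaves passed so far.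
  record Middle (H c : ℕ) (fs : Context) : Set where
    field
      before after : Context
      frame        : (A → A → A) × Tree A m
      split≡       : fs ≡ before ++ frame ∷ after
      before≤      : c + sizeᶜ before ≤ H
      after≤       : sizeᶜ after ≤ H
      frame≤       : size (proj₂ frame) ≤ sizeᶜ fs

  middle : ∀ H c x fs → c ≤ H → c + sizeᶜ (x ∷ fs) ≤ H + H → Middle H c (x ∷ fs)
  middle H c x [] c≤ ≤2H = record
    { before = [] ; after = [] ; frame = x ; split≡ = refl
    ; before≤ = ≤-trans (≤-reflexive (+-identityʳ c)) c≤ ; after≤ = z≤n
    ; frame≤ = m≤m+n _ _ }
  middle H c x@(f , t) (y ∷ fs) c≤ ≤2H with c + size t ≤? H
  ... | no  c+t≰ = record
    { before = [] ; after = y ∷ fs ; frame = x ; split≡ = refl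
    ; before≤ = ≤-trans (≤-reflexive (+-identityʳ c)) c≤
    ; after≤ = +-cancelˡ-≤ H _ _ (≤-trans (+-monoˡ-≤ (sizeᶜ (y ∷ fs)) (<⇒≤ (≰⇒> c+t≰)))
                 (≤-trans (≤-reflexive (+-assoc c (size t) _)) ≤2H))
    ; frame≤ = m≤m+n _ _ }
  ... | yes c+t≤ = record
    { before = x ∷ before ; after = after ; frame = frame ; split≡ = cong (x ∷_) split≡
    ; before≤ = ≤-trans (≤-reflexive (sym (+-assoc c (size t) _))) before≤ ; after≤ = after≤
    ; frame≤ = m≤n⇒m≤o+n (size t) frame≤ }
    where
    open Middle (middle H (c + size t) y fs c+t≤ (≤-trans (≤-reflexive (+-assoc c (size t) _)) ≤2H))

module Balance {n₀ m : ℕ} where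

  A : Set
  A = Fin n₀

  -- States are the functions A → A, together with two markers for the final verdict.
  N : ℕ
  N = 2 + n₀ ^ n₀

  code : (A → A) → Fin N
  code g = suc (suc (funToFin g))

  decode : Fin N → A → A
  decode (suc (suc i)) = finToFun i
  decode _             = id

  decode-code : ∀ g a → decode (code g) a ≡ g a
  decode-code = finToFun-funToFin

  den : Exp N m → Subset m → A → A
  den x S = decode (eval x (res (keys x) S))

  compose : Fin N → Fin N → Fin N
  compose u v = code (decode u ∘ decode v)

  pointwise : (A → A → A) → Fin N → Fin N → Fin N
  pointwise f u v = code (λ a → f (decode u a) (decode v a))

  -- One notion for trees and contexts: a tree denotes the constant function with its value, a
  -- context the function that fills its hole.
  record Balanced (d : ℕ) (sem : Subset m → A → A) (count : Fin m → ℕ) : Set where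
    field
      exp    : Exp N m
      depth≤ : depth exp ≤ d
      den≡   : ∀ S a → den exp S a ≡ sem S a
      occ≡   : ∀ e → occ (keys exp) e ≡ count e

  open Balanced

  balance-node : ∀ {d sem sem′ count count′} f → Balanced d sem count → Balanced d sem′ count′ →
    Balanced (suc d) (λ S a → f (sem S a) (sem′ S a)) (λ e → count e + count′ e)
  balance-node f x y = record
    { exp    = node (pointwise f) (exp x) (exp y)
    ; depth≤ = s≤s (⊔-lub (depth≤ x) (depth≤ y))
    ; den≡   = λ S a → trans (decode-code _ a) (cong₂ f (den≡ x S a) (den≡ y S a))
    ; occ≡   = λ e → cong₂ _+_ (occ≡ x e) (occ≡ y e) }

  balance-∘ : ∀ {d sem sem′ count count′} → Balanced d sem count → Balanced d sem′ count′ →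
    Balanced (suc d) (λ S a → sem S (sem′ S a)) (λ e → count e + count′ e)
  balance-∘ {sem = sem} x y = record
    { exp    = node compose (exp x) (exp y)
    ; depth≤ = s≤s (⊔-lub (depth≤ x) (depth≤ y))
    ; den≡   = λ S a → trans (decode-code _ a) (trans (den≡ x S _) (cong (sem S) (den≡ y S a)))
    ; occ≡   = λ e → cong₂ _+_ (occ≡ x e) (occ≡ y e) }

  balance-id : Balanced 0 (λ S a → a) (λ _ → 0)
  balance-id = record { exp = const (code id) ; depth≤ = z≤n ; den≡ = λ S a → decode-code id a ; occ≡ = λ _ → refl }

  rebalance : ∀ {d d′ sem sem′ count count′} → d ≤ d′ → (∀ S a → sem S a ≡ sem′ S a) → (∀ e → count e ≡ count′ e) →
    Balanced d sem count → Balanced d′ sem′ count′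
  rebalance d≤ sem≡ count≡ x = record
    { exp = exp x ; depth≤ = ≤-trans (depth≤ x) d≤
    ; den≡ = λ S a → trans (den≡ x S a) (sem≡ S a) ; occ≡ = λ e → trans (occ≡ x e) (count≡ e) }

  weaken : ∀ {d d′ sem count} → d ≤ d′ → Balanced d sem count → Balanced d′ sem count
  weaken d≤ = rebalance d≤ (λ _ _ → refl) (λ _ → refl)

  2^suc : ∀ h → 2 ^ suc h ≡ 2 ^ h + 2 ^ h
  2^suc h = cong (2 ^ h +_) (+-identityʳ (2 ^ h))

  -- The depths t of trees and c of contexts obey t(h+1) ≤ c(h) + 1 and c(h+1) ≤ max(c(h), t(h+1)) +
  -- 2; the tree of the middle frame is not halved, whence t(h+1) on the right. The values 4h and 4h
  -- + 2 solve this.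
  balance        : ∀ h (t : Tree A m) → size t ≤ 2 ^ h → Balanced (4 * h) (λ S _ → run t S) (occᵀ t)
  balanceContext : ∀ h (fs : Context) → sizeᶜ fs ≤ 2 ^ h → Balanced (2 + 4 * h) (plug fs) (occᶜ fs)

  balance h (leaf e g) _ = record
    { exp = leaf e (λ b → code (λ _ → g b)) ; depth≤ = z≤n
    ; den≡ = λ S a → decode-code _ a ; occ≡ = λ _ → refl }
  balance zero (node f l r) t≤ = contradiction t≤ (<⇒≱ (+-mono-≤ (1≤size l) (1≤size r)))
  balance (suc h) t@(node _ _ _) t≤ with size t ≤? 2 ^ h
  ... | yes small = weaken (*-monoʳ-≤ 4 (n≤1+n h)) (balance h t small)
  ... | no  large = rebalance (≤-trans (n≤1+n _) (≤-reflexive (sym (*-suc 4 h))))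
      (λ S a → sym (run≡ S)) (λ e → sym (occ≡ᴴ e))
      (balance-∘ (balanceContext h context context≤)
                 (weaken (n≤1+n _) (balance-node op (balance h l l≤) (balance h r r≤))))
    where
    open Heavy (heavy (2 ^ h) t (m^n>0 2 h) (≰⇒> large)) renaming (occ≡ to occ≡ᴴ)
    context≤ : sizeᶜ context ≤ 2 ^ h
    context≤ = +-cancelʳ-≤ (2 ^ h) _ _ (begin
      sizeᶜ context + 2 ^ h                ≤⟨ +-monoʳ-≤ (sizeᶜ context) (<⇒≤ H<) ⟩
      sizeᶜ context + (size l + size r)    ≡⟨ size≡ ⟨
      size t                               ≤⟨ t≤ ⟩
      2 ^ suc h                            ≡⟨ 2^suc h ⟩
      2 ^ h + 2 ^ h                        ∎)
      where open ≤-Reasoning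

  balanceContext h [] _ = weaken z≤n balance-id
  balanceContext zero ((f , t) ∷ []) t≤ =
    rebalance (n≤1+n 1) (λ _ _ → refl) (λ e → +-comm 0 (occᵀ t e))
      (balance-node f balance-id (balance zero t (≤-trans (m≤m+n (size t) 0) t≤)))
  balanceContext zero ((f , t) ∷ (g , u) ∷ fs) t≤ =
    contradiction t≤ (<⇒≱ (+-mono-≤ (1≤size t) (≤-trans (1≤size u) (m≤m+n (size u) (sizeᶜ fs)))))
  balanceContext (suc h) (x ∷ fs) fs≤ =
    rebalance (≤-reflexive (cong (2 +_) (sym (*-suc 4 h))))
      (λ S a → trans (sym (plug-++ before (frame ∷ after) S a)) (cong (λ gs → plug gs S a) (sym split≡)))
      (λ e → trans (cong (occᶜ before e +_) (+-comm (occᶜ after e) _))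
             (trans (sym (occᶜ-++ before (frame ∷ after) e)) (cong (λ gs → occᶜ gs e) (sym split≡))))
      (balance-∘ (weaken (+-monoˡ-≤ (4 * h) (m≤m+n 2 3)) (balanceContext h before before≤))
        (balance-node (proj₁ frame) (weaken (+-monoˡ-≤ (4 * h) (m≤m+n 2 2)) (balanceContext h after after≤))
                       (weaken (≤-reflexive (*-suc 4 h)) (balance (suc h) (proj₂ frame) (≤-trans frame≤ fs≤)))))
    where
    open Middle (middle (2 ^ h) 0 x fs z≤n (≤-trans fs≤ (≤-reflexive (2^suc h))))

  module Decide (t : Tree A m) (h : ℕ) (t≤ : size t ≤ 2 ^ h) (a₀ : A) (acc : A → Bool) where

    balanced = balance h t t≤

    -- All accepting values become one state, because `Iso` compares only selections of equal state
    -- and lightest selections with different accepting values could tie. Done at a node, the merge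
    -- counts as one more level of refinement.
    verdict : Fin N → Fin N → Fin N
    verdict u _ = if acc (decode u a₀) then zero else suc zero

    decide : Exp N m
    decide = node verdict (exp balanced) (const zero)

    decide-depth : depth decide ≤ suc (4 * h)
    decide-depth = s≤s (⊔-lub (depth≤ balanced) z≤n)

    decide-occ : ∀ e → occ (keys decide) e ≡ occᵀ t e
    decide-occ e = trans (+-identityʳ _) (occ≡ balanced e)

    decide-eval : ∀ S → eval decide (res (keys decide) S) ≡ (if acc (run t S) then zero else suc zero)
    decide-eval S = cong (λ a → if acc a then zero else suc zero) (den≡ balanced S a₀)

-- Types of terms

infix 1 _⟷_
_⟷_ : Set → Set → Set
A ⟷ B = (A → B) × (B → A)

⟷-trans : ∀ {A B C} → A ⟷ B → B ⟷ C → A ⟷ C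
⟷-trans (f , g) (h , k) = h ∘ f , g ∘ k

⟷-sym : ∀ {A B} → A ⟷ B → B ⟷ A
⟷-sym (f , g) = g , f

does⟷ : ∀ {P : Set} (P? : Dec P) → does P? ≡ true ⟷ P
does⟷ (yes p) = (λ _ → p) , (λ _ → refl)
does⟷ (no ¬p) = (λ ()) , (λ p → contradiction p ¬p)

does-cong : ∀ {P R : Set} (P? : Dec P) (R? : Dec R) → P ⟷ R → does P? ≡ does R?
does-cong (yes p) (yes r) _       = refl
does-cong (no  _) (no  _) _       = refl
does-cong (yes p) (no ¬r) (f , _) = contradiction (f p) ¬r
does-cong (no ¬p) (yes r) (_ , g) = contradiction (g r) ¬p

∨⟷ : ∀ a b → a ∨ b ≡ true ⟷ (a ≡ true ⊎ b ≡ true)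
∨⟷ true  b = (λ _ → inj₁ refl) , (λ _ → refl)
∨⟷ false b = inj₂ , [ (λ ()) , id ]′

∧⟷ : ∀ a b → a ∧ b ≡ true ⟷ (a ≡ true × b ≡ true)
∧⟷ true  b = (λ eq → refl , eq) , proj₂
∧⟷ false b = (λ ()) , λ { (() , _) }

not⟷ : ∀ {P : Set} b → b ≡ true ⟷ P → not b ≡ true ⟷ (¬ P)
not⟷ true  (f , _) = (λ ()) , λ ¬p → contradiction (f refl) ¬p
not⟷ false (_ , g) = (λ _ p → contradiction (g p) λ ()) , λ _ → refl

anyFin : ∀ {K} → (Fin K → Bool) → Bool
anyFin p = does (Fin.any? (λ c → p c Bool.≟ true))

anyFin⟷ : ∀ {K} (p : Fin K → Bool) → anyFin p ≡ true ⟷ (∃ λ c → p c ≡ true)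
anyFin⟷ p = does⟷ (Fin.any? (λ c → p c Bool.≟ true))

anyFin-cong : ∀ {K} {p q : Fin K → Bool} → p ≗ q → anyFin p ≡ anyFin q
anyFin-cong p≗q = does-cong (Fin.any? _) (Fin.any? _)
  ((λ (c , e) → c , trans (sym (p≗q c)) e) , (λ (c , e) → c , trans (p≗q c) e))

toFin : Bool → Fin 2
toFin false = zero
toFin true  = suc zero

fromFin : Fin 2 → Bool
fromFin zero       = false
fromFin (suc zero) = true

fromFin-toFin : ∀ b → fromFin (toFin b) ≡ b
fromFin-toFin false = refl
fromFin-toFin true  = refl

funToFin-cong : ∀ {a b} {f g : Fin a → Fin b} → f ≗ g → funToFin f ≡ funToFin g
funToFin-cong {zero}  h = refl
funToFin-cong {suc a} h = cong₂ combine (h zero) (funToFin-cong (h ∘ suc))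

subsetCode : ∀ {K} → (Fin K → Bool) → Fin (2 ^ K)
subsetCode p = funToFin (toFin ∘ p)

subsetDecode : ∀ {K} → Fin (2 ^ K) → Fin K → Bool
subsetDecode s c = fromFin (finToFun s c)

subsetDecode-code : ∀ {K} (p : Fin K → Bool) → subsetDecode (subsetCode p) ≗ p
subsetDecode-code p c = trans (cong fromFin (finToFun-funToFin (toFin ∘ p) c)) (fromFin-toFin (p c))

subsetCode-cong : ∀ {K} {p q : Fin K → Bool} → p ≗ q → subsetCode p ≡ subsetCode q
subsetCode-cong h = funToFin-cong (λ c → cong toFin (h c))

anySel : ∀ {m} (k : Keys m) → Sel k → Bool
anySel none      d       = false
anySel (one e)   b       = b
anySel (two k l) (d , c) = anySel k d ∨ anySel l c

meetCount : ∀ {m} (k : Keys m) → Sel k → Sel k → ℕ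
meetCount none      d       c         = 0
meetCount (one e)   b       c         = bit (b ∧ c)
meetCount (two k l) (d , c) (d′ , c′) = meetCount k d d′ + meetCount l c c′

Mem : ∀ {m} → Keys m → Fin m → Set
Mem none      e = Empty.⊥
Mem (one f)   e = f ≡ e
Mem (two k l) e = Mem k e ⊎ Mem l e

anySel-res : ∀ {m} (k : Keys m) S → anySel k (res k S) ≡ true ⟷ (∃ λ e → Mem k e × Vec.lookup S e ≡ true)
anySel-res none      S = (λ ()) , λ { (_ , () , _) }
anySel-res (one f)   S = (λ eq → f , refl , eq) , λ { (_ , refl , eq) → eq }
anySel-res (two k l) S with anySel-res k S | anySel-res l S | ∨⟷ (anySel k (res k S)) (anySel l (res l S))
... | f , g | f′ , g′ | h , h′ =
  (λ eq → [ (λ x → let (e , e∈ , S∋) = f x in e , inj₁ e∈ , S∋) , (λ x → let (e , e∈ , S∋) = f′ x in e , inj₂ e∈ , S∋) ]′ (h eq)) ,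
  λ { (e , inj₁ e∈ , S∋) → h′ (inj₁ (g (e , e∈ , S∋))) ; (e , inj₂ e∈ , S∋) → h′ (inj₂ (g′ (e , e∈ , S∋))) }

weight-1 : ∀ {m} (S : Subset m) → weight (λ _ → 1) S ≡ ∣ S ∣
weight-1 []          = refl
weight-1 (true ∷ S)  = cong suc (weight-1 S)
weight-1 (false ∷ S) = weight-1 S

meetCount-res : ∀ {m} (k : Keys m) → Exact k → ∀ S T → meetCount k (res k S) (res k T) ≡ ∣ S ∩ T ∣
meetCount-res k exact S T = trans (go k) (trans (cost-res (λ _ → 1) k exact (S ∩ T)) (weight-1 (S ∩ T)))
  where
  go : ∀ k → meetCount k (res k S) (res k T) ≡ cost k (λ _ → 1) (res k (S ∩ T))
  go none      = refl
  go (one e)   = cong bit (sym (lookup-zipWith _∧_ e S T))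
  go (two k l) = cong₂ _+_ (go k) (go l)

-- Terms build an incidence structure from single vertices and edges.  The edges of a term wait for
-- end vertices in slots Fin K; in op hit move S T the vertices of S become incident with the edges
-- of T that wait in a slot satisfying hit, and then the slots of the edges of T are renamed by move.
data Term (n m K : ℕ) : Set where
  empty  : Term n m K
  vertex : Fin n → Term n m K
  edge   : Fin m → (Fin K → Bool) → Term n m K
  op     : (Fin K → Bool) → (Fin K → Fin K → Bool) → Term n m K → Term n m K → Term n m K

data Kind : Set where
  V E : Kind

-- Serves both the modular counting predicates and the test for singletons, which stand for the
-- first-order variables.
record Counter : Set where
  field
    modulus : ℕ
    class   : ℕ → Fin modulus
    plus    : Fin modulus → Fin modulus → Fin modulus
    class-+ : ∀ a b → class (a + b) ≡ plus (class a) (class b)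
    ok      : Fin modulus → Bool

-- All variables range over pairs of a vertex set and an edge set; cnt κ x y θ counts the elements of
-- kind κ in the intersection of x and y.
data Core (j : ℕ) : Set where
  cnt : Kind → Fin j → Fin j → Counter → Core j
  inc : Fin j → Fin j → Core j
  neg : Core j → Core j
  and : Core j → Core j → Core j
  ex  : Core (suc j) → Core j

module _ {n m K : ℕ} where

  vkeys : Term n m K → Keys n
  vkeys empty        = none
  vkeys (vertex v)   = one v
  vkeys (edge e p)   = none
  vkeys (op h r S T) = two (vkeys S) (vkeys T)

  ekeys : Term n m K → Keys m
  ekeys empty        = none
  ekeys (vertex v)   = none
  ekeys (edge e p)   = one e
  ekeys (op h r S T) = two (ekeys S) (ekeys T)

  Val : Term n m K → Set
  Val T = Sel (vkeys T) × Sel (ekeys T)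

  left : ∀ {h r S T} → Val (op h r S T) → Val S
  left ((x , _) , (f , _)) = x , f

  right : ∀ {h r S T} → Val (op h r S T) → Val T
  right ((_ , x) , (_ , f)) = x , f

  resᵀ : (T : Term n m K) → Subset n × Subset m → Val T
  resᵀ T (X , F) = res (vkeys T) X , res (ekeys T) F

  Pend : Term n m K → Fin m → Fin K → Set
  Pend empty        e c = Empty.⊥
  Pend (vertex v)   e c = Empty.⊥
  Pend (edge f p)   e c = f ≡ e × p c ≡ true
  Pend (op h r S T) e c = Pend S e c ⊎ (∃ λ c′ → Pend T e c′ × r c′ c ≡ true)

  Incᵀ : Term n m K → Fin n → Fin m → Set
  Incᵀ empty        v e = Empty.⊥
  Incᵀ (vertex u)   v e = Empty.⊥
  Incᵀ (edge f p)   v e = Empty.⊥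
  Incᵀ (op h r S T) v e = (Incᵀ S v e ⊎ Incᵀ T v e) ⊎ (Mem (vkeys S) v × (∃ λ c → Pend T e c × h c ≡ true))

  count : Kind → (T : Term n m K) → Val T → Val T → ℕ
  count V T (x , _) (y , _) = meetCount (vkeys T) x y
  count E T (_ , f) (_ , g) = meetCount (ekeys T) f g

  pend : (T : Term n m K) → Sel (ekeys T) → Fin K → Bool
  pend empty        f       c = false
  pend (vertex v)   f       c = false
  pend (edge e p)   b       c = b ∧ p c
  pend (op h r S T) (f , g) c = pend S f c ∨ anyFin (λ c′ → pend T g c′ ∧ r c′ c)

  touches : (T : Term n m K) → Val T → Val T → Bool
  touches empty          x       y       = false
  touches (vertex v)     x       y       = false
  touches (edge e p)     x       y       = false
  touches o@(op h r S T) x y =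
    (touches S (left {h} {r} {S} {T} x) (left {h} {r} {S} {T} y) ∨ touches T (right {h} {r} {S} {T} x) (right {h} {r} {S} {T} y))
    ∨ (anySel (vkeys S) (proj₁ (left {h} {r} {S} {T} x)) ∧ anyFin (λ c → pend T (proj₂ (right {h} {r} {S} {T} y)) c ∧ h c))

  pend-res : ∀ T F c → pend T (res (ekeys T) F) c ≡ true ⟷ (∃ λ e → Vec.lookup F e ≡ true × Pend T e c)
  pend-res empty        F c = (λ ()) , λ ()
  pend-res (vertex v)   F c = (λ ()) , λ ()
  pend-res (edge f p)   F c with ∧⟷ (Vec.lookup F f) (p c)
  ... | to , from = (λ eq → f , proj₁ (to eq) , refl , proj₂ (to eq)) , λ { (_ , F∋ , refl , pc) → from (F∋ , pc) }
  pend-res (op h r S T) F c = to , from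
    where
    fS = res (ekeys S) F
    fT = res (ekeys T) F
    body : Fin K → Bool
    body c′ = pend T fT c′ ∧ r c′ c
    to : pend S fS c ∨ anyFin body ≡ true → _
    to eq with proj₁ (∨⟷ (pend S fS c) (anyFin body)) eq
    ... | inj₁ eqS with proj₁ (pend-res S F c) eqS
    ...   | e , F∋ , P = e , F∋ , inj₁ P
    to eq | inj₂ eqT with proj₁ (anyFin⟷ body) eqT
    ...   | c′ , eq′ with proj₁ (∧⟷ (pend T fT c′) (r c′ c)) eq′
    ...     | eqP , eqr with proj₁ (pend-res T F c′) eqP
    ...       | e , F∋ , P = e , F∋ , inj₂ (c′ , P , eqr)
    from : (∃ λ e → Vec.lookup F e ≡ true × Pend (op h r S T) e c) → pend S fS c ∨ anyFin body ≡ true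
    from (e , F∋ , inj₁ P) = proj₂ (∨⟷ (pend S fS c) (anyFin body)) (inj₁ (proj₂ (pend-res S F c) (e , F∋ , P)))
    from (e , F∋ , inj₂ (c′ , P , eqr)) = proj₂ (∨⟷ (pend S fS c) (anyFin body)) (inj₂ (proj₂ (anyFin⟷ body)
      (c′ , proj₂ (∧⟷ (pend T fT c′) (r c′ c)) (proj₂ (pend-res T F c′) (e , F∋ , P) , eqr))))

  touches-res : ∀ T (x y : Subset n × Subset m) → touches T (resᵀ T x) (resᵀ T y) ≡ true ⟷
    (∃ λ v → ∃ λ e → Vec.lookup (proj₁ x) v ≡ true × Vec.lookup (proj₂ y) e ≡ true × Incᵀ T v e)
  touches-res empty        x y = (λ ()) , λ ()
  touches-res (vertex v)   x y = (λ ()) , λ ()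
  touches-res (edge e p)   x y = (λ ()) , λ ()
  touches-res (op h r S T) x@(X , _) y@(_ , F) = to , from
    where
    a = touches S (resᵀ S x) (resᵀ S y)
    b = touches T (resᵀ T x) (resᵀ T y)
    body : Fin K → Bool
    body c = pend T (res (ekeys T) F) c ∧ h c
    d = anySel (vkeys S) (res (vkeys S) X)
    to : (a ∨ b) ∨ (d ∧ anyFin body) ≡ true → _
    to eq with proj₁ (∨⟷ (a ∨ b) (d ∧ anyFin body)) eq
    to eq | inj₁ eq₁ with proj₁ (∨⟷ a b) eq₁
    ... | inj₁ eqS with proj₁ (touches-res S x y) eqS
    ...   | v , e , X∋ , F∋ , i = v , e , X∋ , F∋ , inj₁ (inj₁ i)
    to eq | inj₁ eq₁ | inj₂ eqT with proj₁ (touches-res T x y) eqT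
    ...   | v , e , X∋ , F∋ , i = v , e , X∋ , F∋ , inj₁ (inj₂ i)
    to eq | inj₂ eq₂ with proj₁ (∧⟷ d (anyFin body)) eq₂
    ... | eqd , eqb with proj₁ (anySel-res (vkeys S) X) eqd | proj₁ (anyFin⟷ body) eqb
    ...   | v , v∈ , X∋ | c , eqc with proj₁ (∧⟷ (pend T (res (ekeys T) F) c) (h c)) eqc
    ...     | eqp , hc with proj₁ (pend-res T F c) eqp
    ...       | e , F∋ , P = v , e , X∋ , F∋ , inj₂ (v∈ , c , P , hc)
    from : (∃ λ v → ∃ λ e → Vec.lookup X v ≡ true × Vec.lookup F e ≡ true × Incᵀ (op h r S T) v e) → (a ∨ b) ∨ (d ∧ anyFin body) ≡ true
    from (v , e , X∋ , F∋ , inj₁ (inj₁ i)) = proj₂ (∨⟷ (a ∨ b) _) (inj₁ (proj₂ (∨⟷ a b) (inj₁ (proj₂ (touches-res S x y) (v , e , X∋ , F∋ , i)))))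
    from (v , e , X∋ , F∋ , inj₁ (inj₂ i)) = proj₂ (∨⟷ (a ∨ b) _) (inj₁ (proj₂ (∨⟷ a b) (inj₂ (proj₂ (touches-res T x y) (v , e , X∋ , F∋ , i)))))
    from (v , e , X∋ , F∋ , inj₂ (v∈ , c , P , hc)) = proj₂ (∨⟷ (a ∨ b) _) (inj₂ (proj₂ (∧⟷ d (anyFin body))
      ( proj₂ (anySel-res (vkeys S) X) (v , v∈ , X∋)
      , proj₂ (anyFin⟷ body) (c , proj₂ (∧⟷ (pend T (res (ekeys T) F) c) (h c)) (proj₂ (pend-res T F c) (e , F∋ , P) , hc)))))

-- Finite types and their composition

module _ (K : ℕ) where

  -- For `inc` a type records whether the two sets touch, whether the vertex set meets the term, and
  -- the slots in which edges of the edge set wait. A quantifier takes the power set, so the bound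
  -- is a tower in the quantifier depth, independent of the graph.
  states : ∀ {j} → Core j → ℕ
  states (cnt κ x y θ) = Counter.modulus θ
  states (inc x y)     = 2 * (2 * 2 ^ K)
  states (neg φ)       = states φ
  states (and φ ψ)     = states φ * states ψ
  states (ex φ)        = 2 ^ states φ

encodeInc : ∀ {K} → Bool → Bool → (Fin K → Bool) → Fin (2 * (2 * 2 ^ K))
encodeInc {K} a b p = combine (toFin a) (combine {n = 2 ^ K} (toFin b) (subsetCode p))

unpack : ∀ {a b c} → Fin (a * (b * c)) → Fin a × Fin b × Fin c
unpack {a} {b} {c} s = let (i , t) = remQuot {a} (b * c) s in i , remQuot {b} c t

unpack-pack : ∀ {a b c} (i : Fin a) (j : Fin b) (k : Fin c) → unpack (combine i (combine j k)) ≡ (i , j , k)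
unpack-pack {a} {b} {c} i j k =
  trans (cong (λ (i , t) → i , remQuot {b} c t) (Fin.remQuot-combine i (combine j k))) (cong (i ,_) (Fin.remQuot-combine j k))

decodeInc : ∀ {K} → Fin (2 * (2 * 2 ^ K)) → Bool × Bool × (Fin K → Bool)
decodeInc {K} s = let (i , j , k) = unpack {2} {2} {2 ^ K} s in fromFin i , fromFin j , subsetDecode k

-- Functions need not be equal when their values are, so the third component is kept apart.
decode-encodeInc : ∀ {K} a b (p : Fin K → Bool) →
  decodeInc {K} (encodeInc a b p) ≡ (a , b , subsetDecode (subsetCode p))
decode-encodeInc {K} a b p =
  trans (cong (λ (i , j , k) → fromFin i , fromFin j , subsetDecode k) (unpack-pack (toFin a) (toFin b) (subsetCode p)))
        (cong₂ (λ x y → x , y , subsetDecode (subsetCode p)) (fromFin-toFin a) (fromFin-toFin b))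

glueInc : ∀ {K} → (Fin K → Bool) → (Fin K → Fin K → Bool) →
          Bool × Bool × (Fin K → Bool) → Bool × Bool × (Fin K → Bool) → Fin (2 * (2 * 2 ^ K))
glueInc h r (a , b , p) (a′ , b′ , p′) =
  encodeInc ((a ∨ a′) ∨ (b ∧ anyFin (λ c → p′ c ∧ h c))) (b ∨ b′) (λ c → p c ∨ anyFin (λ c′ → p′ c′ ∧ r c′ c))

_∋?_ : ∀ {N} (s : Fin (2 ^ N)) q → Dec (subsetDecode {N} s q ≡ true)
_∋?_ {N} s q = subsetDecode {N} s q Bool.≟ true

∃Sel? : ∀ {m} (k : Keys m) {P : Sel k → Set} → (∀ d → Dec (P d)) → Dec (∃ P)
∃Sel? k P? = Dec.map′ (λ p → let (d , _ , Pd) = find p in d , Pd) (λ (d , Pd) → lose (∈-allSel k d) Pd)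
                      (Any.any? P? (allSel k))

module _ {n m K : ℕ} where

  ∃Val? : (T : Term n m K) {P : Val T → Set} → (∀ d → Dec (P d)) → Dec (∃ P)
  ∃Val? T P? = Dec.map′ (λ (x , f , p) → (x , f) , p) (λ ((x , f) , p) → x , f , p)
                        (∃Sel? (vkeys T) λ x → ∃Sel? (ekeys T) λ f → P? (x , f))

  typeInc : (T : Term n m K) → Val T → Val T → Fin (2 * (2 * 2 ^ K))
  typeInc T x y = encodeInc (touches T x y) (anySel (vkeys T) (proj₁ x)) (pend T (proj₂ y))

  -- For `ex` it is the set of types attained by extensions of the valuation. Negation keeps the
  -- type and acts in `accepts` only.
  type : ∀ {j} (φ : Core j) (T : Term n m K) → Vec (Val T) j → Fin (states K φ)
  image? : ∀ {j} (φ : Core (suc j)) (T : Term n m K) (ρ : Vec (Val T) j) q → Dec (∃ λ d → type φ T (d ∷ ρ) ≡ q)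

  type (cnt κ x y θ) T ρ = Counter.class θ (count κ T (Vec.lookup ρ x) (Vec.lookup ρ y))
  type (inc x y)     T ρ = typeInc T (Vec.lookup ρ x) (Vec.lookup ρ y)
  type (neg φ)       T ρ = type φ T ρ
  type (and φ ψ)     T ρ = combine (type φ T ρ) (type ψ T ρ)
  type (ex φ)        T ρ = subsetCode (λ q → does (image? φ T ρ q))

  image? φ T ρ q = ∃Val? T (λ d → type φ T (d ∷ ρ) ≟ q)

  glue : ∀ {j} (φ : Core j) → (Fin K → Bool) → (Fin K → Fin K → Bool) →
         Fin (states K φ) → Fin (states K φ) → Fin (states K φ)
  glue? : ∀ {j} (φ : Core j) (h : Fin K → Bool) (r : Fin K → Fin K → Bool) (s t : Fin (2 ^ states K φ)) q →
          Dec (∃ λ a → ∃ λ b → subsetDecode {states K φ} s a ≡ true × subsetDecode {states K φ} t b ≡ true × glue φ h r a b ≡ q)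

  glue (cnt κ x y θ) h r s t = Counter.plus θ s t
  glue (inc x y)     h r s t = glueInc h r (decodeInc {K} s) (decodeInc {K} t)
  glue (neg φ)       h r s t = glue φ h r s t
  glue (and φ ψ)     h r s t =
    let (a , b)   = remQuot {states K φ} (states K ψ) s
        (a′ , b′) = remQuot {states K φ} (states K ψ) t
    in combine (glue φ h r a a′) (glue ψ h r b b′)
  glue (ex φ)        h r s t = subsetCode (λ q → does (glue? φ h r s t q))

  glue? φ h r s t q = Fin.any? λ a → Fin.any? λ b → _∋?_ {states K φ} s a ×-dec _∋?_ {states K φ} t b ×-dec (glue φ h r a b ≟ q)

  ∋-type-ex : ∀ {j} (φ : Core (suc j)) T (ρ : Vec (Val T) j) q →
              subsetDecode {states K φ} (type (ex φ) T ρ) q ≡ true ⟷ (∃ λ d → type φ T (d ∷ ρ) ≡ q)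
  ∋-type-ex φ T ρ q =
    ⟷-trans ((λ eq → trans (sym dc) eq) , (λ eq → trans dc eq)) (does⟷ (image? φ T ρ q))
    where
    dc : subsetDecode {states K φ} (type (ex φ) T ρ) q ≡ does (image? φ T ρ q)
    dc = subsetDecode-code (λ q → does (image? φ T ρ q)) q

  module _ {h : Fin K → Bool} {r : Fin K → Fin K → Bool} {S T : Term n m K} where

    leftᵛ : Val (op h r S T) → Val S
    leftᵛ = left {h = h} {r} {S} {T}

    rightᵛ : Val (op h r S T) → Val T
    rightᵛ = right {h = h} {r} {S} {T}

    count-op : ∀ κ x y → count κ (op h r S T) x y ≡ count κ S (leftᵛ x) (leftᵛ y) + count κ T (rightᵛ x) (rightᵛ y)
    count-op V x y = refl
    count-op E x y = refl

    typeInc-op : ∀ x y → typeInc (op h r S T) x y ≡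
                         glueInc h r (decodeInc {K} (typeInc S (leftᵛ x) (leftᵛ y))) (decodeInc {K} (typeInc T (rightᵛ x) (rightᵛ y)))
    typeInc-op x y = trans
      (cong₂ (λ z w → combine (toFin ((a ∨ a′) ∨ (b ∧ z))) (combine {n = 2 ^ K} (toFin (b ∨ b′)) w))
        (anyFin-cong λ c → cong (_∧ h c) (p′≗ c))
        (subsetCode-cong λ c → cong₂ _∨_ (p≗ c) (anyFin-cong λ c′ → cong (_∧ r c′ c) (p′≗ c′))))
      (cong₂ (glueInc h r) (sym (decode-encodeInc a b p)) (sym (decode-encodeInc a′ b′ p′)))
      where
      a = touches S (leftᵛ x) (leftᵛ y)
      a′ = touches T (rightᵛ x) (rightᵛ y)
      b = anySel (vkeys S) (proj₁ (leftᵛ x))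
      b′ = anySel (vkeys T) (proj₁ (rightᵛ x))
      p = pend S (proj₂ (leftᵛ y))
      p′ = pend T (proj₂ (rightᵛ y))
      p≗ : p ≗ subsetDecode (subsetCode p)
      p≗ c = sym (subsetDecode-code p c)
      p′≗ : p′ ≗ subsetDecode (subsetCode p′)
      p′≗ c = sym (subsetDecode-code p′ c)

    -- Composition theorem. A value over `op` is an independent pair of values over the two parts,
    -- so for `ex` the attained types are the glued pairs of attained types.
    type-op : ∀ {j} (φ : Core j) (ρ : Vec (Val (op h r S T)) j) →
              type φ (op h r S T) ρ ≡ glue φ h r (type φ S (Vec.map leftᵛ ρ)) (type φ T (Vec.map rightᵛ ρ))
    type-op (cnt κ x y θ) ρ
      rewrite lookup-map x leftᵛ ρ | lookup-map y leftᵛ ρ | lookup-map x rightᵛ ρ | lookup-map y rightᵛ ρ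
      = trans (cong (Counter.class θ) (count-op κ (Vec.lookup ρ x) (Vec.lookup ρ y))) (Counter.class-+ θ _ _)
    type-op (inc x y) ρ =
      trans (typeInc-op (Vec.lookup ρ x) (Vec.lookup ρ y))
        (cong₂ (λ s t → glueInc h r (decodeInc {K} s) (decodeInc {K} t))
          (sym (cong₂ (typeInc S) (lookup-map x leftᵛ ρ) (lookup-map y leftᵛ ρ)))
          (sym (cong₂ (typeInc T) (lookup-map x rightᵛ ρ) (lookup-map y rightᵛ ρ))))
    type-op (neg φ) ρ = type-op φ ρ
    type-op (and φ ψ) ρ = trans (cong₂ combine (type-op φ ρ) (type-op ψ ρ))
      (cong₂ (λ s t → combine (glue φ h r (proj₁ s) (proj₁ t)) (glue ψ h r (proj₂ s) (proj₂ t)))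
        (sym (Fin.remQuot-combine (type φ S (Vec.map leftᵛ ρ)) (type ψ S (Vec.map leftᵛ ρ))))
        (sym (Fin.remQuot-combine (type φ T (Vec.map rightᵛ ρ)) (type ψ T (Vec.map rightᵛ ρ)))))
    type-op (ex φ) ρ = subsetCode-cong λ q →
      does-cong (image? φ (op h r S T) ρ q) (glue? φ h r (type (ex φ) S ρˡ) (type (ex φ) T ρʳ) q) (to q , from q)
      where
      ρˡ = Vec.map leftᵛ ρ
      ρʳ = Vec.map rightᵛ ρ
      to : ∀ q → (∃ λ d → type φ (op h r S T) (d ∷ ρ) ≡ q) →
           ∃ λ a → ∃ λ b → subsetDecode {states K φ} (type (ex φ) S ρˡ) a ≡ true × subsetDecode {states K φ} (type (ex φ) T ρʳ) b ≡ true × glue φ h r a b ≡ q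
      to q (d , eq) = type φ S (leftᵛ d ∷ ρˡ) , type φ T (rightᵛ d ∷ ρʳ)
        , proj₂ (∋-type-ex φ S ρˡ _) (leftᵛ d , refl)
        , proj₂ (∋-type-ex φ T ρʳ _) (rightᵛ d , refl)
        , trans (sym (type-op φ (d ∷ ρ))) eq
      from : ∀ q → (∃ λ a → ∃ λ b → subsetDecode {states K φ} (type (ex φ) S ρˡ) a ≡ true × subsetDecode {states K φ} (type (ex φ) T ρʳ) b ≡ true × glue φ h r a b ≡ q) →
             ∃ λ d → type φ (op h r S T) (d ∷ ρ) ≡ q
      from q (a , b , a∈ , b∈ , eq) with proj₁ (∋-type-ex φ S ρˡ a) a∈ | proj₁ (∋-type-ex φ T ρʳ b) b∈
      ... | (x , f) , refl | (y , g) , refl = ((x , y) , (f , g)) , trans (type-op φ (((x , y) , (f , g)) ∷ ρ)) eq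

  accepts : ∀ {j} (φ : Core j) → Fin (states K φ) → Bool
  accepts (cnt κ x y θ) s = Counter.ok θ s
  accepts (inc x y)     s = proj₁ (decodeInc {K} s)
  accepts (neg φ)       s = not (accepts φ s)
  accepts (and φ ψ)     s = let (a , b) = remQuot {states K φ} (states K ψ) s in accepts φ a ∧ accepts ψ b
  accepts (ex φ)        s = does (Fin.any? λ q → _∋?_ {states K φ} s q ×-dec (accepts φ q Bool.≟ true))

-- Types decide satisfaction

part : ∀ {n m} → Kind → (x y : Subset n × Subset m) → ℕ
part V (X , _) (Y , _) = ∣ X ∩ Y ∣
part E (_ , F) (_ , H) = ∣ F ∩ H ∣

Satᶜ : ∀ {n m j} → Graph n m → Vec (Subset n × Subset m) j → Core j → Set
Satᶜ G ρ (cnt κ x y θ) = Counter.ok θ (Counter.class θ (part κ (Vec.lookup ρ x) (Vec.lookup ρ y))) ≡ true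
Satᶜ G ρ (inc x y)     = ∃ λ v → ∃ λ e → Vec.lookup (proj₁ (Vec.lookup ρ x)) v ≡ true ×
                                           Vec.lookup (proj₂ (Vec.lookup ρ y)) e ≡ true × Inc G v e
Satᶜ G ρ (neg φ)       = ¬ Satᶜ G ρ φ
Satᶜ G ρ (and φ ψ)     = Satᶜ G ρ φ × Satᶜ G ρ ψ
Satᶜ G ρ (ex φ)        = ∃ λ d → Satᶜ G (d ∷ ρ) φ

record Builds {n m K} (T : Term n m K) (G : Graph n m) : Set where
  field
    vexact : Exact (vkeys T)
    eexact : Exact (ekeys T)
    inc⟷   : ∀ v e → Incᵀ T v e ⟷ Inc G v e

module _ {n m K} {T : Term n m K} {G : Graph n m} (builds : Builds T G) where
  open Builds builds

  part-res : ∀ κ x y → count κ T (resᵀ T x) (resᵀ T y) ≡ part κ x y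
  part-res V (X , _) (Y , _) = meetCount-res (vkeys T) vexact X Y
  part-res E (_ , F) (_ , H) = meetCount-res (ekeys T) eexact F H

  accepts-type : ∀ {j} (φ : Core j) (ρ : Vec (Subset n × Subset m) j) →
                 accepts {n} {m} φ (type φ T (Vec.map (resᵀ T) ρ)) ≡ true ⟷ Satᶜ G ρ φ
  accepts-type (cnt κ x y θ) ρ
    rewrite lookup-map x (resᵀ T) ρ | lookup-map y (resᵀ T) ρ | part-res κ (Vec.lookup ρ x) (Vec.lookup ρ y) = id , id
  accepts-type (inc x y) ρ =
    ⟷-trans ((λ acc → trans (sym eq) acc) , (λ acc → trans eq acc)) (⟷-trans (touches-res T (Vec.lookup ρ x) (Vec.lookup ρ y))
        ((λ (v , e , X∋ , F∋ , i) → v , e , X∋ , F∋ , proj₁ (inc⟷ v e) i) , (λ (v , e , X∋ , F∋ , i) → v , e , X∋ , F∋ , proj₂ (inc⟷ v e) i)))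
    where
    X = resᵀ T (Vec.lookup ρ x)
    Y = resᵀ T (Vec.lookup ρ y)
    eq : proj₁ (decodeInc {K} (type (inc x y) T (Vec.map (resᵀ T) ρ))) ≡ touches T (resᵀ T (Vec.lookup ρ x)) (resᵀ T (Vec.lookup ρ y))
    eq = trans (cong₂ (λ u w → proj₁ (decodeInc {K} (typeInc T u w))) (lookup-map x (resᵀ T) ρ) (lookup-map y (resᵀ T) ρ))
               (cong proj₁ (decode-encodeInc {K} (touches T X Y) (anySel (vkeys T) (proj₁ X)) (pend T (proj₂ Y))))
  accepts-type (neg φ) ρ = not⟷ (accepts {n} {m} φ (type φ T (Vec.map (resᵀ T) ρ))) (accepts-type φ ρ)
  accepts-type (and φ ψ) ρ =
    ⟷-trans ((λ acc → trans (sym eq) acc) , (λ acc → trans eq acc))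
      (⟷-trans (∧⟷ (accepts {n} {m} φ (type φ T σ)) (accepts {n} {m} ψ (type ψ T σ))) ((λ (a , b) → proj₁ (accepts-type φ ρ) a , proj₁ (accepts-type ψ ρ) b)
                        , (λ (a , b) → proj₂ (accepts-type φ ρ) a , proj₂ (accepts-type ψ ρ) b)))
    where
    σ = Vec.map (resᵀ T) ρ
    eq : accepts {n} {m} (and φ ψ) (type (and φ ψ) T σ) ≡ accepts {n} {m} φ (type φ T σ) ∧ accepts {n} {m} ψ (type ψ T σ)
    eq = cong (λ s → accepts {n} {m} φ (proj₁ s) ∧ accepts {n} {m} ψ (proj₂ s)) (Fin.remQuot-combine (type φ T σ) (type ψ T σ))
  accepts-type (ex φ) ρ = ⟷-trans (does⟷ (Fin.any? _)) (to , from)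
    where
    σ = Vec.map (resᵀ T) ρ
    -- Every value over the term is the restriction of a global pair of sets, so quantifying over
    -- either amounts to the same.
    globᵀ : ∀ d → resᵀ T (glob (vkeys T) (proj₁ d) , glob (ekeys T) (proj₂ d)) ≡ d
    globᵀ (x , f) = cong₂ _,_ (res-glob (vkeys T) (exact⇒linear (vkeys T) vexact) x) (res-glob (ekeys T) (exact⇒linear (ekeys T) eexact) f)
    to : (∃ λ q → subsetDecode {states K φ} (type (ex φ) T σ) q ≡ true × accepts {n} {m} φ q ≡ true) → ∃ λ d → Satᶜ G (d ∷ ρ) φ
    to (q , q∈ , acc) with proj₁ (∋-type-ex φ T σ q) q∈
    ... | d , refl = _ , proj₁ (accepts-type φ ((glob (vkeys T) (proj₁ d) , glob (ekeys T) (proj₂ d)) ∷ ρ))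
                           (subst (λ d → accepts {n} {m} φ (type φ T (d ∷ σ)) ≡ true) (sym (globᵀ d)) acc)
    from : (∃ λ d → Satᶜ G (d ∷ ρ) φ) → ∃ λ q → subsetDecode {states K φ} (type (ex φ) T σ) q ≡ true × accepts {n} {m} φ q ≡ true
    from (d , sat) = type φ T (resᵀ T d ∷ σ) , proj₂ (∋-type-ex φ T σ _) (resᵀ T d , refl) , proj₂ (accepts-type φ (d ∷ ρ)) sat

-- Translating formulas

nonzero : Counter
nonzero = record
  { modulus = 2 ; class = class ; plus = plus ; ok = ok
  ; class-+ = λ { zero b → refl ; (suc a) b → refl } }
  where
  class : ℕ → Fin 2
  class zero    = zero
  class (suc _) = suc zero
  plus : Fin 2 → Fin 2 → Fin 2
  plus zero    b = b
  plus (suc _) b = suc zero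
  ok : Fin 2 → Bool
  ok zero    = false
  ok (suc _) = true

single : Counter
single = record
  { modulus = 3 ; class = class ; plus = plus ; ok = ok
  ; class-+ = λ { zero b → refl ; (suc zero) zero → refl ; (suc zero) (suc zero) → refl ; (suc zero) (suc (suc b)) → refl ; (suc (suc a)) b → refl } }
  where
  class : ℕ → Fin 3
  class zero          = zero
  class (suc zero)    = suc zero
  class (suc (suc _)) = suc (suc zero)
  plus : Fin 3 → Fin 3 → Fin 3
  plus zero          b       = b
  plus (suc zero)    zero    = suc zero
  plus (suc zero)    (suc _) = suc (suc zero)
  plus (suc (suc _)) b       = suc (suc zero)
  ok : Fin 3 → Bool
  ok zero          = false
  ok (suc zero)    = true
  ok (suc (suc _)) = false

residue : (a p : ℕ) → {{NonZero p}} → Counter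
residue a p = record
  { modulus = p ; class = _mod p ; plus = λ i j → (toℕ i + toℕ j) mod p
  ; class-+ = λ x y → Fin.toℕ-injective (begin
      toℕ ((x + y) mod p)                             ≡⟨ toℕ-mod (x + y) ⟩
      (x + y) % p                                     ≡⟨ %-distribˡ-+ x y p ⟩
      (x % p + y % p) % p                             ≡⟨ cong₂ (λ u v → (u + v) % p) (toℕ-mod x) (toℕ-mod y) ⟨
      (toℕ (x mod p) + toℕ (y mod p)) % p             ≡⟨ toℕ-mod (toℕ (x mod p) + toℕ (y mod p)) ⟨
      toℕ ((toℕ (x mod p) + toℕ (y mod p)) mod p)     ∎)
  ; ok = λ i → does (toℕ i ℕ.≟ a % p) }
  where
  open ≡-Reasoning
  toℕ-mod : ∀ x → toℕ (x mod p) ≡ x % p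
  toℕ-mod x = Fin.toℕ-fromℕ< (m%n<n x p)

accepted : Counter → ℕ → Set
accepted θ c = Counter.ok θ (Counter.class θ c) ≡ true

nonzero⟷ : ∀ c → accepted nonzero c ⟷ (c ≢ 0)
nonzero⟷ zero    = (λ ()) , λ z → contradiction refl z
nonzero⟷ (suc c) = (λ _ ()) , λ _ → refl

single⟷ : ∀ c → accepted single c ⟷ (c ≡ 1)
single⟷ zero          = (λ ()) , λ ()
single⟷ (suc zero)    = (λ _ → refl) , λ _ → refl
single⟷ (suc (suc c)) = (λ ()) , λ ()

residue⟷ : ∀ a p {{_ : NonZero p}} c → accepted (residue a p) c ⟷ (c % p ≡ a % p)
residue⟷ a p c = ⟷-trans (does⟷ (toℕ (c mod p) ℕ.≟ a % p))
  ((λ eq → trans (sym e) eq) , (λ eq → trans e eq))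
  where
  e : toℕ (c mod p) ≡ c % p
  e = Fin.toℕ-fromℕ< (m%n<n c p)

∣p∣≢0⇒∃ : ∀ {n} (p : Subset n) → ∣ p ∣ ≢ 0 → ∃ λ x → x ∈ₛ p
∣p∣≢0⇒∃ []          h = contradiction refl h
∣p∣≢0⇒∃ (true ∷ p)  h = zero , here
∣p∣≢0⇒∃ (false ∷ p) h = let (x , x∈) = ∣p∣≢0⇒∃ p h in suc x , there x∈

x∈p⇒∣p∣≢0 : ∀ {n} {p : Subset n} {x} → x ∈ₛ p → ∣ p ∣ ≢ 0
x∈p⇒∣p∣≢0 {p = true ∷ p}  here       = λ ()
x∈p⇒∣p∣≢0 {p = true ∷ p}  (there x∈) = λ ()
x∈p⇒∣p∣≢0 {p = false ∷ p} (there x∈) = x∈p⇒∣p∣≢0 x∈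

∣p∣≡1⇒⁅⁆ : ∀ {n} (p : Subset n) → ∣ p ∣ ≡ 1 → ∃ λ x → p ≡ ⁅ x ⁆
∣p∣≡1⇒⁅⁆ (true ∷ p)  eq = zero , cong (true ∷_) (∣p∣≡0⇒⊥ p (suc-injective eq))
  where
  ∣p∣≡0⇒⊥ : ∀ {n} (p : Subset n) → ∣ p ∣ ≡ 0 → p ≡ ⊥
  ∣p∣≡0⇒⊥ []          _  = refl
  ∣p∣≡0⇒⊥ (false ∷ p) eq = cong (false ∷_) (∣p∣≡0⇒⊥ p eq)
∣p∣≡1⇒⁅⁆ (false ∷ p) eq = let (x , e) = ∣p∣≡1⇒⁅⁆ p eq in suc x , cong (false ∷_) e

∣⁅x⁆∩p∣≢0⟷ : ∀ {n} x (p : Subset n) → ∣ ⁅ x ⁆ ∩ p ∣ ≢ 0 ⟷ x ∈ₛ p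
∣⁅x⁆∩p∣≢0⟷ x p = to , λ x∈ → x∈p⇒∣p∣≢0 (x∈p∩q⁺ (x∈⁅x⁆ x , x∈))
  where
  to : ∣ ⁅ x ⁆ ∩ p ∣ ≢ 0 → x ∈ₛ p
  to h with ∣p∣≢0⇒∃ (⁅ x ⁆ ∩ p) h
  ... | z , z∈ with x∈p∩q⁻ ⁅ x ⁆ p z∈
  ...   | z∈x , z∈p = subst (_∈ₛ p) (x∈⁅y⁆⇒x≡y x z∈x) z∈p

-- Only the component of the right kind is constrained; the other one is arbitrary, and `Represents`
-- ignores it.
guard : ∀ {j} → Sort → Core (suc j) → Core (suc j)
guard vtx  φ = and (cnt V zero zero single) φ
guard edg  φ = and (cnt E zero zero single) φ
guard vset φ = φ
guard eset φ = φ

-- For singletons, equality and membership both say that an intersection is nonempty. The De Morgan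
-- forms of `or` and `all` are constructively faithful because satisfaction in a finite graph is
-- decidable (`Satᶜ?`).
translate : ∀ {Γ} → Formula Γ → Core (length Γ)
translate (eqV x y)    = cnt V (Any.index x) (Any.index y) nonzero
translate (eqE x y)    = cnt E (Any.index x) (Any.index y) nonzero
translate (memV x X)   = cnt V (Any.index x) (Any.index X) nonzero
translate (memE x X)   = cnt E (Any.index x) (Any.index X) nonzero
translate (inc u e)    = inc (Any.index u) (Any.index e)
translate (modV X a p) = cnt V (Any.index X) (Any.index X) (residue a p)
translate (modE X a p) = cnt E (Any.index X) (Any.index X) (residue a p)
translate (neg φ)      = neg (translate φ)
translate (and φ ψ)    = and (translate φ) (translate ψ)
translate (or φ ψ)     = neg (and (neg (translate φ)) (neg (translate ψ)))
translate (ex s φ)     = ex (guard s (translate φ))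
translate (all s φ)    = neg (ex (guard s (neg (translate φ))))

module _ {n m : ℕ} (G : Graph n m) where

  Satᶜ? : ∀ {j} (ρ : Vec (Subset n × Subset m) j) φ → Dec (Satᶜ G ρ φ)
  Satᶜ? ρ (cnt κ x y θ) = _ Bool.≟ true
  Satᶜ? ρ (inc x y)     = Fin.any? λ v → Fin.any? λ e → (_ Bool.≟ true) ×-dec (_ Bool.≟ true) ×-dec ((v ≟ _) ⊎-dec (v ≟ _))
  Satᶜ? ρ (neg φ)       = ¬? (Satᶜ? ρ φ)
  Satᶜ? ρ (and φ ψ)     = Satᶜ? ρ φ ×-dec Satᶜ? ρ ψ
  Satᶜ? ρ (ex φ)        = Dec.map′ (λ (X , F , h) → (X , F) , h) (λ ((X , F) , h) → X , F , h)
                            (anySubset? λ X → anySubset? λ F → Satᶜ? ((X , F) ∷ ρ) φ)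

  Represents : (s : Sort) → Dom G s → Subset n × Subset m → Set
  Represents vtx  v (X , F) = X ≡ ⁅ v ⁆
  Represents edg  e (X , F) = F ≡ ⁅ e ⁆
  Represents vset Y (X , F) = X ≡ Y
  Represents eset Y (X , F) = F ≡ Y

  Match : ∀ {Γ} → Env G Γ → Vec (Subset n × Subset m) (length Γ) → Set
  Match {Γ} ρ σ = ∀ {s} (x : s ∈ Γ) → Represents s (All.lookup ρ x) (Vec.lookup σ (Any.index x))

  extend : ∀ {Γ s} {ρ : Env G Γ} {σ} {d : Dom G s} {z} → Represents s d z → Match ρ σ → Match (d ∷ ρ) (z ∷ σ)
  extend r M (here refl) = r
  extend r M (there x)   = M x

  represent : ∀ s (d : Dom G s) → ∃ (Represents s d)
  represent vtx  v = (⁅ v ⁆ , ⊥) , refl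
  represent edg  e = (⊥ , ⁅ e ⁆) , refl
  represent vset X = (X , ⊥) , refl
  represent eset F = (⊥ , F) , refl

  ∣p∩p∣≡1⟷ : ∀ {n} (p : Subset n) → accepted single ∣ p ∩ p ∣ ⟷ (∃ λ x → p ≡ ⁅ x ⁆)
  ∣p∩p∣≡1⟷ p rewrite ∩-idem p = ⟷-trans (single⟷ ∣ p ∣) (∣p∣≡1⇒⁅⁆ p , λ { (x , refl) → ∣⁅x⁆∣≡1 x })

  guard⟷ : ∀ s {j} {σ : Vec (Subset n × Subset m) j} z φ →
           Satᶜ G (z ∷ σ) (guard s φ) ⟷ ((∃ λ d → Represents s d z) × Satᶜ G (z ∷ σ) φ)
  guard⟷ vtx  (X , F) φ = let (f , g) = ∣p∩p∣≡1⟷ X in (λ (a , b) → f a , b) , (λ (a , b) → g a , b)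
  guard⟷ edg  (X , F) φ = let (f , g) = ∣p∩p∣≡1⟷ F in (λ (a , b) → f a , b) , (λ (a , b) → g a , b)
  guard⟷ vset (X , F) φ = (λ h → (X , refl) , h) , proj₂
  guard⟷ eset (X , F) φ = (λ h → (F , refl) , h) , proj₂

  ∈⟷ : ∀ {k} x (p q : Subset k) → p ≡ ⁅ x ⁆ → x ∈ₛ q ⟷ accepted nonzero ∣ p ∩ q ∣
  ∈⟷ x p q refl = ⟷-sym (⟷-trans (nonzero⟷ ∣ ⁅ x ⁆ ∩ q ∣) (∣⁅x⁆∩p∣≢0⟷ x q))

  ≡⟷ : ∀ {k} x y (p q : Subset k) → p ≡ ⁅ x ⁆ → q ≡ ⁅ y ⁆ → x ≡ y ⟷ accepted nonzero ∣ p ∩ q ∣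
  ≡⟷ x y p q ep refl = ⟷-trans ((λ { refl → x∈⁅x⁆ x }) , x∈⁅y⁆⇒x≡y y) (∈⟷ x p ⁅ y ⁆ ep)

  mod⟷ : ∀ a p {{_ : NonZero p}} {k} (X Y : Subset k) → X ≡ Y → ∣ Y ∣ % p ≡ a % p ⟷ accepted (residue a p) ∣ X ∩ X ∣
  mod⟷ a p X .X refl rewrite ∩-idem X = ⟷-sym (residue⟷ a p ∣ X ∣)

  lookup-⁅⁆⟷ : ∀ {k} (x y : Fin k) → Vec.lookup ⁅ x ⁆ y ≡ true → x ≡ y
  lookup-⁅⁆⟷ x y eq = sym (x∈⁅y⁆⇒x≡y x (lookup⇒[]= y ⁅ x ⁆ eq))

  Sat⟷ : ∀ {Γ} (φ : Formula Γ) (ρ : Env G Γ) σ → Match ρ σ → Sat G ρ φ ⟷ Satᶜ G σ (translate φ)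
  Sat⟷ (eqV x y)    ρ σ M = ≡⟷ _ _ (proj₁ (Vec.lookup σ (Any.index x))) (proj₁ (Vec.lookup σ (Any.index y))) (M x) (M y)
  Sat⟷ (eqE x y)    ρ σ M = ≡⟷ _ _ (proj₂ (Vec.lookup σ (Any.index x))) (proj₂ (Vec.lookup σ (Any.index y))) (M x) (M y)
  Sat⟷ (memV x X)   ρ σ M = subst (λ Y → All.lookup ρ x ∈ₛ Y ⟷ _) (M X) (∈⟷ _ (proj₁ (Vec.lookup σ (Any.index x))) (proj₁ (Vec.lookup σ (Any.index X))) (M x))
  Sat⟷ (memE x X)   ρ σ M = subst (λ Y → All.lookup ρ x ∈ₛ Y ⟷ _) (M X) (∈⟷ _ (proj₂ (Vec.lookup σ (Any.index x))) (proj₂ (Vec.lookup σ (Any.index X))) (M x))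
  Sat⟷ (inc u e)    ρ σ M = to , from
    where
    X = proj₁ (Vec.lookup σ (Any.index u))
    F = proj₂ (Vec.lookup σ (Any.index e))
    to : Inc G (All.lookup ρ u) (All.lookup ρ e) → _
    to i = _ , _ , trans (cong (λ Y → Vec.lookup Y (All.lookup ρ u)) (M u)) (lookup-⁅⁆-same (All.lookup ρ u))
                 , trans (cong (λ Y → Vec.lookup Y (All.lookup ρ e)) (M e)) (lookup-⁅⁆-same (All.lookup ρ e)) , i
    from : (∃ λ v → ∃ λ f → Vec.lookup X v ≡ true × Vec.lookup F f ≡ true × Inc G v f) → Inc G (All.lookup ρ u) (All.lookup ρ e)
    from (v , f , X∋ , F∋ , i)
      with lookup-⁅⁆⟷ (All.lookup ρ u) v (trans (cong (λ Y → Vec.lookup Y v) (sym (M u))) X∋)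
         | lookup-⁅⁆⟷ (All.lookup ρ e) f (trans (cong (λ Y → Vec.lookup Y f) (sym (M e))) F∋)
    ... | refl | refl = i
  Sat⟷ (modV X a p) ρ σ M = mod⟷ a p _ _ (M X)
  Sat⟷ (modE X a p) ρ σ M = mod⟷ a p _ _ (M X)
  Sat⟷ (neg φ)      ρ σ M = let (f , g) = Sat⟷ φ ρ σ M in (λ h → h ∘ g) , (λ h → h ∘ f)
  Sat⟷ (and φ ψ)    ρ σ M = let (f , g) = Sat⟷ φ ρ σ M ; (f′ , g′) = Sat⟷ ψ ρ σ M in
    (λ (a , b) → f a , f′ b) , (λ (a , b) → g a , g′ b)
  Sat⟷ (or φ ψ)     ρ σ M = to , from
    where
    to : Sat G ρ φ ⊎ Sat G ρ ψ → ¬ (¬ Satᶜ G σ (translate φ) × ¬ Satᶜ G σ (translate ψ))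
    to (inj₁ a) (na , _) = na (proj₁ (Sat⟷ φ ρ σ M) a)
    to (inj₂ b) (_ , nb) = nb (proj₁ (Sat⟷ ψ ρ σ M) b)
    from : ¬ (¬ Satᶜ G σ (translate φ) × ¬ Satᶜ G σ (translate ψ)) → Sat G ρ φ ⊎ Sat G ρ ψ
    from h with Satᶜ? σ (translate φ) | Satᶜ? σ (translate ψ)
    ... | yes a | _     = inj₁ (proj₂ (Sat⟷ φ ρ σ M) a)
    ... | no  _ | yes b = inj₂ (proj₂ (Sat⟷ ψ ρ σ M) b)
    ... | no na | no nb = contradiction (na , nb) h
  Sat⟷ (ex s φ)     ρ σ M = to , from
    where
    to : (∃ λ d → Sat G (d ∷ ρ) φ) → ∃ λ z → Satᶜ G (z ∷ σ) (guard s (translate φ))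
    to (d , h) = let (z , r) = represent s d in
      z , proj₂ (guard⟷ s z _) ((d , r) , proj₁ (Sat⟷ φ (d ∷ ρ) (z ∷ σ) (extend r M)) h)
    from : (∃ λ z → Satᶜ G (z ∷ σ) (guard s (translate φ))) → ∃ λ d → Sat G (d ∷ ρ) φ
    from (z , h) = let ((d , r) , h′) = proj₁ (guard⟷ s z _) h in d , proj₂ (Sat⟷ φ (d ∷ ρ) (z ∷ σ) (extend r M)) h′
  Sat⟷ (all s φ)    ρ σ M = to , from
    where
    to : (∀ d → Sat G (d ∷ ρ) φ) → ¬ (∃ λ z → Satᶜ G (z ∷ σ) (guard s (neg (translate φ))))
    to h (z , k) = let ((d , r) , k′) = proj₁ (guard⟷ s z _) k in k′ (proj₁ (Sat⟷ φ (d ∷ ρ) (z ∷ σ) (extend r M)) (h d))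
    from : ¬ (∃ λ z → Satᶜ G (z ∷ σ) (guard s (neg (translate φ)))) → ∀ d → Sat G (d ∷ ρ) φ
    from h d with represent s d
    ... | z , r with Satᶜ? (z ∷ σ) (translate φ)
    ...   | yes k = proj₂ (Sat⟷ φ (d ∷ ρ) (z ∷ σ) (extend r M)) k
    ...   | no ¬k = contradiction (z , proj₂ (guard⟷ s z _) ((d , r) , ¬k)) h

-- From tree decompositions to terms

∑ : ∀ {n} → (Fin n → ℕ) → ℕ
∑ {zero}  f = 0
∑ {suc n} f = f zero + ∑ (f ∘ suc)

∑-cong : ∀ {n} {f g : Fin n → ℕ} → f ≗ g → ∑ f ≡ ∑ g
∑-cong {zero}  h = refl
∑-cong {suc n} h = cong₂ _+_ (h zero) (∑-cong (h ∘ suc))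

∑-+ : ∀ {n} (f g : Fin n → ℕ) → ∑ (λ i → f i + g i) ≡ ∑ f + ∑ g
∑-+ {zero}  f g = refl
∑-+ {suc n} f g = trans (cong (f zero + g zero +_) (∑-+ (f ∘ suc) (g ∘ suc))) (interchange (f zero) (g zero) _ _)
  where
  interchange : ∀ a b c d → (a + b) + (c + d) ≡ (a + c) + (b + d)
  interchange = solve-∀

∑-0 : ∀ n → ∑ {n} (λ _ → 0) ≡ 0
∑-0 zero    = refl
∑-0 (suc n) = ∑-0 n

∑-swap : ∀ {n k} (f : Fin n → Fin k → ℕ) → ∑ (λ i → ∑ (f i)) ≡ ∑ (λ j → ∑ (λ i → f i j))
∑-swap {zero}  {k} f = sym (∑-0 k)
∑-swap {suc n} {k} f = trans (cong (∑ (f zero) +_) (∑-swap (f ∘ suc))) (sym (∑-+ (f zero) (λ j → ∑ (λ i → f (suc i) j))))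

indicator : ∀ {n} → Fin n → Fin n → ℕ → ℕ
indicator i j c = if does (i ≟ j) then c else 0

∑-indicator : ∀ {n} (j : Fin n) c → ∑ (λ i → indicator j i c) ≡ c
∑-indicator {suc n} zero    c = trans (cong (c +_) (∑-0 n)) (+-identityʳ c)
∑-indicator {suc n} (suc j) c = ∑-indicator j c

∑-indicator′ : ∀ {n} (j : Fin n) (f : Fin n → ℕ) → ∑ (λ i → indicator i j (f i)) ≡ f j
∑-indicator′ {suc n} zero    f = trans (cong (f zero +_) (∑-0 n)) (+-identityʳ (f zero))
∑-indicator′ {suc n} (suc j) f = ∑-indicator′ j (f ∘ suc)

rank : ∀ {n} → Subset n → Fin n → ℕ
rank (b ∷ p) zero    = 0
rank (b ∷ p) (suc i) = bit b + rank p i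

rank< : ∀ {n} (p : Subset n) i → i ∈ₛ p → rank p i < ∣ p ∣
rank< (true ∷ p)  zero    here       = s≤s z≤n
rank< (true ∷ p)  (suc i) (there i∈) = s≤s (rank< p i i∈)
rank< (false ∷ p) (suc i) (there i∈) = rank< p i i∈

rank-injective : ∀ {n} (p : Subset n) i j → i ∈ₛ p → j ∈ₛ p → rank p i ≡ rank p j → i ≡ j
rank-injective p           zero    zero    _          _          _  = refl
rank-injective (true ∷ p)  (suc i) (suc j) (there i∈) (there j∈) eq = cong suc (rank-injective p i j i∈ j∈ (suc-injective eq))
rank-injective (false ∷ p) (suc i) (suc j) (there i∈) (there j∈) eq = cong suc (rank-injective p i j i∈ j∈ eq)
rank-injective (true ∷ p)  zero    (suc j) here       (there _)  ()
rank-injective (true ∷ p)  (suc i) zero    (there _)  here       ()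

occ≢0⇒Mem : ∀ {m} (k : Keys m) e → occ k e ≢ 0 → Mem k e
occ≢0⇒Mem none      e h = contradiction refl h
occ≢0⇒Mem (one f)   e h with f ≟ e
... | yes eq = eq
... | no  _  = contradiction refl h
occ≢0⇒Mem (two k l) e h with occ k e in eq
... | suc _ = inj₁ (occ≢0⇒Mem k e (λ z → 1+n≢0 (trans (sym eq) z)))
... | zero  = inj₂ (occ≢0⇒Mem l e h)

module _ {A : Set} where

  sweep : ∀ {k} → (Fin k → Bool) → (Fin k → A → A) → A → A
  sweep {zero}  b f a = a
  sweep {suc k} b f a = if b zero then f zero (sweep (b ∘ suc) (f ∘ suc) a) else sweep (b ∘ suc) (f ∘ suc) a

  sweep-cong : ∀ {k} (b : Fin k → Bool) {f g : Fin k → A → A} a → (∀ i → b i ≡ true → ∀ a → f i a ≡ g i a) →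
               sweep b f a ≡ sweep b g a
  sweep-cong {zero}  b a h = refl
  sweep-cong {suc k} b {g = g} a h with b zero in eq
  ... | false = sweep-cong (b ∘ suc) a (h ∘ suc)
  ... | true  = trans (h zero eq _) (cong (g zero) (sweep-cong (b ∘ suc) a (h ∘ suc)))

  sweep-measure : ∀ {k} (μ : A → ℕ) (w : Fin k → ℕ) (b : Fin k → Bool) (f : Fin k → A → A) a →
    (∀ i a → μ (f i a) ≡ w i + μ a) → μ (sweep b f a) ≡ ∑ (λ i → if b i then w i else 0) + μ a
  sweep-measure {zero}  μ w b f a h = refl
  sweep-measure {suc k} μ w b f a h with b zero
  ... | false = sweep-measure μ (w ∘ suc) (b ∘ suc) (f ∘ suc) a (h ∘ suc)
  ... | true  = trans (h zero _) (trans (cong (w zero +_) (sweep-measure μ (w ∘ suc) (b ∘ suc) (f ∘ suc) a (h ∘ suc))) (sym (+-assoc (w zero) _ _)))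

  sweep-invariant : ∀ {k} (P : A → Set) (b : Fin k → Bool) (f : Fin k → A → A) a →
    (∀ i → b i ≡ true → ∀ a → P a → P (f i a)) → P a → P (sweep b f a)
  sweep-invariant {zero}  P b f a h p = p
  sweep-invariant {suc k} P b f a h p with b zero in eq
  ... | false = sweep-invariant P (b ∘ suc) (f ∘ suc) a (h ∘ suc) p
  ... | true  = h zero eq _ (sweep-invariant P (b ∘ suc) (f ∘ suc) a (h ∘ suc) p)

  sweep-done : ∀ {k} (P : A → Set) (D : Fin k → A → Set) (b : Fin k → Bool) (f : Fin k → A → A) a →
    (∀ i → b i ≡ true → ∀ a → P a → P (f i a)) →
    (∀ i → b i ≡ true → ∀ a → P a → D i (f i a)) →
    (∀ i j → ∀ a → D i a → D i (f j a)) →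
    P a → ∀ i → b i ≡ true → D i (sweep b f a)
  sweep-done {suc k} P D b f a inv new old p i bi with b zero in eq
  sweep-done {suc k} P D b f a inv new old p zero    bi | false = contradiction (trans (sym eq) bi) λ ()
  sweep-done {suc k} P D b f a inv new old p (suc i) bi | false =
    sweep-done P (D ∘ suc) (b ∘ suc) (f ∘ suc) a (inv ∘ suc) (new ∘ suc) (λ i j → old (suc i) (suc j)) p i bi
  sweep-done {suc k} P D b f a inv new old p zero    bi | true =
    new zero eq _ (sweep-invariant P (b ∘ suc) (f ∘ suc) a (inv ∘ suc) p)
  sweep-done {suc k} P D b f a inv new old p (suc i) bi | true =
    old (suc i) zero _ (sweep-done P (D ∘ suc) (b ∘ suc) (f ∘ suc) a (inv ∘ suc) (new ∘ suc) (λ i j → old (suc i) (suc j)) p i bi)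

module Decomposed {n m k : ℕ} (G : Graph n m) (td : TreeDecomposition G k) where
  open TreeDecomposition td

  K : ℕ
  K = suc k

  Node : Set
  Node = Fin (suc t)

  -- A bag has at most K vertices, so on its members `mod` changes nothing; it only makes the
  -- function total.
  slot : Node → Fin n → Fin K
  slot x v = rank (bag x) v mod K

  slot-injective : ∀ x {u v} → u ∈ₛ bag x → v ∈ₛ bag x → slot x u ≡ slot x v → u ≡ v
  slot-injective x {u} {v} u∈ v∈ eq = rank-injective (bag x) u v u∈ v∈ (trans (sym (toℕ-slot u∈)) (trans (cong toℕ eq) (toℕ-slot v∈)))
    where
    toℕ-slot : ∀ {u} → u ∈ₛ bag x → toℕ (slot x u) ≡ rank (bag x) u
    toℕ-slot {u} u∈ = trans (Fin.toℕ-fromℕ< (m%n<n (rank (bag x) u) K)) (m<n⇒m%n≡m (<-≤-trans (rank< (bag x) u u∈) (width x)))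

  -- Moves to the parent while its bag contains v. Indices decrease on the way, and d is fuel
  -- bounding the index.
  climb : ∀ v d x → toℕ x ≤ d → v ∈ₛ bag x → ∃ λ y → v ∈ₛ bag y × TopFor parent bag v y
  climb v d       zero    _        v∈ = zero , v∈ , tt
  climb v (suc d) (suc i) (s≤s i≤) v∈ with v ∈? bag (parent i)
  ... | yes v∈′ = climb v d (parent i) (≤-trans (parent≤ i) i≤) v∈′
  ... | no  v∉  = suc i , v∈ , v∉

  topOf : ∀ v → ∃ λ y → v ∈ₛ bag y × TopFor parent bag v y
  topOf v = let (x , v∈) = vertexCovered v in climb v (toℕ x) x ≤-refl v∈

  top : Fin n → Node
  top v = proj₁ (topOf v)

  top∈ : ∀ v → v ∈ₛ bag (top v)
  top∈ v = proj₁ (proj₂ (topOf v))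

  -- If the parent bag missed v, this node would be a second top of v, against `connected`.
  below-top : ∀ v i → v ∈ₛ bag (suc i) → top v ≢ suc i → v ∈ₛ bag (parent i)
  below-top v i v∈ top≢ with v ∈? bag (parent i)
  ... | yes v∈′ = v∈′
  ... | no  v∉  = contradiction (connected v _ _ (top∈ v) v∈ (proj₂ (proj₂ (topOf v))) v∉) top≢

  home : Fin m → Node
  home e = proj₁ (edgeCovered e)

  Inc⇒home : ∀ {u e} → Inc G u e → u ∈ₛ bag (home e)
  Inc⇒home {e = e} (inj₁ refl) = proj₁ (proj₂ (edgeCovered e))
  Inc⇒home {e = e} (inj₂ refl) = proj₂ (proj₂ (edgeCovered e))

  Term′ : Set
  Term′ = Term n m K

  nowhere : Fin K → Bool
  nowhere _ = false

  keep : Fin K → Fin K → Bool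
  keep c c′ = does (c ≟ c′)

  endSlots : Node → Fin m → Fin K → Bool
  endSlots x e c = does (slot x (proj₁ (ends G e)) ≟ c) ∨ does (slot x (proj₂ (ends G e)) ≟ c)

  -- A slot follows its vertex into the parent's bag. The slot of a vertex whose top is the child
  -- has no target, so ends attached there are dropped and the slot can be reused.
  move? : ∀ i x c c′ → Dec (∃ λ w → w ∈ₛ bag (suc i) × w ∈ₛ bag x × slot (suc i) w ≡ c × slot x w ≡ c′)
  move? i x c c′ = Fin.any? λ w → (w ∈? bag (suc i)) ×-dec (w ∈? bag x) ×-dec (slot (suc i) w ≟ c) ×-dec (slot x w ≟ c′)

  addEdge : Node → Fin m → Term′ → Term′
  addEdge x e = op nowhere keep (edge e (endSlots x e))

  addChild : (Node → Term′) → Node → Fin t → Term′ → Term′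
  addChild F x i A = op nowhere (λ c c′ → does (move? i x c c′)) A (F (suc i))

  addVertex : Node → Fin n → Term′ → Term′
  addVertex x v = op (λ c → does (c ≟ slot x v)) keep (vertex v)

  edgesAt : Node → Term′
  edgesAt x = sweep (λ e → does (home e ≟ x)) (addEdge x) empty

  childrenAt : (Node → Term′) → Node → Term′
  childrenAt F x = sweep (λ i → does (parent i ≟ x)) (addChild F x) (edgesAt x)

  -- A vertex is attached at its top and after the edges and children: the home of an incident edge
  -- contains the vertex and so lies at or below that top, hence all its edges are already present.
  step : (Node → Term′) → Node → Term′
  step F x = sweep (λ v → does (top v ≟ x)) (addVertex x) (childrenAt F x)

  -- With parent pointers the recursion into children is not structural, so d is fuel. Children have
  -- larger indices, which makes the iteration stationary once d + x exceeds t.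
  approx : ℕ → Node → Term′
  approx zero    x = empty
  approx (suc d) x = step (approx d) x

  approx-stable : ∀ d x → suc t ≤ d + toℕ x → approx d x ≡ approx (suc d) x
  approx-stable zero    x h = contradiction (Fin.toℕ<n x) (≤⇒≯ h)
  approx-stable (suc d) x h = cong (sweep (λ v → does (top v ≟ x)) (addVertex x))
    (sweep-cong (λ i → does (parent i ≟ x)) (edgesAt x) λ i eq a →
      cong (op nowhere _ a) (approx-stable d (suc i) (deeper i (proj₁ (does⟷ (parent i ≟ x)) eq))))
    where
    deeper : ∀ i → parent i ≡ x → suc t ≤ d + suc (toℕ i)
    deeper i refl = ≤-trans h (≤-trans (s≤s (+-monoʳ-≤ d (parent≤ i))) (≤-reflexive (sym (+-suc d (toℕ i)))))

  build : Node → Term′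
  build = approx (suc t)

  build-step : ∀ x → build x ≡ step build x
  build-step x = approx-stable (suc t) x (m≤m+n (suc t) (toℕ x))

  -- Summing over all nodes counts each non-root node once more through its parent,
  -- so only the root's share remains.
  root-count : (c base : Node → ℕ) → (∀ x → c x ≡ base x + ∑ (λ i → indicator (parent i) x (c (suc i)))) → c zero ≡ ∑ base
  root-count c base h = +-cancelʳ-≡ (∑ (c ∘ suc)) (c zero) (∑ base) (begin
    c zero + ∑ (c ∘ suc)                                                    ≡⟨ ∑-cong h ⟩
    ∑ (λ x → base x + ∑ (λ i → indicator (parent i) x (c (suc i))))         ≡⟨ ∑-+ base (λ x → ∑ (λ i → indicator (parent i) x (c (suc i)))) ⟩
    ∑ base + ∑ (λ x → ∑ (λ i → indicator (parent i) x (c (suc i))))         ≡⟨ cong (∑ base +_) (∑-swap (λ x i → indicator (parent i) x (c (suc i)))) ⟩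
    ∑ base + ∑ (λ i → ∑ (λ x → indicator (parent i) x (c (suc i))))         ≡⟨ cong (∑ base +_) (∑-cong (λ i → ∑-indicator (parent i) (c (suc i)))) ⟩
    ∑ base + ∑ (c ∘ suc)                                                    ∎)
    where open ≡-Reasoning

  bit≡indicator : ∀ {j} (a b : Fin j) (x y : Node) →
    (if does (x ≟ y) then occ (one a) b else 0) ≡ indicator a b (indicator x y 1)
  bit≡indicator a b x y with does (x ≟ y) | does (a ≟ b)
  ... | true  | true  = refl
  ... | true  | false = refl
  ... | false | true  = refl
  ... | false | false = refl

  vexact : Exact (vkeys (build zero))
  vexact v = trans (root-count (λ x → occ (vkeys (build x)) v) (λ x → indicator (top v) x 1) eq) (∑-indicator (top v) 1)
    where
    μ : Term′ → ℕ
    μ A = occ (vkeys A) v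
    open ≡-Reasoning
    eq : ∀ x → μ (build x) ≡ indicator (top v) x 1 + ∑ (λ i → indicator (parent i) x (μ (build (suc i))))
    eq x = begin
      μ (build x)
        ≡⟨ cong μ (build-step x) ⟩
      μ (step build x)
        ≡⟨ sweep-measure μ (λ u → occ (one u) v) _ (addVertex x) _ (λ _ _ → refl) ⟩
      ∑ (λ u → if does (top u ≟ x) then occ (one u) v else 0) + μ (childrenAt build x)
        ≡⟨ cong₂ _+_ (trans (∑-cong λ u → bit≡indicator u v (top u) x) (∑-indicator′ v (λ u → indicator (top u) x 1)))
                     (sweep-measure μ (λ i → μ (build (suc i))) _ (addChild build x) _ (λ i A → +-comm (μ A) _)) ⟩
      indicator (top v) x 1 + (∑ (λ i → indicator (parent i) x (μ (build (suc i)))) + μ (edgesAt x))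
        ≡⟨ cong (λ z → indicator (top v) x 1 + (∑ (λ i → indicator (parent i) x (μ (build (suc i)))) + z)) noEdges ⟩
      indicator (top v) x 1 + (∑ (λ i → indicator (parent i) x (μ (build (suc i)))) + 0)
        ≡⟨ cong (indicator (top v) x 1 +_) (+-identityʳ _) ⟩
      indicator (top v) x 1 + ∑ (λ i → indicator (parent i) x (μ (build (suc i)))) ∎
      where
      noEdges : μ (edgesAt x) ≡ 0
      noEdges = trans (sweep-measure μ (λ _ → 0) _ (addEdge x) empty (λ _ _ → refl))
                      (trans (+-identityʳ _) (trans (∑-cong (λ e → if-0 (does (home e ≟ x)))) (∑-0 m)))
        where
        if-0 : ∀ b → (if b then 0 else 0) ≡ 0
        if-0 false = refl
        if-0 true  = refl

  eexact : Exact (ekeys (build zero))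
  eexact e = trans (root-count (λ x → occ (ekeys (build x)) e) (λ x → indicator (home e) x 1) eq) (∑-indicator (home e) 1)
    where
    μ : Term′ → ℕ
    μ A = occ (ekeys A) e
    open ≡-Reasoning
    eq : ∀ x → μ (build x) ≡ indicator (home e) x 1 + ∑ (λ i → indicator (parent i) x (μ (build (suc i))))
    eq x = begin
      μ (build x)
        ≡⟨ cong μ (build-step x) ⟩
      μ (step build x)
        ≡⟨ sweep-invariant (λ A → μ A ≡ μ (childrenAt build x)) _ (addVertex x) _ (λ _ _ _ h → h) refl ⟩
      μ (childrenAt build x)
        ≡⟨ sweep-measure μ (λ i → μ (build (suc i))) _ (addChild build x) _ (λ i A → +-comm (μ A) _) ⟩
      ∑ (λ i → indicator (parent i) x (μ (build (suc i)))) + μ (edgesAt x)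
        ≡⟨ cong (∑ (λ i → indicator (parent i) x (μ (build (suc i)))) +_)
             (trans (sweep-measure μ (λ f → occ (one f) e) _ (addEdge x) empty (λ _ _ → refl))
               (trans (+-identityʳ _) (trans (∑-cong λ f → bit≡indicator f e (home f) x) (∑-indicator′ e (λ f → indicator (home f) x 1))))) ⟩
      ∑ (λ i → indicator (parent i) x (μ (build (suc i)))) + indicator (home e) x 1
        ≡⟨ +-comm _ (indicator (home e) x 1) ⟩
      indicator (home e) x 1 + ∑ (λ i → indicator (parent i) x (μ (build (suc i)))) ∎

  -- The alternatives in `complete` may overlap: `keep` leaves an edge in its slot after that end
  -- has been attached.
  record Partial (x : Node) (A : Term′) : Set where
    field
      inc-sound  : ∀ {v e} → Incᵀ A v e → Inc G v e
      pend-sound : ∀ {e c} → Pend A e c → ∃ λ u → Inc G u e × u ∈ₛ bag x × slot x u ≡ c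
      complete   : ∀ {u e} → Mem (ekeys A) e → Inc G u e → (u ∈ₛ bag x × Pend A e (slot x u)) ⊎ Incᵀ A u e
  open Partial

  Finished : Node → Term′ → Set
  Finished x A = Partial x A × (∀ {u e} → top u ≡ x → Mem (ekeys A) e → Inc G u e → Incᵀ A u e)

  keep⁺ : ∀ c → keep c c ≡ true
  keep⁺ c = proj₂ (does⟷ (c ≟ c)) refl

  keep⁻ : ∀ {c c′} → keep c c′ ≡ true → c ≡ c′
  keep⁻ {c} {c′} = proj₁ (does⟷ (c ≟ c′))

  empty-partial : ∀ x → Partial x empty
  empty-partial x = record { inc-sound = λ () ; pend-sound = λ () ; complete = λ () }

  addEdge-partial : ∀ x e A → home e ≡ x → Partial x A → Partial x (addEdge x e A)
  addEdge-partial x e A refl P = record { inc-sound = inc′ ; pend-sound = pend′ ; complete = complete′ }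
    where
    a b : Fin K → Bool
    a c = does (slot x (proj₁ (ends G e)) ≟ c)
    b c = does (slot x (proj₂ (ends G e)) ≟ c)
    inc′ : ∀ {v f} → Incᵀ (addEdge x e A) v f → Inc G v f
    inc′ (inj₁ (inj₂ i)) = inc-sound P i
    pend′ : ∀ {f c} → Pend (addEdge x e A) f c → ∃ λ u → Inc G u f × u ∈ₛ bag x × slot x u ≡ c
    pend′ {c = c} (inj₁ (refl , pc)) with proj₁ (∨⟷ (a c) (b c)) pc
    ... | inj₁ eq = _ , inj₁ refl , Inc⇒home (inj₁ refl) , proj₁ (does⟷ (slot x (proj₁ (ends G e)) ≟ c)) eq
    ... | inj₂ eq = _ , inj₂ refl , Inc⇒home (inj₂ refl) , proj₁ (does⟷ (slot x (proj₂ (ends G e)) ≟ c)) eq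
    pend′ (inj₂ (c′ , p , eq)) = let (u , i , u∈ , s) = pend-sound P p in u , i , u∈ , trans s (keep⁻ eq)
    complete′ : ∀ {u f} → Mem (ekeys (addEdge x e A)) f → Inc G u f → (u ∈ₛ bag x × Pend (addEdge x e A) f (slot x u)) ⊎ Incᵀ (addEdge x e A) u f
    complete′ {u} (inj₁ refl) i = inj₁ (Inc⇒home i , inj₁ (refl , proj₂ (∨⟷ (a (slot x u)) (b (slot x u))) (end i)))
      where
      end : Inc G u e → a (slot x u) ≡ true ⊎ b (slot x u) ≡ true
      end (inj₁ refl) = inj₁ (keep⁺ (slot x u))
      end (inj₂ refl) = inj₂ (keep⁺ (slot x u))
    complete′ {u} (inj₂ f∈) i with complete P f∈ i
    ... | inj₁ (u∈ , p) = inj₁ (u∈ , inj₂ (_ , p , keep⁺ (slot x u)))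
    ... | inj₂ j        = inj₂ (inj₁ (inj₂ j))

  -- An end not yet attached in the child belongs to a vertex whose top is not the child, by
  -- `Finished`; `below-top` puts that vertex into the parent's bag and its slot is renamed.
  -- Injectivity of slots makes the renaming sound.
  addChild-partial : ∀ F x i A → parent i ≡ x → Finished (suc i) (F (suc i)) → Partial x A → Partial x (addChild F x i A)
  addChild-partial F x i A refl (Q , done) P = record { inc-sound = inc′ ; pend-sound = pend′ ; complete = complete′ }
    where
    C = F (suc i)
    AC = addChild F x i A
    inc′ : ∀ {v f} → Incᵀ AC v f → Inc G v f
    inc′ (inj₁ (inj₁ j)) = inc-sound P j
    inc′ (inj₁ (inj₂ j)) = inc-sound Q j
    inc′ (inj₂ (_ , _ , _ , ()))
    pend′ : ∀ {f c} → Pend AC f c → ∃ λ u → Inc G u f × u ∈ₛ bag x × slot x u ≡ c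
    pend′ (inj₁ p) = pend-sound P p
    pend′ {c = c} (inj₂ (c′ , p , eq)) with pend-sound Q p | proj₁ (does⟷ (move? i x c′ c)) eq
    ... | u , j , u∈ , s | w , w∈′ , w∈ , s′ , s″ with slot-injective (suc i) u∈ w∈′ (trans s (sym s′))
    ...   | refl = u , j , w∈ , s″
    complete′ : ∀ {u f} → Mem (ekeys AC) f → Inc G u f → (u ∈ₛ bag x × Pend AC f (slot x u)) ⊎ Incᵀ AC u f
    complete′ (inj₁ f∈) j with complete P f∈ j
    ... | inj₁ (u∈ , p) = inj₁ (u∈ , inj₁ p)
    ... | inj₂ i′       = inj₂ (inj₁ (inj₁ i′))
    complete′ {u} (inj₂ f∈) j with complete Q f∈ j | top u ≟ suc i
    ... | inj₂ i′       | _       = inj₂ (inj₁ (inj₂ i′))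
    ... | inj₁ _        | yes top≡ = inj₂ (inj₁ (inj₂ (done top≡ f∈ j)))
    ... | inj₁ (u∈ , p) | no top≢ = inj₁ (u∈′ , inj₂ (_ , p , proj₂ (does⟷ (move? i x _ _)) (u , u∈ , u∈′ , refl , refl)))
      where u∈′ = below-top u i u∈ top≢

  addVertex-partial : ∀ x v A → top v ≡ x → Partial x A → Partial x (addVertex x v A)
  addVertex-partial x v A refl P = record { inc-sound = inc′ ; pend-sound = pend′ ; complete = complete′ }
    where
    A′ = addVertex x v A
    inc′ : ∀ {u f} → Incᵀ A′ u f → Inc G u f
    inc′ (inj₁ (inj₂ i)) = inc-sound P i
    inc′ (inj₂ (refl , c , p , eq)) with pend-sound P p
    ... | w , i , w∈ , s with slot-injective x w∈ (top∈ v) (trans s (keep⁻ eq))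
    ...   | refl = i
    pend′ : ∀ {f c} → Pend A′ f c → ∃ λ u → Inc G u f × u ∈ₛ bag x × slot x u ≡ c
    pend′ (inj₂ (c′ , p , eq)) = let (u , i , u∈ , s) = pend-sound P p in u , i , u∈ , trans s (keep⁻ eq)
    complete′ : ∀ {u f} → Mem (ekeys A′) f → Inc G u f → (u ∈ₛ bag x × Pend A′ f (slot x u)) ⊎ Incᵀ A′ u f
    complete′ {u} (inj₂ f∈) i with complete P f∈ i
    ... | inj₁ (u∈ , p) = inj₁ (u∈ , inj₂ (_ , p , keep⁺ (slot x u)))
    ... | inj₂ j        = inj₂ (inj₁ (inj₂ j))

  step-finished : ∀ F x → (∀ i → Finished (suc i) (F (suc i))) → Finished x (step F x)
  step-finished F x fin = sweep-invariant (Partial x) _ (addVertex x) _ inv base ,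
      λ {u} {e} top≡ e∈ i → sweep-done (Partial x) (λ u A → ∀ e → Mem (ekeys A) e → Inc G u e → Incᵀ A u e)
        (λ v → does (top v ≟ x)) (addVertex x) (childrenAt F x) inv new old base u (proj₂ (does⟷ (top u ≟ x)) top≡) e e∈ i
    where
    base : Partial x (childrenAt F x)
    base = sweep-invariant (Partial x) _ (addChild F x) _ (λ i eq A → addChild-partial F x i A (proj₁ (does⟷ (parent i ≟ x)) eq) (fin i))
          (sweep-invariant (Partial x) _ (addEdge x) _ (λ e eq A → addEdge-partial x e A (proj₁ (does⟷ (home e ≟ x)) eq)) (empty-partial x))
    inv : ∀ v → does (top v ≟ x) ≡ true → ∀ A → Partial x A → Partial x (addVertex x v A)
    inv v eq A = addVertex-partial x v A (proj₁ (does⟷ (top v ≟ x)) eq)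
    new : ∀ v → does (top v ≟ x) ≡ true → ∀ A → Partial x A →
          ∀ e → Mem (ekeys (addVertex x v A)) e → Inc G v e → Incᵀ (addVertex x v A) v e
    new v eq A P e (inj₂ e∈) i with complete P e∈ i
    ... | inj₁ (_ , p) = inj₂ (refl , _ , p , keep⁺ (slot x v))
    ... | inj₂ j       = inj₁ (inj₂ j)
    old : ∀ u v A → (∀ e → Mem (ekeys A) e → Inc G u e → Incᵀ A u e) →
          ∀ e → Mem (ekeys (addVertex x v A)) e → Inc G u e → Incᵀ (addVertex x v A) u e
    old u v A h e (inj₂ e∈) i = inj₁ (inj₂ (h e e∈ i))

  approx-finished : ∀ d x → Finished x (approx d x)
  approx-finished zero    x = empty-partial x , λ _ ()
  approx-finished (suc d) x = step-finished (approx d) x (λ i → approx-finished d (suc i))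

  build-builds : Builds (build zero) G
  build-builds = record { vexact = vexact ; eexact = eexact ; inc⟷ = λ v e → inc-sound P , from v e }
    where
    P = proj₁ (approx-finished (suc t) zero)
    done = proj₂ (approx-finished (suc t) zero)
    from : ∀ v e → Inc G v e → Incᵀ (build zero) v e
    from v e i with complete P (occ≢0⇒Mem (ekeys (build zero)) e (λ z → 1+n≢0 (trans (sym (eexact e)) z))) i
    ... | inj₂ j = j
    -- The root counts as a top for every vertex of its bag (`tt`), so by uniqueness such a vertex
    -- was attached here.
    ... | inj₁ (v∈ , p) = done (connected v _ _ (top∈ v) v∈ (proj₂ (proj₂ (topOf v))) tt)
            (occ≢0⇒Mem (ekeys (build zero)) e (λ z → 1+n≢0 (trans (sym (eexact e)) z))) i

-- Assembling the scheme

∑-one : ∀ {m} (f : Fin m) → ∑ (λ e → occ (one f) e) ≡ 1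
∑-one {suc m} zero    = cong suc (∑-0 m)
∑-one {suc m} (suc f) = ∑-one f

size≡∑ : ∀ {A m} (t : Tree A m) → size t ≡ ∑ (occᵀ t)
size≡∑ (leaf f g)   = sym (∑-one f)
size≡∑ (node f l r) = trans (cong₂ _+_ (size≡∑ l) (size≡∑ r)) (sym (∑-+ (occᵀ l) (occᵀ r)))

∑-1 : ∀ m → ∑ {m} (λ _ → 1) ≡ m
∑-1 zero    = refl
∑-1 (suc m) = cong suc (∑-1 m)

-- A term without edges has a constant type; otherwise its type is computed by a tree over its edges.
module Flatten {n m K : ℕ} (φ : Core 1) where

  A : Set
  A = Fin (states K φ)

  join : (A → A → A) → A ⊎ Tree A m → A ⊎ Tree A m → A ⊎ Tree A m
  join f (inj₁ a)          (inj₁ b)          = inj₁ (f a b)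
  join f (inj₁ a)          (inj₂ (leaf e g)) = inj₂ (leaf e (f a ∘ g))
  join f (inj₁ a)          (inj₂ (node g l r)) = inj₂ (node (λ x y → f a (g x y)) l r)
  join f (inj₂ (leaf e g)) (inj₁ b)          = inj₂ (leaf e (λ x → f (g x) b))
  join f (inj₂ (node g l r)) (inj₁ b)        = inj₂ (node (λ x y → f (g x y) b) l r)
  join f (inj₂ s)          (inj₂ t)          = inj₂ (node f s t)

  run⊎ : A ⊎ Tree A m → Subset m → A
  run⊎ (inj₁ a) S = a
  run⊎ (inj₂ t) S = run t S

  occ⊎ : A ⊎ Tree A m → Fin m → ℕ
  occ⊎ (inj₁ a) e = 0
  occ⊎ (inj₂ t) e = occᵀ t e

  run-join : ∀ f s t S → run⊎ (join f s t) S ≡ f (run⊎ s S) (run⊎ t S)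
  run-join f (inj₁ a)              (inj₁ b)              S = refl
  run-join f (inj₁ a)              (inj₂ (leaf e g))     S = refl
  run-join f (inj₁ a)              (inj₂ (node g l r))   S = refl
  run-join f (inj₂ (leaf e g))     (inj₁ b)              S = refl
  run-join f (inj₂ (node g l r))   (inj₁ b)              S = refl
  run-join f (inj₂ (leaf e g))     (inj₂ t)              S = refl
  run-join f (inj₂ (node g l r))   (inj₂ t)              S = refl

  occ-join : ∀ f s t e → occ⊎ (join f s t) e ≡ occ⊎ s e + occ⊎ t e
  occ-join f (inj₁ a)              (inj₁ b)              e = refl
  occ-join f (inj₁ a)              (inj₂ (leaf e′ g))    e = refl
  occ-join f (inj₁ a)              (inj₂ (node g l r))   e = refl
  occ-join f (inj₂ (leaf e′ g))    (inj₁ b)              e = sym (+-identityʳ _)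
  occ-join f (inj₂ (node g l r))   (inj₁ b)              e = sym (+-identityʳ _)
  occ-join f (inj₂ (leaf e′ g))    (inj₂ t)              e = refl
  occ-join f (inj₂ (node g l r))   (inj₂ t)              e = refl

  typeOf : (T : Term n m K) → Subset m → A
  typeOf T S = type φ T (resᵀ T (⊥ , S) ∷ [])

  flatten : Term n m K → A ⊎ Tree A m
  flatten empty        = inj₁ (typeOf empty ⊥)
  flatten (vertex v)   = inj₁ (typeOf (vertex v) ⊥)
  flatten (edge e p)   = inj₂ (leaf e (λ b → type {n} φ (edge e p) ((tt , b) ∷ [])))
  flatten (op h r S T) = join (glue {n} {m} φ h r) (flatten S) (flatten T)

  run-flatten : ∀ T S → run⊎ (flatten T) S ≡ typeOf T S
  run-flatten empty        X = refl
  run-flatten (vertex v)   X = refl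
  run-flatten (edge e p)   X = refl
  run-flatten (op h r S T) X = trans (run-join (glue {n} {m} φ h r) (flatten S) (flatten T) X)
    (trans (cong₂ (glue {n} {m} φ h r) (run-flatten S X) (run-flatten T X))
           (sym (type-op φ (resᵀ (op h r S T) (⊥ , X) ∷ []))))

  occ-flatten : ∀ T e → occ⊎ (flatten T) e ≡ occ (ekeys T) e
  occ-flatten empty        f = refl
  occ-flatten (vertex v)   f = refl
  occ-flatten (edge e p)   f = refl
  occ-flatten (op h r S T) f = trans (occ-join (glue {n} {m} φ h r) (flatten S) (flatten T) f) (cong₂ _+_ (occ-flatten S f) (occ-flatten T f))

⌈log₂[1+2^k]⌉>k : ∀ k → k < ⌈log₂ suc (2 ^ k) ⌉
⌈log₂[1+2^k]⌉>k zero    = ≤-reflexive (sym (⌈log₂2^n⌉≡n 1))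
⌈log₂[1+2^k]⌉>k (suc k) = >∸1⇒> (≤-trans (⌈log₂[1+2^k]⌉>k k) (≤-reflexive (trans (cong ⌈log₂_⌉ (sym half)) (⌈log₂⌈n/2⌉⌉≡⌈log₂n⌉∸1 (suc (2 ^ suc k))))))
  where
  half : ℕ.⌈ suc (2 ^ suc k) /2⌉ ≡ suc (2 ^ k)
  half = cong suc (trans (cong (λ z → ℕ.⌊ 2 ^ k + z /2⌋) (+-identityʳ (2 ^ k))) (sym (n≡⌊n+n/2⌋ (2 ^ k))))
  >∸1⇒> : ∀ {y} → k < y ∸ 1 → suc k < y
  >∸1⇒> {suc y} h = s≤s h

n≤2^⌈log₂n⌉ : ∀ n → n ≤ 2 ^ ⌈log₂ n ⌉
n≤2^⌈log₂n⌉ n = ≮⇒≥ λ 2^k<n → <-irrefl refl (<-≤-trans (⌈log₂[1+2^k]⌉>k ⌈log₂ n ⌉) (⌈log₂⌉-mono-≤ 2^k<n))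

n≤2^n : ∀ n → n ≤ 2 ^ n
n≤2^n zero    = z≤n
n≤2^n (suc n) = ≤-trans (+-mono-≤ (m^n>0 2 n) (n≤2^n n)) (≤-reflexive (cong (2 ^ n +_) (sym (+-identityʳ (2 ^ n)))))

-- Simplicity of the graph enters here: it makes log m of order log n.
edges≤ : ∀ {n m} → Graph n m → m ≤ n * n
edges≤ {n} G = Fin.injective⇒≤ {f = λ e → combine (proj₁ (ends G e)) (proj₂ (ends G e))} λ {e} {e′} eq →
  noParallel G e e′ (inj₁ (Fin.combine-injective _ _ _ _ eq))

-- Makes the logarithm of n at least 1, so that additive constants can be absorbed into multiples of
-- it.
2≤vertices : ∀ {n m} → Graph n (suc m) → 2 ≤ n
2≤vertices {zero}        G = case proj₁ (ends G zero) of λ ()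
2≤vertices {suc zero}    G = contradiction (Fin.toℕ-injective {i = proj₁ (ends G zero)} (trans (n<1⇒n≡0 (Fin.toℕ<n _)) (sym (n<1⇒n≡0 (Fin.toℕ<n _))))) (loopless G zero)
2≤vertices {suc (suc n)} G = s≤s (s≤s z≤n)

module Parameters (n m N : ℕ) (2≤n : 2 ≤ n) (m≤n² : m ≤ n * n) where

  -- 2 ^ h bounds the number of edges and L is the depth of `decide`. The bits a per level cover the
  -- share 2L, the 2 ^ L nodes and the N⁴ m bad primes of a node, using L ≤ 2 ^ L and N ≤ 2 ^ N. R
  -- has to dominate both the L a seed bits and `exponent`.
  Λ h L a R : ℕ
  Λ = ⌈log₂ n ⌉
  h = 2 * Λ
  L = suc (4 * h)
  a = 1 + 2 * L + 4 * N + h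
  R = 72 * N * Λ + 496 * (Λ ^ 2 + 1)

  1≤Λ : 1 ≤ Λ
  1≤Λ = ≤-trans (≤-reflexive (sym (⌈log₂2^n⌉≡n 1))) (⌈log₂⌉-mono-≤ 2≤n)

  m≤2^h : m ≤ 2 ^ h
  m≤2^h = begin
    m                  ≤⟨ m≤n² ⟩
    n * n              ≤⟨ *-mono-≤ (n≤2^⌈log₂n⌉ n) (n≤2^⌈log₂n⌉ n) ⟩
    2 ^ Λ * 2 ^ Λ      ≡⟨ ^-distribˡ-+-* 2 Λ Λ ⟨
    2 ^ (Λ + Λ)        ≡⟨ cong (λ z → 2 ^ (Λ + z)) (+-identityʳ Λ) ⟨
    2 ^ h              ∎
    where open ≤-Reasoning

  badPrimes≤ : badPrimes N m ≤ 2 ^ (4 * N + h)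
  badPrimes≤ = begin
    N * N * (N * N) * m                              ≤⟨ *-mono-≤ (*-mono-≤ NN NN) m≤2^h ⟩
    2 ^ (N + N) * 2 ^ (N + N) * 2 ^ h                ≡⟨ cong (_* 2 ^ h) (^-distribˡ-+-* 2 (N + N) (N + N)) ⟨
    2 ^ (N + N + (N + N)) * 2 ^ h                    ≡⟨ ^-distribˡ-+-* 2 (N + N + (N + N)) h ⟨
    2 ^ (N + N + (N + N) + h)                        ≡⟨ cong (λ z → 2 ^ (z + h)) (four N) ⟩
    2 ^ (4 * N + h)                                  ∎
    where
    open ≤-Reasoning
    NN : N * N ≤ 2 ^ (N + N)
    NN = ≤-trans (*-mono-≤ (n≤2^n N) (n≤2^n N)) (≤-reflexive (sym (^-distribˡ-+-* 2 N N)))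
    four : ∀ N → N + N + (N + N) ≡ 4 * N
    four = solve-∀

  enough : 2 * L * (2 ^ L * badPrimes N m) ≤ 2 ^ a
  enough = begin
    2 * L * (2 ^ L * badPrimes N m)                   ≤⟨ *-mono-≤ (*-monoʳ-≤ 2 (n≤2^n L)) (*-monoʳ-≤ (2 ^ L) badPrimes≤) ⟩
    2 ^ (1 + L) * (2 ^ L * 2 ^ (4 * N + h))    ≡⟨ cong (2 ^ (1 + L) *_) (^-distribˡ-+-* 2 L (4 * N + h)) ⟨
    2 ^ (1 + L) * 2 ^ (L + (4 * N + h))        ≡⟨ ^-distribˡ-+-* 2 (1 + L) (L + (4 * N + h)) ⟨
    2 ^ (1 + L + (L + (4 * N + h)))            ≡⟨ cong (2 ^_) (regroup L N h) ⟩
    2 ^ a                                      ∎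
    where
    open ≤-Reasoning
    regroup : ∀ L N h → 1 + L + (L + (4 * N + h)) ≡ 1 + 2 * L + 4 * N + h
    regroup = solve-∀

  -- Logarithm of the weight bound: 1 for the initial factor 2, and per level 1 + h for `suc m` and
  -- 10 + 2a for the size of a prime.
  exponent : ℕ
  exponent = 1 + (1 + h + (10 + 2 * a)) * L

  exponent≤ : exponent ≤ R
  exponent≤ = begin
    exponent                                                      ≡⟨ expand Λ N ⟩
    -- Since Λ ≥ 1 the lower terms are absorbed: 496 = 304 + 174 + 18 and 72 = 64 + 8.
    304 * (Λ * Λ) + 174 * Λ + 18 + (64 * N * Λ + 8 * N)           ≤⟨ +-mono-≤ quadratic linear ⟩
    496 * (Λ ^ 2 + 1) + 72 * N * Λ                                ≡⟨ +-comm (496 * (Λ ^ 2 + 1)) _ ⟩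
    R                                                             ∎
    where
    open ≤-Reasoning
    expand : ∀ l N → 1 + (1 + 2 * l + (10 + 2 * (1 + 2 * suc (4 * (2 * l)) + 4 * N + 2 * l))) * suc (4 * (2 * l))
                     ≡ 304 * (l * l) + 174 * l + 18 + (64 * N * l + 8 * N)
    expand = solve-∀
    Λ≤Λ² : Λ ≤ Λ * Λ
    Λ≤Λ² = m≤m*n Λ Λ {{>-nonZero 1≤Λ}}
    collect : ∀ l → 304 * (l * l) + 174 * (l * l) + 18 + (18 * (l * l) + 478) ≡ 496 * (l * (l * 1) + 1)
    collect = solve-∀
    quadratic : 304 * (Λ * Λ) + 174 * Λ + 18 ≤ 496 * (Λ ^ 2 + 1)
    quadratic = ≤-trans (+-monoˡ-≤ 18 (+-monoʳ-≤ (304 * (Λ * Λ)) (*-monoʳ-≤ 174 Λ≤Λ²)))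
               (≤-trans (m≤m+n _ (18 * (Λ * Λ) + 478)) (≤-reflexive (collect Λ)))
    linear : 64 * N * Λ + 8 * N ≤ 72 * N * Λ
    linear = ≤-trans (+-monoʳ-≤ (64 * N * Λ) (m≤m*n (8 * N) Λ {{>-nonZero 1≤Λ}})) (≤-reflexive (sum N Λ))
      where
      sum : ∀ N l → 64 * N * l + 8 * N * l ≡ 72 * N * l
      sum = solve-∀

  bits≤ : L * a ≤ R
  bits≤ = ≤-trans (≤-reflexive (*-comm L a)) (≤-trans (*-monoˡ-≤ L a≤) (≤-trans (n≤1+n _) exponent≤))
    where
    a≤ : a ≤ 1 + h + (10 + 2 * a)
    a≤ = ≤-trans (m≤m+n a (a + 0)) (≤-trans (m≤n+m (2 * a) 10) (m≤n+m (10 + 2 * a) (1 + h)))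

  weight-bound : 2 * (suc m * 2 ^ (10 + 2 * a)) ^ L ≤ 2 ^ R
  weight-bound = begin
    2 * (suc m * 2 ^ b) ^ L                  ≤⟨ *-monoʳ-≤ 2 (^-monoˡ-≤ L (*-monoˡ-≤ (2 ^ b) 1+m≤)) ⟩
    2 * (2 ^ (1 + h) * 2 ^ b) ^ L            ≡⟨ cong (λ z → 2 * z ^ L) (^-distribˡ-+-* 2 (1 + h) b) ⟨
    2 * (2 ^ (1 + h + b)) ^ L                ≡⟨ cong (2 *_) (^-*-assoc 2 (1 + h + b) L) ⟩
    2 ^ exponent                             ≤⟨ ^-monoʳ-≤ 2 exponent≤ ⟩
    2 ^ R                                    ∎
    where
    open ≤-Reasoning
    b = 10 + 2 * a
    1+m≤ : suc m ≤ 2 ^ (1 + h)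
    1+m≤ = ≤-trans (+-mono-≤ (m^n>0 2 h) m≤2^h) (≤-reflexive (cong (2 ^ h +_) (sym (+-identityʳ (2 ^ h)))))

module Main (P : EdgeSelectionProblem) (φ : Formula (eset ∷ []))
            (P⟷φ : ∀ {n m} (G : Graph n m) (S : Subset m) → P G S ⟷ Sat G (S ∷ []) φ) where

  φᶜ : Core 1
  φᶜ = translate φ

  n₀ : ℕ → ℕ
  n₀ k = states (suc k) φᶜ

  N : ℕ → ℕ
  N k = 2 + n₀ k ^ n₀ k

  -- For the degenerate sizes: without edges there is one selection only, and for the other sizes no
  -- graph exists.
  trivial : ∀ {k n m R} → (∀ (G : Graph n m) → Isolates (λ _ → 0) (P G)) → IsolationScheme P k n m R
  trivial h = 1 , (λ _ _ → 0) , ≤-refl , ≤-trans (≤-reflexive (⌈log₂2^n⌉≡n 0)) z≤n , (λ _ _ → z≤n) ,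
              λ G _ → true ∷ [] , s≤s z≤n , λ _ _ → h G

  module _ {k n m : ℕ} (G : Graph n (suc m)) (td : TreeDecomposition G k) (h : ℕ) (m≤2^h : suc m ≤ 2 ^ h) where

    open Decomposed G td using (build; build-builds)
    open Flatten {n} {suc m} {suc k} φᶜ

    term : Term n (suc m) (suc k)
    term = build zero

    tree : Σ (Tree (Fin (n₀ k)) (suc m)) λ t → (∀ e → occᵀ t e ≡ 1) × (∀ S → run t S ≡ typeOf term S)
    tree with flatten term | run-flatten term | occ-flatten term
    -- The graph has the edge `zero`, so its term cannot be constant.
    ... | inj₁ _ | _  | os = contradiction (trans (os zero) (Builds.eexact build-builds zero)) λ ()
    ... | inj₂ t | rs | os = t , (λ e → trans (os e) (Builds.eexact build-builds e)) , rs

    t : Tree (Fin (n₀ k)) (suc m)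
    t = proj₁ tree

    size≤ : size t ≤ 2 ^ h
    size≤ = ≤-trans (≤-reflexive (trans (size≡∑ t) (trans (∑-cong (proj₁ (proj₂ tree))) (∑-1 (suc m))))) m≤2^h

    open Balance {n₀ k} {suc m} using (module Decide)
    -- `run t ⊥` merely supplies an argument: the balanced tree denotes a constant function.
    open Decide t h size≤ (run t ⊥) (accepts {n} {suc m} φᶜ) public

    decide-exact : Exact (keys decide)
    decide-exact e = trans (decide-occ e) (proj₁ (proj₂ tree) e)

    P⟷decide : ∀ S → P G S ⟷ eval decide (res (keys decide) S) ≡ zero
    P⟷decide S = ⟷-trans (P⟷φ G S) (⟷-trans (Sat⟷ G φ (S ∷ []) ((⊥ , S) ∷ []) (λ { (here refl) → refl }))
      (⟷-trans (⟷-sym (accepts-type build-builds φᶜ ((⊥ , S) ∷ []))) (⟷-trans (verdict⟷ (accepts {n} {suc m} φᶜ (typeOf term S))) ((λ e → trans eq e) , (λ e → trans (sym eq) e)))))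
      where
      eq : eval decide (res (keys decide) S) ≡ (if accepts {n} {suc m} φᶜ (typeOf term S) then zero else suc zero)
      eq = trans (decide-eval S) (cong (λ s → if accepts {n} {suc m} φᶜ s then zero else suc zero) (proj₂ (proj₂ tree) S))
      verdict⟷ : ∀ b → b ≡ true ⟷ _≡_ {A = Fin (N k)} (if b then zero else suc zero) zero
      verdict⟷ true  = (λ _ → refl) , (λ _ → refl)
      verdict⟷ false = (λ ()) , (λ ())

  module _ (k n m : ℕ) (2≤n : 2 ≤ n) (m≤n² : suc m ≤ n * n) where
    open Parameters n (suc m) (N k) 2≤n m≤n²
    open Scheme (N k) (suc m) (manyPrimes a)

    main : IsolationScheme P k n (suc m) R
    main = seeds L , weights L
         , ≤-trans (m^n>0 2 (L * a)) (≤-reflexive (sym (seeds≡ L)))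
         , ≤-trans (≤-reflexive (trans (cong ⌈log₂_⌉ (seeds≡ L)) (⌈log₂2^n⌉≡n (L * a)))) bits≤
         , (λ i e → ≤-trans (<⇒≤ (weights< L i e)) weight-bound)
         , isolating
      where
      isolating : ∀ (G : Graph n (suc m)) → TreewidthAtMost k G →
        Σ (Subset (seeds L)) λ I → (seeds L ≤ 2 * ∣ I ∣) × (∀ i → i ∈ₛ I → Isolates (weights L i) (P G))
      isolating G td = I , half , λ i i∈ →
          Iso⇒Isolates (weights L i) x exact (AllIso⇒Iso x (iso i i∈) x≤L) zero (P G)
            (λ S → proj₁ (P⟷decide G td h m≤2^h S)) (λ S → proj₂ (P⟷decide G td h m≤2^h S))
        where
        x = decide G td h m≤2^h
        exact = decide-exact G td h m≤2^h
        x≤L : depth x ≤ L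
        x≤L = decide-depth G td h m≤2^h
        few : nodes x * badPrimes (N k) (suc m) ≤ 2 ^ L * badPrimes (N k) (suc m)
        few = *-monoˡ-≤ (badPrimes (N k) (suc m)) (≤-trans (<⇒≤ (nodes<2^depth x)) (^-monoʳ-≤ 2 x≤L))
        -- Each of the L levels loses at most one of 2L parts, so L parts, that is half of the
        -- seeds, remain.
        open Count (2 * L) x (exact⇒linear (keys x) exact) (2 ^ L * badPrimes (N k) (suc m)) few enough
        goodSeeds = good L L (cong (L +_) (sym (+-identityʳ L)))
        I = proj₁ goodSeeds
        iso = proj₂ (proj₂ goodSeeds)
        half : seeds L ≤ 2 * ∣ I ∣
        half = *-cancelʳ-≤ (seeds L) (2 * ∣ I ∣) L (≤-trans (proj₁ (proj₂ goodSeeds)) (≤-reflexive (rearrange ∣ I ∣ L)))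
          where
          rearrange : ∀ i l → i * (2 * l) ≡ 2 * i * l
          rearrange = solve-∀

  scheme : ∀ k n m → IsolationScheme P k n m (72 * N k * ⌈log₂ n ⌉ + 496 * (⌈log₂ n ⌉ ^ 2 + 1))
  scheme k n zero    = trivial {k = k} λ { G [] [] _ _ _ _ → refl }
  scheme k n (suc m) with 2 ≤? n | suc m ≤? n * n
  ... | no 2≰n  | _        = trivial {k = k} λ G → contradiction (2≤vertices G) 2≰n
  ... | yes _   | no m≰n²  = trivial {k = k} λ G → contradiction (edges≤ G) m≰n²
  ... | yes 2≤n | yes m≤n² = main k n m 2≤n m≤n²

theorem1p5 : (P : EdgeSelectionProblem) → CMSO₂Definable P →
    Σ (ℕ → ℕ) λ f → Σ ℕ λ c → ∀ k n m →
    IsolationScheme P k n m (f k * ⌈log₂ n ⌉ + c * (⌈log₂ n ⌉ ^ 2 + 1))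
theorem1p5 P (φ , P⟷φ) = (λ k → 72 * N k) , 496 , scheme
  where open Main P φ P⟷φ
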